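{- Let $p$ be a prime, $k \in \mathbb{N}$, and $G_1, \dots, G_k$ finite-dimensional vector spaces over $\mathbb{F}_p$. For $\varepsilon > 0$ set $b(\varepsilon) = (\varepsilon/1000)^{2^{2k+2}}$ and $n(\varepsilon) = \lceil 10 \varepsilon^{ -2^{k+1}} \rceil$. Let $f \colon G_1 \times \cdots \times G_k \to \mathbb{D}$ and let $\mu_1, \dots, \mu_n \in \operatorname{Spec}^{\mathrm{ml}}_{\varepsilon}(f)$ be multilinear forms such that $\operatorname{bias}(\mu_i - \mu_j) \leq b(\varepsilon)$ for all $i \neq j$. Then $n < n(\varepsilon)$.
   Context: $\mathbb{D} = \{z \in \mathbb{C} : |z| \leq 1\}$, $\omega = e^{2\pi i/p}$, $\mathbb{E}$ is the uniform average. For a multilinear form $\beta$ on $G_1 \times \cdots \times G_k$, $\operatorname{bias}\beta = \mathbb{E}_{x_1 \in G_1, \dots, x_k \in G_k}\omega^{\beta(x_1, \dots, x_k)}$. The box norm of $g \colon G_1 \times \cdots \times G_k \to \mathbb{C}$ is given by $\|g\|_{\square^k}^{2^k} = \mathbb{E}_{x_1, y_1 \in G_1, \dots, x_k, y_k \in G_k} \prod_{I \subseteq [k]} \operatorname{Conj}^{|I|} g(x_I, y_{[k]\setminus I})$, where $(x_I, y_{[k]\setminus I})$ has $i$-th coordinate $x_i$ if $i \in I$ and $y_i$ otherwise, and $\operatorname{Conj}^j$ is complex conjugation applied $j$ times. $\operatorname{Spec}^{\mathrm{ml}}_{\varepsilon}(f) = \{\mu \text{ multilinear form } G_1 \times \cdots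 \times G_k \to \mathbb{F}_p : \|f\omega^{\mu}\|_{\square^k} \geq \varepsilon\}$. -}

module Defs where

open import Algebra.Bundles using (RawRing; CommutativeRing)
open import Algebra.Module.Bundles using (Module)
import Algebra.Definitions.RawMonoid as RawMonoidDefs
import Algebra.Definitions.RawSemiring as RawSemiringDefs
import Algebra.Module.Construct.TensorUnit as TensorUnit
open import Algebra.Module.Morphism.Structures using (IsModuleHomomorphism)
open import Data.Bool.Base using (if_then_else_)
open import Data.Fin.Base using (Fin; zero; suc)
open import Data.Fin.Properties using (∀-cons)
open import Data.Fin.Subset using (Subset; inside; outside; ∣_∣)
open import Data.Integer.Base as ℤ using (ℤ; +_; 0ℤ; 1ℤ)
open import Data.Integer.Divisibility.Signed as ℤ∣ using (_∣_)
open import Data.Integer.DivMod using (_%ℕ_)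
import Data.Integer.Properties as ℤₚ
import Data.Integer.Solver as ℤSolver
open import Data.List.Base using (List; []; _∷_; map; foldr; length; upTo; cartesianProductWith)
open import Data.Nat.Base as ℕ using (ℕ; zero; suc)
open import Data.Nat.GeneralisedArithmetic using (iterate)
import Data.Nat.Properties as ℕₚ
open import Data.Nat.Primality using (Prime; prime⇒nonZero)
open import Data.Product.Base using (∃; ∃-syntax; _×_; _,_)
open import Data.Rational.Base as ℚ using (ℚ; 0ℚ; 1ℚ; ½)
import Data.Rational.Properties as ℚₚ
import Data.Rational.Solver as ℚSolver
open import Data.Vec.Base using (lookup; []; _∷_)
open import Level using (Level; _⊔_)
open import Relation.Binary.PropositionalEquality
open import Relation.Binary.Structures using (IsEquivalence)

private
  variable
    a b : Level

-- Real numbers: Cauchy sequences of rationals (the modulus is the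
-- witness inside `cauchy`), compared by the setoid equality _≈ʳ_.

record ℝ : Set where
  field
    seq    : ℕ → ℚ
    cauchy : ∀ ε → 0ℚ ℚ.< ε →
             ∃[ N ] (∀ m n → N ℕ.≤ m → N ℕ.≤ n → ℚ.∣ seq m ℚ.- seq n ∣ ℚ.< ε)

open ℝ public

infix 4 _≈ʳ_ _≤ʳ_ _<ʳ_

_≈ʳ_ : ℝ → ℝ → Set
x ≈ʳ y = ∀ ε → 0ℚ ℚ.< ε → ∃[ N ] (∀ n → N ℕ.≤ n → ℚ.∣ seq x n ℚ.- seq y n ∣ ℚ.< ε)

_≤ʳ_ : ℝ → ℝ → Set
x ≤ʳ y = ∀ ε → 0ℚ ℚ.< ε → ∃[ N ] (∀ n → N ℕ.≤ n → seq x n ℚ.≤ seq y n ℚ.+ ε)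

_<ʳ_ : ℝ → ℝ → Set
x <ʳ y = ∃[ δ ] (0ℚ ℚ.< δ × ∃[ N ] (∀ n → N ℕ.≤ n → seq x n ℚ.+ δ ℚ.≤ seq y n))

private
  module _ where
    open ℚSolver.+-*-Solver using (solve; _:+_; _:*_; :-_; _:-_; _:=_)

    sub-add : ∀ u v → u ≡ (u ℚ.- v) ℚ.+ v
    sub-add = solve 2 (λ u v → u := (u :- v) :+ v) refl

    add-difference : ∀ a b c d → (a ℚ.- c) ℚ.+ (b ℚ.- d) ≡ (a ℚ.+ b) ℚ.- (c ℚ.+ d)
    add-difference = solve 4 (λ a b c d → (a :- c) :+ (b :- d) := (a :+ b) :- (c :+ d)) refl

    neg-difference : ∀ a b → b ℚ.- a ≡ ℚ.- a ℚ.- ℚ.- b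
    neg-difference = solve 2 (λ a b → b :- a := (:- a) :- (:- b)) refl

    mul-difference : ∀ a b c d → a ℚ.* (b ℚ.- d) ℚ.+ d ℚ.* (a ℚ.- c) ≡ a ℚ.* b ℚ.- c ℚ.* d
    mul-difference = solve 4 (λ a b c d → a :* (b :- d) :+ d :* (a :- c) := a :* b :- c :* d) refl

    inv-difference : ∀ a b c d → a ℚ.* (b ℚ.* (c ℚ.- d)) ≡ c ℚ.* b ℚ.* a ℚ.- d ℚ.* a ℚ.* b
    inv-difference = solve 4 (λ a b c d → a :* (b :* (c :- d)) := c :* b :* a :- d :* a :* b) refl

    swap : ∀ q r s → q ℚ.* (r ℚ.* s) ≡ r ℚ.* (q ℚ.* s)
    swap = solve 3 (λ q r s → q :* (r :* s) := r :* (q :* s)) refl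

    regroup : ∀ d e r → e ℚ.* (e ℚ.* (d ℚ.* (d ℚ.* r))) ≡ d ℚ.* (d ℚ.* (r ℚ.* e) ℚ.* e)
    regroup = solve 3 (λ d e r → e :* (e :* (d :* (d :* r))) := d :* (d :* (r :* e) :* e)) refl

  pos* : ∀ {x y} → 0ℚ ℚ.< x → 0ℚ ℚ.< y → 0ℚ ℚ.< x ℚ.* y
  pos* {x} {y} 0<x 0<y = ℚₚ.positive⁻¹ _ {{ℚₚ.pos*pos⇒pos x {{ℚ.positive 0<x}} y {{ℚ.positive 0<y}}}}

  half-pos : ∀ {ε} → 0ℚ ℚ.< ε → 0ℚ ℚ.< ½ ℚ.* ε
  half-pos = pos* (ℚₚ.positive⁻¹ ½)

  halves : ∀ ε → ½ ℚ.* ε ℚ.+ ½ ℚ.* ε ≡ ε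
  halves ε = trans (sym (ℚₚ.*-distribʳ-+ ε ½ ½)) (ℚₚ.*-identityˡ ε)

  recip : ∀ q → 0ℚ ℚ.< q → ℚ
  recip q 0<q = ℚ.1/_ q {{ℚ.>-nonZero 0<q}}

  recip-pos : ∀ q (0<q : 0ℚ ℚ.< q) → 0ℚ ℚ.< recip q 0<q
  recip-pos q 0<q = ℚₚ.positive⁻¹ _ {{ℚₚ.1/pos⇒pos q {{ℚ.positive 0<q}}}}

  recip-inverse : ∀ q (0<q : 0ℚ ℚ.< q) → q ℚ.* recip q 0<q ≡ 1ℚ
  recip-inverse q 0<q = ℚₚ.*-inverseʳ q {{ℚ.>-nonZero 0<q}}

  cancel-recip : ∀ q (0<q : 0ℚ ℚ.< q) r → q ℚ.* (r ℚ.* recip q 0<q) ≡ r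
  cancel-recip q 0<q r = begin
    q ℚ.* (r ℚ.* recip q 0<q)
      ≡⟨ swap q r (recip q 0<q) ⟩
    r ℚ.* (q ℚ.* recip q 0<q)
      ≡⟨ cong (r ℚ.*_) (recip-inverse q 0<q) ⟩
    r ℚ.* 1ℚ
      ≡⟨ ℚₚ.*-identityʳ r ⟩
    r ∎
    where open ≡-Reasoning

  *-mono-abs : ∀ {B ε} u v → 0ℚ ℚ.< B → ℚ.∣ u ∣ ℚ.≤ B → ℚ.∣ v ∣ ℚ.< ε →
               ℚ.∣ u ℚ.* v ∣ ℚ.< B ℚ.* ε
  *-mono-abs {B} {ε} u v 0<B u≤B v<ε = begin-strict
    ℚ.∣ u ℚ.* v ∣         ≡⟨ ℚₚ.∣p*q∣≡∣p∣*∣q∣ u v ⟩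
    ℚ.∣ u ∣ ℚ.* ℚ.∣ v ∣   ≤⟨ ℚₚ.*-monoʳ-≤-nonNeg ℚ.∣ v ∣ {{ℚₚ.∣-∣-nonNeg v}} u≤B ⟩
    B ℚ.* ℚ.∣ v ∣         <⟨ ℚₚ.*-monoʳ-<-pos B {{ℚ.positive 0<B}} v<ε ⟩
    B ℚ.* ε               ∎
    where open ℚₚ.≤-Reasoning

  eventually-bounded : ∀ x → ∃[ B ] (0ℚ ℚ.< B × ∃[ N ] (∀ n → N ℕ.≤ n → ℚ.∣ seq x n ∣ ℚ.≤ B))
  eventually-bounded x with cauchy x 1ℚ (ℚₚ.positive⁻¹ 1ℚ)
  ... | N , close = 1ℚ ℚ.+ ℚ.∣ seq x N ∣ , B>0 , N , bound
    where
    open ℚₚ.≤-Reasoning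
    B>0 = ℚₚ.positive⁻¹ (1ℚ ℚ.+ ℚ.∣ seq x N ∣) {{ℚₚ.pos+nonNeg⇒pos 1ℚ ℚ.∣ seq x N ∣ {{ℚₚ.∣-∣-nonNeg (seq x N)}}}}
    bound : ∀ n → N ℕ.≤ n → ℚ.∣ seq x n ∣ ℚ.≤ 1ℚ ℚ.+ ℚ.∣ seq x N ∣
    bound n N≤n = begin
      ℚ.∣ seq x n ∣
        ≡⟨ cong ℚ.∣_∣ (sub-add (seq x n) (seq x N)) ⟩
      ℚ.∣ (seq x n ℚ.- seq x N) ℚ.+ seq x N ∣
        ≤⟨ ℚₚ.∣p+q∣≤∣p∣+∣q∣ (seq x n ℚ.- seq x N) (seq x N) ⟩
      ℚ.∣ seq x n ℚ.- seq x N ∣ ℚ.+ ℚ.∣ seq x N ∣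
        ≤⟨ ℚₚ.+-monoˡ-≤ ℚ.∣ seq x N ∣ (ℚₚ.<⇒≤ (close n N N≤n ℕₚ.≤-refl)) ⟩
      1ℚ ℚ.+ ℚ.∣ seq x N ∣ ∎

  add-< : ∀ {ε} u v → ℚ.∣ u ∣ ℚ.< ½ ℚ.* ε → ℚ.∣ v ∣ ℚ.< ½ ℚ.* ε → ℚ.∣ u ℚ.+ v ∣ ℚ.< ε
  add-< {ε} u v u< v< = begin-strict
    ℚ.∣ u ℚ.+ v ∣             ≤⟨ ℚₚ.∣p+q∣≤∣p∣+∣q∣ u v ⟩
    ℚ.∣ u ∣ ℚ.+ ℚ.∣ v ∣       <⟨ ℚₚ.+-mono-< u< v< ⟩
    ½ ℚ.* ε ℚ.+ ½ ℚ.* ε       ≡⟨ halves ε ⟩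
    ε                         ∎
    where open ℚₚ.≤-Reasoning

  mul-< : ∀ {B C ε} a b c d (0<B : 0ℚ ℚ.< B) (0<C : 0ℚ ℚ.< C) →
          ℚ.∣ a ∣ ℚ.≤ B → ℚ.∣ d ∣ ℚ.≤ C →
          ℚ.∣ a ℚ.- c ∣ ℚ.< ½ ℚ.* ε ℚ.* recip C 0<C →
          ℚ.∣ b ℚ.- d ∣ ℚ.< ½ ℚ.* ε ℚ.* recip B 0<B →
          ℚ.∣ a ℚ.* b ℚ.- c ℚ.* d ∣ ℚ.< ε
  mul-< {B} {C} {ε} a b c d 0<B 0<C a≤B d≤C a-c< b-d< =
    subst (λ t → ℚ.∣ t ∣ ℚ.< ε) (mul-difference a b c d)
      (add-< u v
        (subst (ℚ.∣ u ∣ ℚ.<_) (cancel-recip B 0<B (½ ℚ.* ε)) (*-mono-abs a (b ℚ.- d) 0<B a≤B b-d<))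
        (subst (ℚ.∣ v ∣ ℚ.<_) (cancel-recip C 0<C (½ ℚ.* ε)) (*-mono-abs d (a ℚ.- c) 0<C d≤C a-c<)))
    where
    u = a ℚ.* (b ℚ.- d)
    v = d ℚ.* (a ℚ.- c)

fromℚ : ℚ → ℝ
fromℚ q = record
  { seq    = λ _ → q
  ; cauchy = λ ε 0<ε → 0 , λ _ _ _ _ → subst (ℚ._< ε) (sym (cong ℚ.∣_∣ (ℚₚ.+-inverseʳ q))) 0<ε
  }

fromℤ : ℤ → ℝ
fromℤ z = fromℚ (z ℚ./ 1)

0ʳ 1ʳ : ℝ
0ʳ = fromℚ 0ℚ
1ʳ = fromℚ 1ℚ

infixl 6 _+ʳ_ _-ʳ_
infixl 7 _*ʳ_
infix  8 -ʳ_

_+ʳ_ : ℝ → ℝ → ℝ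
x +ʳ y = record { seq = λ n → seq x n ℚ.+ seq y n ; cauchy = +-cauchy }
  where
  +-cauchy : ∀ ε → 0ℚ ℚ.< ε → ∃[ N ] (∀ m n → N ℕ.≤ m → N ℕ.≤ n →
             ℚ.∣ (seq x m ℚ.+ seq y m) ℚ.- (seq x n ℚ.+ seq y n) ∣ ℚ.< ε)
  +-cauchy ε 0<ε with cauchy x (½ ℚ.* ε) (half-pos 0<ε) | cauchy y (½ ℚ.* ε) (half-pos 0<ε)
  ... | M , closeˣ | N , closeʸ = M ℕ.⊔ N , λ m n p q →
    subst (λ t → ℚ.∣ t ∣ ℚ.< ε)
      (add-difference (seq x m) (seq y m) (seq x n) (seq y n))
      (add-< (seq x m ℚ.- seq x n) (seq y m ℚ.- seq y n)
        (closeˣ m n (ℕₚ.m⊔n≤o⇒m≤o M N p) (ℕₚ.m⊔n≤o⇒m≤o M N q))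
        (closeʸ m n (ℕₚ.m⊔n≤o⇒n≤o M N p) (ℕₚ.m⊔n≤o⇒n≤o M N q)))

-ʳ_ : ℝ → ℝ
-ʳ x = record { seq = λ n → ℚ.- seq x n ; cauchy = neg-cauchy }
  where
  neg-cauchy : ∀ ε → 0ℚ ℚ.< ε → ∃[ N ] (∀ m n → N ℕ.≤ m → N ℕ.≤ n →
               ℚ.∣ ℚ.- seq x m ℚ.- ℚ.- seq x n ∣ ℚ.< ε)
  neg-cauchy ε 0<ε with cauchy x ε 0<ε
  ... | N , close = N , λ m n p q →
    subst (λ t → ℚ.∣ t ∣ ℚ.< ε)
      (neg-difference (seq x m) (seq x n))
      (close n m q p)

_*ʳ_ : ℝ → ℝ → ℝ
x *ʳ y = record { seq = λ n → seq x n ℚ.* seq y n ; cauchy = *-cauchy }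
  where
  *-cauchy : ∀ ε → 0ℚ ℚ.< ε → ∃[ N ] (∀ m n → N ℕ.≤ m → N ℕ.≤ n →
             ℚ.∣ seq x m ℚ.* seq y m ℚ.- seq x n ℚ.* seq y n ∣ ℚ.< ε)
  *-cauchy ε 0<ε =
    let B , 0<B , K , x≤B = eventually-bounded x
        C , 0<C , L , y≤C = eventually-bounded y
        M , closeˣ = cauchy x (½ ℚ.* ε ℚ.* recip C 0<C) (pos* (half-pos 0<ε) (recip-pos C 0<C))
        N , closeʸ = cauchy y (½ ℚ.* ε ℚ.* recip B 0<B) (pos* (half-pos 0<ε) (recip-pos B 0<B))
    in (K ℕ.⊔ L) ℕ.⊔ (M ℕ.⊔ N) , λ m n p q →
      let p₁ = ℕₚ.m⊔n≤o⇒m≤o (K ℕ.⊔ L) (M ℕ.⊔ N) p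
          p₂ = ℕₚ.m⊔n≤o⇒n≤o (K ℕ.⊔ L) (M ℕ.⊔ N) p
          q₁ = ℕₚ.m⊔n≤o⇒m≤o (K ℕ.⊔ L) (M ℕ.⊔ N) q
          q₂ = ℕₚ.m⊔n≤o⇒n≤o (K ℕ.⊔ L) (M ℕ.⊔ N) q
      in mul-< (seq x m) (seq y m) (seq x n) (seq y n) 0<B 0<C
           (x≤B m (ℕₚ.m⊔n≤o⇒m≤o K L p₁)) (y≤C n (ℕₚ.m⊔n≤o⇒n≤o K L q₁))
           (closeˣ m n (ℕₚ.m⊔n≤o⇒m≤o M N p₂) (ℕₚ.m⊔n≤o⇒m≤o M N q₂))
           (closeʸ m n (ℕₚ.m⊔n≤o⇒n≤o M N p₂) (ℕₚ.m⊔n≤o⇒n≤o M N q₂))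

_-ʳ_ : ℝ → ℝ → ℝ
x -ʳ y = x +ʳ (-ʳ y)

-- The inverse of a positive real; the sequence of inverses is shifted so
-- that every term inverted is bounded below by the witness δ of 0 < x.

inv : (x : ℝ) → 0ʳ <ʳ x → ℝ
inv x (δ , 0<δ , K , δ≤x) = record { seq = x⁻¹ ; cauchy = inv-cauchy }
  where
  above : ∀ n → δ ℚ.≤ seq x (K ℕ.+ n)
  above n = subst (ℚ._≤ seq x (K ℕ.+ n)) (ℚₚ.+-identityˡ δ) (δ≤x (K ℕ.+ n) (ℕₚ.m≤m+n K n))

  x>0 : ∀ n → 0ℚ ℚ.< seq x (K ℕ.+ n)
  x>0 n = ℚₚ.<-≤-trans 0<δ (above n)

  x⁻¹ : ℕ → ℚ
  x⁻¹ n = recip (seq x (K ℕ.+ n)) (x>0 n)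

  δ⁻¹ = recip δ 0<δ

  x⁻¹≤δ⁻¹ : ∀ n → ℚ.∣ x⁻¹ n ∣ ℚ.≤ δ⁻¹
  x⁻¹≤δ⁻¹ n = begin
    ℚ.∣ x⁻¹ n ∣                 ≡⟨ ℚₚ.0≤p⇒∣p∣≡p (ℚₚ.<⇒≤ (recip-pos _ (x>0 n))) ⟩
    x⁻¹ n                       ≡⟨ cancel-recip δ 0<δ (x⁻¹ n) ⟨
    δ ℚ.* (x⁻¹ n ℚ.* δ⁻¹)       ≤⟨ ℚₚ.*-monoʳ-≤-nonNeg (x⁻¹ n ℚ.* δ⁻¹)
                                     {{ℚₚ.pos⇒nonNeg (x⁻¹ n ℚ.* δ⁻¹) {{ℚ.positive
                                       (pos* (recip-pos _ (x>0 n)) (recip-pos δ 0<δ))}}}}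
                                     (above n) ⟩
    seq x (K ℕ.+ n) ℚ.* (x⁻¹ n ℚ.* δ⁻¹)
                                ≡⟨ cong (seq x (K ℕ.+ n) ℚ.*_) (ℚₚ.*-comm (x⁻¹ n) δ⁻¹) ⟩
    seq x (K ℕ.+ n) ℚ.* (δ⁻¹ ℚ.* x⁻¹ n)
                                ≡⟨ cancel-recip (seq x (K ℕ.+ n)) (x>0 n) δ⁻¹ ⟩
    δ⁻¹                         ∎
    where open ℚₚ.≤-Reasoning

  difference : ∀ m n → x⁻¹ m ℚ.* (x⁻¹ n ℚ.* (seq x (K ℕ.+ n) ℚ.- seq x (K ℕ.+ m)))
                       ≡ x⁻¹ m ℚ.- x⁻¹ n
  difference m n = begin
    x⁻¹ m ℚ.* (x⁻¹ n ℚ.* (seq x (K ℕ.+ n) ℚ.- seq x (K ℕ.+ m)))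
      ≡⟨ inv-difference (x⁻¹ m) (x⁻¹ n) (seq x (K ℕ.+ n)) (seq x (K ℕ.+ m)) ⟩
    (seq x (K ℕ.+ n) ℚ.* x⁻¹ n) ℚ.* x⁻¹ m ℚ.- (seq x (K ℕ.+ m) ℚ.* x⁻¹ m) ℚ.* x⁻¹ n
      ≡⟨ cong₂ (λ s t → s ℚ.* x⁻¹ m ℚ.- t ℚ.* x⁻¹ n)
           (recip-inverse _ (x>0 n)) (recip-inverse _ (x>0 m)) ⟩
    1ℚ ℚ.* x⁻¹ m ℚ.- 1ℚ ℚ.* x⁻¹ n
      ≡⟨ cong₂ ℚ._-_ (ℚₚ.*-identityˡ (x⁻¹ m)) (ℚₚ.*-identityˡ (x⁻¹ n)) ⟩
    x⁻¹ m ℚ.- x⁻¹ n ∎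
    where open ≡-Reasoning

  inv-cauchy : ∀ ε → 0ℚ ℚ.< ε → ∃[ N ] (∀ m n → N ℕ.≤ m → N ℕ.≤ n →
               ℚ.∣ x⁻¹ m ℚ.- x⁻¹ n ∣ ℚ.< ε)
  inv-cauchy ε 0<ε with cauchy x (δ ℚ.* (δ ℚ.* ε)) (pos* 0<δ (pos* 0<δ 0<ε))
  ... | N , close = N , λ m n p q →
    subst₂ (λ s t → ℚ.∣ s ∣ ℚ.< t) (difference m n)
      (begin
        δ⁻¹ ℚ.* (δ⁻¹ ℚ.* (δ ℚ.* (δ ℚ.* ε)))
          ≡⟨ regroup δ δ⁻¹ ε ⟩
        δ ℚ.* ((δ ℚ.* (ε ℚ.* δ⁻¹)) ℚ.* δ⁻¹)
          ≡⟨ cancel-recip δ 0<δ _ ⟩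
        δ ℚ.* (ε ℚ.* δ⁻¹)
          ≡⟨ cancel-recip δ 0<δ ε ⟩
        ε ∎)
      (*-mono-abs (x⁻¹ m) _ (recip-pos δ 0<δ) (x⁻¹≤δ⁻¹ m)
        (*-mono-abs (x⁻¹ n) _ (recip-pos δ 0<δ) (x⁻¹≤δ⁻¹ n)
          (close (K ℕ.+ n) (K ℕ.+ m)
            (ℕₚ.≤-trans q (ℕₚ.m≤n+m n K)) (ℕₚ.≤-trans p (ℕₚ.m≤n+m m K)))))
    where open ≡-Reasoning

ℝ-rawRing : RawRing _ _
ℝ-rawRing = record
  { Carrier = ℝ ; _≈_ = _≈ʳ_ ; _+_ = _+ʳ_ ; _*_ = _*ʳ_ ; -_ = -ʳ_ ; 0# = 0ʳ ; 1# = 1ʳ }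

open RawSemiringDefs (RawRing.rawSemiring ℝ-rawRing) public using () renaming (_^_ to _^ʳ_)

-- ⌈x⌉ is the least integer that is at least x.

IsCeiling : ℝ → ℤ → Set
IsCeiling x N = x ≤ʳ fromℤ N × (∀ M → x ≤ʳ fromℤ M → N ℤ.≤ M)

record ℂ : Set where
  constructor _+i_
  field
    re im : ℝ

open ℂ public

infix 4 _≈ᶜ_
infix 5 _+i_
infixl 6 _+ᶜ_
infixl 7 _*ᶜ_

_≈ᶜ_ : ℂ → ℂ → Set
z ≈ᶜ w = re z ≈ʳ re w × im z ≈ʳ im w

fromℝ : ℝ → ℂ
fromℝ x = x +i 0ʳ

_+ᶜ_ _*ᶜ_ : ℂ → ℂ → ℂ
z +ᶜ w = (re z +ʳ re w) +i (im z +ʳ im w)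
z *ᶜ w = (re z *ʳ re w -ʳ im z *ʳ im w) +i (re z *ʳ im w +ʳ im z *ʳ re w)

-ᶜ_ conj : ℂ → ℂ
-ᶜ z = (-ʳ re z) +i (-ʳ im z)
conj z = re z +i (-ʳ im z)

∣_∣² : ℂ → ℝ
∣ z ∣² = re z *ʳ re z +ʳ im z *ʳ im z

InUnitDisc : ℂ → Set
InUnitDisc z = ∣ z ∣² ≤ʳ 1ʳ

ℂ-rawRing : RawRing _ _
ℂ-rawRing = record
  { Carrier = ℂ ; _≈_ = _≈ᶜ_ ; _+_ = _+ᶜ_ ; _*_ = _*ᶜ_ ; -_ = -ᶜ_
  ; 0# = fromℝ 0ʳ ; 1# = fromℝ 1ʳ }

open RawSemiringDefs (RawRing.rawSemiring ℂ-rawRing) public using () renaming (_^_ to _^ᶜ_)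

infix 4 _⟶_

_⟶_ : (ℕ → ℂ) → ℂ → Set
z ⟶ w = ∀ δ → 0ʳ <ʳ δ → ∃[ N ] (∀ n → N ℕ.≤ n → ∣ z n +ᶜ (-ᶜ w) ∣² <ʳ δ *ʳ δ)

-- w = e^z, through e^z = lim (1 + z/n)ⁿ.

IsExp : ℂ → ℂ → Set
IsExp z w = (λ n → (fromℝ 1ʳ +ᶜ fromℝ (fromℚ (1ℤ ℚ./ suc n)) *ᶜ z) ^ᶜ suc n) ⟶ w

-- 2π is the least positive period of t ↦ e^{it}.

IsPi : ℝ → Set
IsPi π = 0ʳ <ʳ π
       × IsExp (0ʳ +i (fromℤ (+ 2) *ʳ π)) (fromℝ 1ʳ)
       × (∀ t → 0ʳ <ʳ t → IsExp (0ʳ +i t) (fromℝ 1ʳ) → fromℤ (+ 2) *ʳ π ≤ʳ t)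

-- ω = e^{2πi/p}

IsExp2πi/ : (p : ℕ) → .{{ℕ.NonZero p}} → ℂ → Set
IsExp2πi/ p ω = ∃[ π ] (IsPi π × IsExp (0ʳ +i (fromℚ (+ 2 ℚ./ p) *ʳ π)) ω)

𝔼 : {A : Set a} → List A → (A → ℂ) → ℂ
𝔼 []          g = fromℝ 0ʳ
𝔼 xs@(_ ∷ ys) g =
  fromℝ (fromℚ (1ℤ ℚ./ suc (length ys))) *ᶜ foldr _+ᶜ_ (fromℝ 0ʳ) (map g xs)

-- All dependent tuples with i-th entry drawn from the i-th list.

tuples : ∀ {k} {A : Fin k → Set a} → (∀ i → List (A i)) → List (∀ i → A i)
tuples {k = zero}          L = (λ ()) ∷ []
tuples {k = suc _} {A = A} L = cartesianProductWith (∀-cons {P = A}) (L zero) (tuples (λ i → L (suc i)))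

infix 9 _[_≔_]

_[_≔_] : ∀ {k} {A : Fin k → Set a} → (∀ i → A i) → ∀ i → A i → ∀ i → A i
(x [ zero  ≔ u ]) zero    = u
(x [ zero  ≔ u ]) (suc j) = x (suc j)
(x [ suc i ≔ u ]) zero    = x zero
(x [ suc i ≔ u ]) (suc j) = ((λ l → x (suc l)) [ i ≔ u ]) j

subsets : ∀ k → List (Subset k)
subsets zero    = [] ∷ []
subsets (suc k) = cartesianProductWith _∷_ (outside ∷ inside ∷ []) (subsets k)

-- 𝔽 p is ℤ with equality modulo p; it is a field when p is prime.

𝔽 : ℕ → CommutativeRing _ _
𝔽 p = record
  { Carrier = ℤ
  ; _≈_ = _≈_
  ; _+_ = ℤ._+_
  ; _*_ = ℤ._*_
  ; -_ = ℤ.-_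
  ; 0# = 0ℤ
  ; 1# = 1ℤ
  ; isCommutativeRing = record
    { isRing = record
      { +-isAbelianGroup = record
        { isGroup = record
          { isMonoid = record
            { isSemigroup = record
              { isMagma = record { isEquivalence = isEquiv ; ∙-cong = λ {x} {y} {u} {v} → +-cong {x} {y} {u} {v} }
              ; assoc = λ x y z → reflexive (ℤₚ.+-assoc x y z)
              }
            ; identity = (λ x → reflexive (ℤₚ.+-identityˡ x)) , (λ x → reflexive (ℤₚ.+-identityʳ x))
            }
          ; inverse = (λ x → reflexive (ℤₚ.+-inverseˡ x)) , (λ x → reflexive (ℤₚ.+-inverseʳ x))
          ; ⁻¹-cong = λ {x} {y} → neg-cong {x} {y}
          }
        ; comm = λ x y → reflexive (ℤₚ.+-comm x y)
        }
      ; *-cong = λ {x} {y} {u} {v} → *-cong {x} {y} {u} {v}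
      ; *-assoc = λ x y z → reflexive (ℤₚ.*-assoc x y z)
      ; *-identity = (λ x → reflexive (ℤₚ.*-identityˡ x)) , (λ x → reflexive (ℤₚ.*-identityʳ x))
      ; distrib = (λ x y z → reflexive (ℤₚ.*-distribˡ-+ x y z)) , (λ x y z → reflexive (ℤₚ.*-distribʳ-+ x y z))
      }
    ; *-comm = λ x y → reflexive (ℤₚ.*-comm x y)
    }
  }
  where
  module S = ℤSolver.+-*-Solver

  _≈_ : ℤ → ℤ → Set
  x ≈ y = + p ∣ x ℤ.- y

  reflexive : ∀ {x y} → x ≡ y → x ≈ y
  reflexive {x} refl = ℤ∣.divides 0ℤ (ℤₚ.+-inverseʳ x)

  isEquiv : IsEquivalence _≈_
  isEquiv = record
    { refl  = λ {x} → reflexive {x} refl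
    ; sym   = λ {x} {y} d → subst (+ p ∣_)
                (S.solve 2 (λ x y → S.:- (x S.:- y) S.:= y S.:- x) refl x y) (ℤ∣.∣m⇒∣-m d)
    ; trans = λ {x} {y} {z} d e → subst (+ p ∣_)
                (S.solve 3 (λ x y z → (x S.:- y) S.:+ (y S.:- z) S.:= x S.:- z) refl x y z)
                (ℤ∣.∣m∣n⇒∣m+n d e)
    }

  +-cong : ∀ {x y u v} → x ≈ y → u ≈ v → (x ℤ.+ u) ≈ (y ℤ.+ v)
  +-cong {x} {y} {u} {v} d e = subst (+ p ∣_)
    (S.solve 4 (λ x y u v → (x S.:- y) S.:+ (u S.:- v) S.:= (x S.:+ u) S.:- (y S.:+ v)) refl x y u v)
    (ℤ∣.∣m∣n⇒∣m+n d e)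

  neg-cong : ∀ {x y} → x ≈ y → (ℤ.- x) ≈ (ℤ.- y)
  neg-cong {x} {y} d = subst (+ p ∣_)
    (S.solve 2 (λ x y → S.:- (x S.:- y) S.:= (S.:- x) S.:- (S.:- y)) refl x y) (ℤ∣.∣m⇒∣-m d)

  *-cong : ∀ {x y u v} → x ≈ y → u ≈ v → (x ℤ.* u) ≈ (y ℤ.* v)
  *-cong {x} {y} {u} {v} d e = subst (+ p ∣_)
    (S.solve 4 (λ x y u v → (x S.:- y) S.:* u S.:+ y S.:* (u S.:- v) S.:= x S.:* u S.:- y S.:* v)
      refl x y u v)
    (ℤ∣.∣m∣n⇒∣m+n (ℤ∣.∣m⇒∣m*n u d) (ℤ∣.∣n⇒∣m*n y e))

module _ {p : ℕ} (V : Module (𝔽 p) a b) where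
  open Module V

  linComb : ∀ {d} → (Fin d → Carrierᴹ) → (Fin d → ℤ) → Carrierᴹ
  linComb v c = RawMonoidDefs.sum +ᴹ-rawMonoid (λ j → c j *ₗ v j)

  record FiniteDimensional : Set (a ⊔ b) where
    field
      dim         : ℕ
      basis       : Fin dim → Carrierᴹ
      spanning    : ∀ v → ∃[ c ] v ≈ᴹ linComb basis c
      independent : ∀ c → linComb basis c ≈ᴹ 0ᴹ → ∀ j → CommutativeRing._≈_ (𝔽 p) (c j) 0ℤ

  -- Each vector exactly once, as a combination of the basis with
  -- coefficients in {0, …, p - 1}.

  elements : FiniteDimensional → List Carrierᴹ
  elements fd = map (linComb basis) (tuples (λ _ → map +_ (upTo p)))
    where open FiniteDimensional fd

Tuple : ∀ {p k} → (Fin k → Module (𝔽 p) a b) → Set a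
Tuple G = ∀ i → Module.Carrierᴹ (G i)

module _ {p k : ℕ} (G : Fin k → Module (𝔽 p) a b) where

  infix 4 _≋_

  _≋_ : Tuple G → Tuple G → Set b
  x ≋ y = ∀ i → Module._≈ᴹ_ (G i) (x i) (y i)

  record MultilinearForm : Set (a ⊔ b) where
    field
      ⟦_⟧    : Tuple G → ℤ
      ⟦⟧-cong : ∀ {x y} → x ≋ y → CommutativeRing._≈_ (𝔽 p) (⟦ x ⟧) (⟦ y ⟧)
      linear : ∀ i x → IsModuleHomomorphism
                 (Module.rawModule (G i))
                 (TensorUnit.rawModule {R = CommutativeRing.rawRing (𝔽 p)})
                 (λ u → ⟦ x [ i ≔ u ] ⟧)

open MultilinearForm public

module Box (p : ℕ) .{{_ : ℕ.NonZero p}} (ω : ℂ)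
           {k : ℕ} (G : Fin k → Module (𝔽 p) a b) (fd : ∀ i → FiniteDimensional (G i)) where

  points : List (Tuple G)
  points = tuples (λ i → elements (G i) (fd i))

  ω^_ : (Tuple G → ℤ) → Tuple G → ℂ
  (ω^ β) x = ω ^ᶜ (β x %ℕ p)

  -- For multilinear β in k ≥ 1 variables this is real (and non-negative),
  -- so it is compared with real numbers through its real part.

  bias : (Tuple G → ℤ) → ℂ
  bias β = 𝔼 points (ω^ β)

  mix : Subset k → Tuple G → Tuple G → Tuple G
  mix I x y i = if lookup I i then x i else y i

  boxAverage : (Tuple G → ℂ) → ℂ
  boxAverage g = 𝔼 points λ x → 𝔼 points λ y →
    foldr _*ᶜ_ (fromℝ 1ʳ) (map (λ I → iterate conj (g (mix I x y)) ∣ I ∣) (subsets k))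

  -- r = ‖g‖: the non-negative 2^k-th root of the box average.

  IsBoxNorm : (Tuple G → ℂ) → ℝ → Set
  IsBoxNorm g r = 0ʳ ≤ʳ r × fromℝ (r ^ʳ (2 ℕ.^ k)) ≈ᶜ boxAverage g

  Specᵐˡ : ℝ → (Tuple G → ℂ) → MultilinearForm G → Set
  Specᵐˡ ε f μ = ∃[ r ] (IsBoxNorm (λ x → f x *ᶜ (ω^ ⟦ μ ⟧) x) r × ε ≤ʳ r)

{-# OPTIONS --safe #-}
module Submission where

-- Expanding the box average of f ω^μ, the phases of a multilinear μ telescope
-- to ω^{μ(y−x)}, so a form in the spectrum correlates: E F(x,y) ω^{μ(y−x)} ≥ ε^{2^k}
-- with |F| ≤ 1 the box product of f. Summing over μ₁, …, μₙ, Cauchy–Schwarz gives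
--   n² e ≤ E |∑ᵢ ω^{μᵢ(y−x)}|² = ∑ᵢⱼ bias(μᵢ − μⱼ) ≤ n + n² b(ε),  e = ε^{2^{k+1}}.
-- For n = 1 this says e ≤ 1, whence b(ε) ≤ e/2 and n e ≤ 2 < 10.
-- The only facts needed about ω are ω^p = 1, because the p-th powers of the
-- approximants of e^{2πi/p} form a subsequence of those of e^{2πi}, and |ω| = 1,
-- which follows.

open import Defs
open import Algebra.Bundles using (CommutativeMonoid; CommutativeRing)
open import Algebra.Bundles.Raw using (RawMonoid; RawRing; RawSemiring)
import Algebra.Consequences.Setoid as Consequences
import Algebra.Definitions.RawMonoid as RawMonoidDefs
open import Algebra.Module.Bundles using (Module)
import Algebra.Module.Morphism.Structures as Morphisms
import Algebra.Properties.CommutativeMonoid.Sum as FinSum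
import Algebra.Properties.CommutativeSemigroup as CommutativeSemigroupProperties
import Algebra.Properties.CommutativeSemiring.Exp as CommutativeExp
import Algebra.Properties.Group as GroupProperties
import Algebra.Properties.Ring as RingProperties
import Algebra.Properties.Semiring.Exp as Exp
import Algebra.Properties.Semiring.Sum as SemiringSum
open import Data.Bool.Base using (if_then_else_)
open import Data.Fin.Base using (Fin; zero; suc; punchIn)
open import Data.Fin.Properties using (∀-cons; punchInᵢ≢i)
open import Data.Fin.Subset using (Subset; inside; outside; ∣_∣)
open import Data.Integer.Base as ℤ using (ℤ; +_; -[1+_]; 0ℤ; 1ℤ)
open import Data.Integer.Divisibility.Signed using (divides)
open import Data.Integer.DivMod using (_%ℕ_; _/ℕ_; a≡a%ℕn+[a/ℕn]*n)
import Data.Integer.Properties as ℤₚ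
import Data.Integer.Solver as ℤSolver
open import Data.List.Base using (List; []; _∷_; _++_; map; foldr; length; upTo; applyUpTo; cartesianProductWith)
open import Data.Nat.Base as ℕ using (ℕ; zero; suc; _+_; _*_; _^_)
open import Data.Nat.GeneralisedArithmetic using (fold; iterate)
open import Data.Nat.Primality using (Prime; prime⇒nonZero)
import Data.Nat.Properties as ℕₚ
open import Data.Product.Base using (∃-syntax; _×_; _,_; proj₁; proj₂)
open import Data.Rational.Base as ℚ using (ℚ; 0ℚ; 1ℚ; ½)
import Data.Rational.Properties as ℚₚ
import Data.Rational.Solver as ℚSolver
import Data.Rational.Unnormalised.Base as ℚᵘ
import Data.Rational.Unnormalised.Properties as ℚᵘₚ
open import Data.Sum.Base using (inj₁; inj₂)
open import Data.Unit.Base using (tt)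
open import Data.Vec.Base using (lookup; []; _∷_)
open import Function.Base using (_∘_; id)
open import Level using (Level; 0ℓ)
open import Relation.Binary.Bundles using (Preorder; Setoid)
open import Relation.Binary.Core using (Rel)
open import Relation.Binary.PropositionalEquality as ≡ using (_≡_; _≢_; cong; subst)
import Relation.Binary.Reasoning.Preorder as PreorderReasoning
import Relation.Binary.Reasoning.Setoid as SetoidReasoning
open import Relation.Binary.Structures using (IsEquivalence)
open import Relation.Nullary using (¬_; yes; no; contradiction)
open import Relation.Nullary.Decidable using (from-yes; from-no; decidable-stable)

open ℚSolver.+-*-Solver using (solve; con; _:+_; _:*_; :-_; _:-_; _:=_)
module ℤS = ℤSolver.+-*-Solver

-- Multilinearity moves all dependence on μ into the phase ω^{μ(y-x)}, so the same F tests every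
-- form and one Cauchy-Schwarz inequality treats all of them together. For fixed x the difference z
-- = y - x runs over all points, hence the average of a product of two phases is exactly the real
-- part of a bias of a difference of forms, the quantity that the hypothesis controls.
--
-- The order on Cauchy reals is not decidable and roots would have to be constructed. The argument
-- is therefore arranged so that no root is taken and no two reals are compared by cases: the box
-- norm is used through its 2^k-th power, moduli through their squares, Cauchy-Schwarz through |t F*
-- - A|² ≥ 0. A case distinction occurs only for rationals and integers, and the gap between 2 and
-- 10 absorbs every loss from approximate inequalities.
--
-- Vectors and residues are equal only up to a setoid equality, and averages run over lists of
-- representatives. A translation can leave such a list, so the change of variables holds only for
-- sums of functions that respect the equality.

private
  variable
    a b ℓ : Level
    A B D : Set a

-- Real numbers as an ordered ring

half-positive : ∀ {ε} → 0ℚ ℚ.< ε → 0ℚ ℚ.< ½ ℚ.* ε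
half-positive {ε} 0<ε = subst (ℚ._< ½ ℚ.* ε) (ℚₚ.*-zeroʳ ½) (ℚₚ.*-monoʳ-<-pos ½ 0<ε)

half+half : ∀ ε → ½ ℚ.* ε ℚ.+ ½ ℚ.* ε ≡ ε
half+half = solve 1 (λ ε → con ½ :* ε :+ con ½ :* ε := ε) ≡.refl

half< : ∀ {ε} → 0ℚ ℚ.< ε → ½ ℚ.* ε ℚ.< ε
half< {ε} 0<ε = ≡.subst₂ ℚ._<_ (ℚₚ.+-identityʳ (½ ℚ.* ε)) (half+half ε)
  (ℚₚ.+-monoʳ-< (½ ℚ.* ε) (half-positive 0<ε))

∣∣-≤ : ∀ {q r} → q ℚ.≤ r → ℚ.- q ℚ.≤ r → ℚ.∣ q ∣ ℚ.≤ r
∣∣-≤ {q} q≤r -q≤r with ℚₚ.∣p∣≡p∨∣p∣≡-p q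
... | inj₁ e = subst (ℚ._≤ _) (≡.sym e) q≤r
... | inj₂ e = subst (ℚ._≤ _) (≡.sym e) -q≤r

≤-∣∣ : ∀ q → q ℚ.≤ ℚ.∣ q ∣
≤-∣∣ q with ℚₚ.∣p∣≡p∨∣p∣≡-p q | ℚₚ.≤-total 0ℚ q
... | inj₁ e | _        = ℚₚ.≤-reflexive (≡.sym e)
... | inj₂ _ | inj₁ 0≤q = ℚₚ.≤-reflexive (≡.sym (ℚₚ.0≤p⇒∣p∣≡p 0≤q))
... | inj₂ _ | inj₂ q≤0 = ℚₚ.≤-trans q≤0 (ℚₚ.0≤∣p∣ q)

∣+∣-< : ∀ {ε} u v → ℚ.∣ u ∣ ℚ.< ½ ℚ.* ε → ℚ.∣ v ∣ ℚ.< ½ ℚ.* ε → ℚ.∣ u ℚ.+ v ∣ ℚ.< ε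
∣+∣-< {ε} u v u< v< = ℚₚ.≤-<-trans (ℚₚ.∣p+q∣≤∣p∣+∣q∣ u v)
  (subst (_ ℚ.<_) (half+half ε) (ℚₚ.+-mono-< u< v<))

q≤q+ε : ∀ q {ε} → 0ℚ ℚ.< ε → q ℚ.≤ q ℚ.+ ε
q≤q+ε q {ε} 0<ε = subst (ℚ._≤ q ℚ.+ ε) (ℚₚ.+-identityʳ q) (ℚₚ.+-monoʳ-≤ q (ℚₚ.<⇒≤ 0<ε))

divide : ∀ {ε B} → 0ℚ ℚ.< ε → 0ℚ ℚ.< B → ∃[ δ ] (0ℚ ℚ.< δ × B ℚ.* δ ≡ ε)
divide {ε} {B} 0<ε 0<B = ε ℚ.* r , 0<εr , Bεr≡ε
  where
  r = ℚ.1/_ B {{ℚ.>-nonZero 0<B}}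
  0<εr = ℚₚ.positive⁻¹ _ {{ℚₚ.pos*pos⇒pos ε {{ℚ.positive 0<ε}} r {{ℚₚ.1/pos⇒pos B {{ℚ.positive 0<B}}}}}}
  Bεr≡ε : B ℚ.* (ε ℚ.* r) ≡ ε
  Bεr≡ε = begin
    B ℚ.* (ε ℚ.* r)   ≡⟨ solve 3 (λ b e r → b :* (e :* r) := e :* (b :* r)) ≡.refl B ε r ⟩
    ε ℚ.* (B ℚ.* r)   ≡⟨ cong (ε ℚ.*_) (ℚₚ.*-inverseʳ B {{ℚ.>-nonZero 0<B}}) ⟩
    ε ℚ.* 1ℚ          ≡⟨ ℚₚ.*-identityʳ ε ⟩
    ε                 ∎
    where open ≡.≡-Reasoning

∣*∣-< : ∀ {B δ} u v → 0ℚ ℚ.< B → ℚ.∣ u ∣ ℚ.≤ B → ℚ.∣ v ∣ ℚ.< δ → ℚ.∣ u ℚ.* v ∣ ℚ.< B ℚ.* δ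
∣*∣-< {B} {δ} u v 0<B u≤B v<δ = begin-strict
  ℚ.∣ u ℚ.* v ∣         ≡⟨ ℚₚ.∣p*q∣≡∣p∣*∣q∣ u v ⟩
  ℚ.∣ u ∣ ℚ.* ℚ.∣ v ∣   ≤⟨ ℚₚ.*-monoʳ-≤-nonNeg ℚ.∣ v ∣ {{ℚₚ.∣-∣-nonNeg v}} u≤B ⟩
  B ℚ.* ℚ.∣ v ∣         <⟨ ℚₚ.*-monoʳ-<-pos B {{ℚ.positive 0<B}} v<δ ⟩
  B ℚ.* δ               ∎
  where open ℚₚ.≤-Reasoning

0≤* : ∀ {q r} → 0ℚ ℚ.≤ q → 0ℚ ℚ.≤ r → 0ℚ ℚ.≤ q ℚ.* r
0≤* {q} {r} 0≤q 0≤r =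
  ℚₚ.nonNegative⁻¹ _ {{ℚₚ.nonNeg*nonNeg⇒nonNeg q {{ℚ.nonNegative 0≤q}} r {{ℚ.nonNegative 0≤r}}}}

∣q∣*∣q∣≡q*q : ∀ q → ℚ.∣ q ∣ ℚ.* ℚ.∣ q ∣ ≡ q ℚ.* q
∣q∣*∣q∣≡q*q q with ℚₚ.∣p∣≡p∨∣p∣≡-p q
... | inj₁ e = ≡.cong₂ ℚ._*_ e e
... | inj₂ e = ≡.trans (≡.cong₂ ℚ._*_ e e) (solve 1 (λ q → (:- q) :* (:- q) := q :* q) ≡.refl q)

0≤q*q : ∀ q → 0ℚ ℚ.≤ q ℚ.* q
0≤q*q q = subst (0ℚ ℚ.≤_) (∣q∣*∣q∣≡q*q q) (0≤* (ℚₚ.0≤∣p∣ q) (ℚₚ.0≤∣p∣ q))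

-- Late terms of a nonnegative real are only known to be at least -δ, so their product may fall
-- short by B δ. Splitting on the sign of `u` alone suffices: for u ≥ 0 expand u(v + δ); for u ≤ 0
-- the nonnegative terms -u(B - v) and B(u + δ) add up to the right side.
*-almost-nonNeg : ∀ {u v B δ} → 0ℚ ℚ.≤ δ → 0ℚ ℚ.≤ u ℚ.+ δ → 0ℚ ℚ.≤ v ℚ.+ δ →
                  ℚ.∣ u ∣ ℚ.≤ B → ℚ.∣ v ∣ ℚ.≤ B → 0ℚ ℚ.≤ u ℚ.* v ℚ.+ B ℚ.* δ
*-almost-nonNeg {u} {v} {B} {δ} 0≤δ 0≤u+δ 0≤v+δ u≤B v≤B with ℚₚ.≤-total 0ℚ u
... | inj₁ 0≤u = begin
  0ℚ                               ≤⟨ 0≤* 0≤u 0≤v+δ ⟩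
  u ℚ.* (v ℚ.+ δ)                  ≡⟨ ℚₚ.*-distribˡ-+ u v δ ⟩
  u ℚ.* v ℚ.+ u ℚ.* δ              ≤⟨ ℚₚ.+-monoʳ-≤ (u ℚ.* v) (ℚₚ.*-monoʳ-≤-nonNeg δ {{ℚ.nonNegative 0≤δ}}
                                        (ℚₚ.≤-trans (≤-∣∣ u) u≤B)) ⟩
  u ℚ.* v ℚ.+ B ℚ.* δ              ∎
  where
  open ℚₚ.≤-Reasoning
... | inj₂ u≤0 = begin
  0ℚ                                          ≤⟨ ℚₚ.+-mono-≤ (0≤* 0≤-u 0≤B-v) (0≤* (ℚₚ.≤-trans (ℚₚ.0≤∣p∣ v) v≤B) 0≤u+δ) ⟩
  ℚ.- u ℚ.* (B ℚ.- v) ℚ.+ B ℚ.* (u ℚ.+ δ)     ≡⟨ solve 4 (λ u v B d → (:- u) :* (B :- v) :+ B :* (u :+ d) := u :* v :+ B :* d) ≡.refl u v B δ ⟩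
  u ℚ.* v ℚ.+ B ℚ.* δ                         ∎
  where
  open ℚₚ.≤-Reasoning
  0≤-u : 0ℚ ℚ.≤ ℚ.- u
  0≤-u = ℚₚ.neg-antimono-≤ u≤0
  0≤B-v : 0ℚ ℚ.≤ B ℚ.- v
  0≤B-v = subst (ℚ._≤ B ℚ.- v) (ℚₚ.+-inverseʳ v) (ℚₚ.+-monoˡ-≤ (ℚ.- v) (ℚₚ.≤-trans (≤-∣∣ v) v≤B))

-- The order on ℚ is decidable, so a contradiction replaces the square root.
∣∣-<-from-square : ∀ q {ε} → 0ℚ ℚ.< ε → q ℚ.* q ℚ.< ε ℚ.* ε → ℚ.∣ q ∣ ℚ.< ε
∣∣-<-from-square q {ε} 0<ε q²<ε² with ℚ.∣ q ∣ ℚₚ.<? ε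
... | yes q<ε = q<ε
... | no  q≮ε = contradiction (ℚₚ.<-≤-trans q²<ε² ε²≤q²) (ℚₚ.<-irrefl ≡.refl)
  where
  open ℚₚ.≤-Reasoning
  ε≤q = ℚₚ.≮⇒≥ q≮ε
  ε²≤q² = begin
    ε ℚ.* ε               ≤⟨ ℚₚ.*-monoʳ-≤-nonNeg ε {{ℚ.nonNegative (ℚₚ.<⇒≤ 0<ε)}} ε≤q ⟩
    ℚ.∣ q ∣ ℚ.* ε         ≤⟨ ℚₚ.*-monoˡ-≤-nonNeg ℚ.∣ q ∣ {{ℚₚ.∣-∣-nonNeg q}} ε≤q ⟩
    ℚ.∣ q ∣ ℚ.* ℚ.∣ q ∣   ≡⟨ ∣q∣*∣q∣≡q*q q ⟩
    q ℚ.* q               ∎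

Eventually : (ℕ → Set) → Set
Eventually P = ∃[ N ] (∀ n → N ℕ.≤ n → P n)

eventually₁ : ∀ {P Q} → Eventually P → (∀ n → P n → Q n) → Eventually Q
eventually₁ (N , p) f = N , λ n N≤n → f n (p n N≤n)

eventually₂ : ∀ {P Q R} → Eventually P → Eventually Q → (∀ n → P n → Q n → R n) → Eventually R
eventually₂ (M , p) (N , q) f = M ℕ.⊔ N , λ n l →
  f n (p n (ℕₚ.m⊔n≤o⇒m≤o M N l)) (q n (ℕₚ.m⊔n≤o⇒n≤o M N l))

eventually-∣∣≤ : ∀ x → ∃[ B ] (0ℚ ℚ.< B × Eventually (λ n → ℚ.∣ seq x n ∣ ℚ.≤ B))
eventually-∣∣≤ x with cauchy x 1ℚ (ℚₚ.positive⁻¹ 1ℚ)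
... | N , close = ℚ.∣ c ∣ ℚ.+ 1ℚ , ℚₚ.≤-<-trans (ℚₚ.0≤∣p∣ c) c<c+1 , N , bound
  where
  c = seq x N
  c<c+1 = subst (ℚ._< ℚ.∣ c ∣ ℚ.+ 1ℚ) (ℚₚ.+-identityʳ ℚ.∣ c ∣) (ℚₚ.+-monoʳ-< ℚ.∣ c ∣ (ℚₚ.positive⁻¹ 1ℚ))
  bound : ∀ n → N ℕ.≤ n → ℚ.∣ seq x n ∣ ℚ.≤ ℚ.∣ c ∣ ℚ.+ 1ℚ
  bound n N≤n = begin
    ℚ.∣ seq x n ∣                     ≡⟨ cong ℚ.∣_∣ (solve 2 (λ a c → a := c :+ (a :- c)) ≡.refl (seq x n) c) ⟩
    ℚ.∣ c ℚ.+ (seq x n ℚ.- c) ∣       ≤⟨ ℚₚ.∣p+q∣≤∣p∣+∣q∣ c (seq x n ℚ.- c) ⟩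
    ℚ.∣ c ∣ ℚ.+ ℚ.∣ seq x n ℚ.- c ∣   ≤⟨ ℚₚ.+-monoʳ-≤ ℚ.∣ c ∣ (ℚₚ.<⇒≤ (close n N N≤n ℕₚ.≤-refl)) ⟩
    ℚ.∣ c ∣ ℚ.+ 1ℚ                    ∎
    where open ℚₚ.≤-Reasoning

-- The relations on ℝ unfold to statements about sequences, from which Agda
-- cannot recover the related reals; the records keep them inferable.
infix 4 _≃_ _≼_

record _≃_ (x y : ℝ) : Set where
  constructor mk≃
  field un≃ : x ≈ʳ y
open _≃_

record _≼_ (x y : ℝ) : Set where
  constructor mk≼
  field un≼ : x ≤ʳ y
open _≼_

-- Operations on reals act term by term, so through this lemma every ring identity becomes one in ℚ,
-- within reach of the solver.
pointwise : ∀ {x y} → (∀ n → seq x n ≡ seq y n) → x ≃ y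
pointwise {x} {y} eq = mk≃ λ ε 0<ε → 0 , λ n _ → subst (ℚ._< ε)
  (≡.sym (≡.trans (cong (λ q → ℚ.∣ q ℚ.- seq y n ∣) (eq n)) (cong ℚ.∣_∣ (ℚₚ.+-inverseʳ (seq y n))))) 0<ε

≃-isEquivalence : IsEquivalence _≃_
≃-isEquivalence = record
  { refl  = pointwise λ _ → ≡.refl
  ; sym   = λ {x} {y} (mk≃ p) → mk≃ λ ε 0<ε → eventually₁ (p ε 0<ε) λ n →
      subst (ℚ._< ε) (≡.trans (≡.sym (ℚₚ.∣-p∣≡∣p∣ (seq x n ℚ.- seq y n)))
        (cong ℚ.∣_∣ (solve 2 (λ x y → :- (x :- y) := y :- x) ≡.refl (seq x n) (seq y n))))
  ; trans = λ {x} {y} {z} (mk≃ p) (mk≃ q) → mk≃ λ ε 0<ε →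
      eventually₂ (p _ (half-positive 0<ε)) (q _ (half-positive 0<ε)) λ n x~y y~z →
      subst (λ t → ℚ.∣ t ∣ ℚ.< ε)
        (solve 3 (λ x y z → (x :- y) :+ (y :- z) := x :- z) ≡.refl (seq x n) (seq y n) (seq z n))
        (∣+∣-< (seq x n ℚ.- seq y n) (seq y n ℚ.- seq z n) x~y y~z)
  }

≃-refl : ∀ {x} → x ≃ x
≃-refl = IsEquivalence.refl ≃-isEquivalence

tail-positive : ∀ x (0<x : 0ʳ <ʳ x) n → 0ℚ ℚ.< seq x (proj₁ (proj₂ (proj₂ 0<x)) ℕ.+ n)
tail-positive x (δ , 0<δ , K , δ≤x) n = ℚₚ.<-≤-trans 0<δ
  (subst (ℚ._≤ seq x (K ℕ.+ n)) (ℚₚ.+-identityˡ δ) (δ≤x (K ℕ.+ n) (ℕₚ.m≤m+n K n)))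

-- Opacity stops the conversion checker from comparing the Cauchy proofs
-- inside sums and products of reals.
infixl 6 _⊕_
infixl 7 _⊗_
infix  8 ⊖_

opaque
  _⊕_ _⊗_ : ℝ → ℝ → ℝ
  _⊕_ = _+ʳ_
  _⊗_ = _*ʳ_

  ⊖_ : ℝ → ℝ
  ⊖_ = -ʳ_

  ι : ℚ → ℝ
  ι = fromℚ

  recip : (x : ℝ) → 0ʳ <ʳ x → ℝ
  recip = inv

  ⊕-cong : ∀ {x y u v} → x ≃ y → u ≃ v → x ⊕ u ≃ y ⊕ v
  ⊕-cong {x} {y} {u} {v} (mk≃ p) (mk≃ q) = mk≃ λ ε 0<ε →
    eventually₂ (p _ (half-positive 0<ε)) (q _ (half-positive 0<ε)) λ n x~y u~v →
    subst (λ t → ℚ.∣ t ∣ ℚ.< ε)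
      (solve 4 (λ x y u v → (x :- y) :+ (u :- v) := (x :+ u) :- (y :+ v)) ≡.refl
        (seq x n) (seq y n) (seq u n) (seq v n))
      (∣+∣-< (seq x n ℚ.- seq y n) (seq u n ℚ.- seq v n) x~y u~v)

  ⊖-cong : ∀ {x y} → x ≃ y → ⊖ x ≃ ⊖ y
  ⊖-cong {x} {y} (mk≃ p) = mk≃ λ ε 0<ε → eventually₁ (p ε 0<ε) λ n →
    subst (ℚ._< ε) (≡.trans (≡.sym (ℚₚ.∣-p∣≡∣p∣ (seq x n ℚ.- seq y n)))
      (cong ℚ.∣_∣ (solve 2 (λ x y → :- (x :- y) := (:- x) :- (:- y)) ≡.refl (seq x n) (seq y n))))

  ⊗-congˡ : ∀ {x u v} → u ≃ v → x ⊗ u ≃ x ⊗ v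
  ⊗-congˡ {x} {u} {v} (mk≃ p) = mk≃ λ ε 0<ε →
    let B , 0<B , bounded = eventually-∣∣≤ x
        δ , 0<δ , Bδ≡ε = divide 0<ε 0<B
    in eventually₂ bounded (p δ 0<δ) λ n x≤B u~v →
       ≡.subst₂ (λ s t → ℚ.∣ s ∣ ℚ.< t)
         (solve 3 (λ x u v → x :* (u :- v) := x :* u :- x :* v) ≡.refl (seq x n) (seq u n) (seq v n))
         Bδ≡ε
         (∣*∣-< (seq x n) (seq u n ℚ.- seq v n) 0<B x≤B u~v)

  ⊕-assoc : ∀ x y z → (x ⊕ y) ⊕ z ≃ x ⊕ (y ⊕ z)
  ⊕-assoc x y z = pointwise λ n → ℚₚ.+-assoc (seq x n) (seq y n) (seq z n)

  ⊕-identityˡ : ∀ x → ι 0ℚ ⊕ x ≃ x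
  ⊕-identityˡ x = pointwise λ n → ℚₚ.+-identityˡ (seq x n)

  ⊖-inverseˡ : ∀ x → ⊖ x ⊕ x ≃ ι 0ℚ
  ⊖-inverseˡ x = pointwise λ n → ℚₚ.+-inverseˡ (seq x n)

  ⊕-comm : ∀ x y → x ⊕ y ≃ y ⊕ x
  ⊕-comm x y = pointwise λ n → ℚₚ.+-comm (seq x n) (seq y n)

  ⊗-assoc : ∀ x y z → (x ⊗ y) ⊗ z ≃ x ⊗ (y ⊗ z)
  ⊗-assoc x y z = pointwise λ n → ℚₚ.*-assoc (seq x n) (seq y n) (seq z n)

  ⊗-identityˡ : ∀ x → ι 1ℚ ⊗ x ≃ x
  ⊗-identityˡ x = pointwise λ n → ℚₚ.*-identityˡ (seq x n)

  ⊗-distribˡ : ∀ x y z → x ⊗ (y ⊕ z) ≃ (x ⊗ y) ⊕ (x ⊗ z)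
  ⊗-distribˡ x y z = pointwise λ n → ℚₚ.*-distribˡ-+ (seq x n) (seq y n) (seq z n)

  ⊗-comm : ∀ x y → x ⊗ y ≃ y ⊗ x
  ⊗-comm x y = pointwise λ n → ℚₚ.*-comm (seq x n) (seq y n)

  ≼-reflexive : ∀ {x y} → x ≃ y → x ≼ y
  ≼-reflexive {x} {y} (mk≃ p) = mk≼ λ ε 0<ε → eventually₁ (p ε 0<ε) λ n x~y →
    subst (ℚ._≤ _) (solve 2 (λ x y → y :+ (x :- y) := x) ≡.refl (seq x n) (seq y n))
      (ℚₚ.+-monoʳ-≤ (seq y n) (ℚₚ.≤-trans (≤-∣∣ (seq x n ℚ.- seq y n)) (ℚₚ.<⇒≤ x~y)))

  ≼-refl : ∀ {x} → x ≼ x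
  ≼-refl = ≼-reflexive ≃-refl

  ≼-trans : ∀ {x y z} → x ≼ y → y ≼ z → x ≼ z
  ≼-trans {x} {y} {z} (mk≼ p) (mk≼ q) = mk≼ λ ε 0<ε →
    eventually₂ (p _ (half-positive 0<ε)) (q _ (half-positive 0<ε)) λ n x≤y y≤z →
    ℚₚ.≤-trans x≤y (ℚₚ.≤-trans (ℚₚ.+-monoˡ-≤ (½ ℚ.* ε) y≤z)
      (ℚₚ.≤-reflexive (solve 2 (λ z ε → z :+ con ½ :* ε :+ con ½ :* ε := z :+ ε) ≡.refl (seq z n) ε)))

  +-mono-≼ : ∀ {x y u v} → x ≼ y → u ≼ v → x ⊕ u ≼ y ⊕ v
  +-mono-≼ {x} {y} {u} {v} (mk≼ p) (mk≼ q) = mk≼ λ ε 0<ε →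
    eventually₂ (p _ (half-positive 0<ε)) (q _ (half-positive 0<ε)) λ n x≤y u≤v →
    ℚₚ.≤-trans (ℚₚ.+-mono-≤ x≤y u≤v)
      (ℚₚ.≤-reflexive (solve 3 (λ y v ε → (y :+ con ½ :* ε) :+ (v :+ con ½ :* ε) := y :+ v :+ ε) ≡.refl
        (seq y n) (seq v n) ε))

  *-nonNeg : ∀ {x y} → ι 0ℚ ≼ x → ι 0ℚ ≼ y → ι 0ℚ ≼ x ⊗ y
  *-nonNeg {x} {y} (mk≼ p) (mk≼ q) = mk≼ λ ε 0<ε →
    let B , 0<B , x≤B = eventually-∣∣≤ x
        C , 0<C , y≤C = eventually-∣∣≤ y
        δ , 0<δ , eq = divide {B = B ℚ.+ C} 0<ε (ℚₚ.+-mono-< 0<B 0<C)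
        B≤B+C = q≤q+ε B 0<C
        C≤B+C = ℚₚ.≤-trans (q≤q+ε C 0<B) (ℚₚ.≤-reflexive (ℚₚ.+-comm C B))
    in eventually₂ (eventually₂ x≤B y≤C λ _ → _,_) (eventually₂ (p δ 0<δ) (q δ 0<δ) λ _ → _,_)
         λ n (x≤B , y≤C) (0≤x , 0≤y) →
       subst (λ t → 0ℚ ℚ.≤ seq x n ℚ.* seq y n ℚ.+ t) eq
         (*-almost-nonNeg (ℚₚ.<⇒≤ 0<δ) 0≤x 0≤y (ℚₚ.≤-trans x≤B B≤B+C) (ℚₚ.≤-trans y≤C C≤B+C))

  ι-mono : ∀ {q r} → q ℚ.≤ r → ι q ≼ ι r
  ι-mono {_} {r} q≤r = mk≼ λ ε 0<ε → 0 , λ _ _ → ℚₚ.≤-trans q≤r (q≤q+ε r 0<ε)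

  square-nonNeg : ∀ x → ι 0ℚ ≼ x ⊗ x
  square-nonNeg x = mk≼ λ ε 0<ε → 0 , λ n _ → ℚₚ.≤-trans (0≤q*q (seq x n)) (q≤q+ε _ 0<ε)

  square-null : ∀ {x} → x ⊗ x ≼ ι 0ℚ → x ≃ ι 0ℚ
  -- The tolerance is half of ε² because `_≼_` yields only a weak inequality, while the square must
  -- lie strictly below ε².
  square-null {x} (mk≼ p) = mk≃ λ ε 0<ε → eventually₁ (p (½ ℚ.* (ε ℚ.* ε)) (half-positive (0<ε² 0<ε))) λ n x²≤ →
    subst (λ t → ℚ.∣ t ∣ ℚ.< ε) (≡.sym (ℚₚ.+-identityʳ (seq x n)))
      (∣∣-<-from-square (seq x n) 0<ε (ℚₚ.≤-<-trans x²≤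
        (subst (ℚ._< ε ℚ.* ε) (≡.sym (ℚₚ.+-identityˡ _)) (half< (0<ε² 0<ε)))))
    where
    0<ε² : ∀ {ε} → 0ℚ ℚ.< ε → 0ℚ ℚ.< ε ℚ.* ε
    0<ε² {ε} 0<ε = ℚₚ.positive⁻¹ _ {{ℚₚ.pos*pos⇒pos ε {{ℚ.positive 0<ε}} ε {{ℚ.positive 0<ε}}}}

  ≼-limit : ∀ {x y} → (∀ ε → 0ℚ ℚ.< ε → x ≼ y ⊕ ι ε) → x ≼ y
  ≼-limit {x} {y} p = mk≼ λ ε 0<ε → eventually₁ (un≼ (p _ (half-positive 0<ε)) _ (half-positive 0<ε)) λ n x≤ →
    ℚₚ.≤-trans x≤ (ℚₚ.≤-reflexive
      (solve 2 (λ y ε → y :+ con ½ :* ε :+ con ½ :* ε := y :+ ε) ≡.refl (seq y n) ε))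

  bounded-by-rational : ∀ x → ∃[ B ] (0ℚ ℚ.< B × x ≼ ι B)
  bounded-by-rational x =
    let B , 0<B , bounded = eventually-∣∣≤ x
    in B , 0<B , mk≼ λ ε 0<ε → eventually₁ bounded λ n x≤B →
       ℚₚ.≤-trans (≤-∣∣ (seq x n)) (ℚₚ.≤-trans x≤B (q≤q+ε B 0<ε))

  <ʳ⇒≼ : ∀ {x y} → x <ʳ y → x ≼ y
  <ʳ⇒≼ {x} (δ , 0<δ , ev) = mk≼ λ ε 0<ε → eventually₁ ev λ n x+δ≤y →
    ℚₚ.≤-trans (q≤q+ε (seq x n) 0<δ) (ℚₚ.≤-trans x+δ≤y (q≤q+ε _ 0<ε))

  shift : ℕ → ℝ → ℝ
  shift K x = record
    { seq = λ n → seq x (K ℕ.+ n)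
    ; cauchy = λ ε 0<ε → let N , close = cauchy x ε 0<ε in N , λ m n p q →
        close _ _ (ℕₚ.≤-trans p (ℕₚ.m≤n+m m K)) (ℕₚ.≤-trans q (ℕₚ.m≤n+m n K)) }

  shift-≃ : ∀ K x → x ≃ shift K x
  shift-≃ K x = mk≃ λ ε 0<ε → let N , close = cauchy x ε 0<ε in N , λ n p →
    close _ _ p (ℕₚ.≤-trans p (ℕₚ.m≤n+m n K))

  -- inv x inverts the terms of x from the index K on only.
  shift-inverse : ∀ x 0<x → shift (proj₁ (proj₂ (proj₂ 0<x))) x ⊗ recip x 0<x ≃ ι 1ℚ
  shift-inverse x 0<x@(_ , _ , K , _) = pointwise λ n →
    ℚₚ.*-inverseʳ (seq x (K ℕ.+ n)) {{ℚ.>-nonZero (tail-positive x 0<x n)}}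

  ι-+ : ∀ q r → ι (q ℚ.+ r) ≃ ι q ⊕ ι r
  ι-+ q r = pointwise λ _ → ≡.refl

  ι-* : ∀ q r → ι (q ℚ.* r) ≃ ι q ⊗ ι r
  ι-* q r = pointwise λ _ → ≡.refl

  ι-reflect : ∀ {q r} → ι q ≼ ι r → ∀ ε → 0ℚ ℚ.< ε → q ℚ.≤ r ℚ.+ ε
  ι-reflect (mk≼ p) ε 0<ε = let N , le = p ε 0<ε in le N ℕₚ.≤-refl


ℝ-setoid : Setoid 0ℓ 0ℓ
ℝ-setoid = record { isEquivalence = ≃-isEquivalence }

ℝ-commutativeRing : CommutativeRing 0ℓ 0ℓ
ℝ-commutativeRing = record
  { Carrier = ℝ ; _≈_ = _≃_ ; _+_ = _⊕_ ; _*_ = _⊗_ ; -_ = ⊖_ ; 0# = ι 0ℚ ; 1# = ι 1ℚ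
  ; isCommutativeRing = record
    { isRing = record
      { +-isAbelianGroup = record
        { isGroup = record
          { isMonoid = record
            { isSemigroup = record
              { isMagma = record { isEquivalence = ≃-isEquivalence ; ∙-cong = ⊕-cong }
              ; assoc = ⊕-assoc
              }
            ; identity = comm∧idˡ⇒id ⊕-comm ⊕-identityˡ
            }
          ; inverse = comm∧invˡ⇒inv ⊕-comm ⊖-inverseˡ
          ; ⁻¹-cong = ⊖-cong
          }
        ; comm = ⊕-comm
        }
      ; *-cong = λ {_} {y} {u} p q → trans (⊗-congˡ q)
          (trans (⊗-comm _ _) (trans (⊗-congˡ p) (⊗-comm _ _)))
      ; *-assoc = ⊗-assoc
      ; *-identity = comm∧idˡ⇒id ⊗-comm ⊗-identityˡ
      ; distrib = ⊗-distribˡ , comm∧distrˡ⇒distrʳ ⊕-cong ⊗-comm ⊗-distribˡ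
      }
    ; *-comm = ⊗-comm
    }
  }
  where
  open IsEquivalence ≃-isEquivalence using (trans)
  open Consequences ℝ-setoid

module R = CommutativeRing ℝ-commutativeRing

recip-inverseʳ : ∀ x 0<x → x ⊗ recip x 0<x ≃ ι 1ℚ
recip-inverseʳ x 0<x =
  R.trans (R.*-congʳ (shift-≃ (proj₁ (proj₂ (proj₂ 0<x))) x)) (shift-inverse x 0<x)

module ≃-Reasoning = SetoidReasoning R.setoid

≼-preorder : Preorder 0ℓ 0ℓ 0ℓ
≼-preorder = record
  { Carrier = ℝ ; _≈_ = _≃_ ; _≲_ = _≼_
  ; isPreorder = record { isEquivalence = ≃-isEquivalence ; reflexive = ≼-reflexive ; trans = ≼-trans } }

module ≼-Reasoning = PreorderReasoning ≼-preorder

module ℝ^ = Exp R.semiring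
open ℝ^ using () renaming (_^_ to _^ᴿ_)
module ℝ^ᶜ = CommutativeExp R.commutativeSemiring

opaque
  unfolding _⊕_

  difference-cancel : ∀ x y → (y ⊕ ⊖ x) ⊕ x ≃ y
  difference-cancel x y = pointwise λ n → solve 2 (λ x y → (y :- x) :+ x := y) ≡.refl (seq x n) (seq y n)

  ⊗-difference : ∀ z x y → z ⊗ (y ⊕ ⊖ x) ≃ z ⊗ y ⊕ ⊖ (z ⊗ x)
  ⊗-difference z x y = pointwise λ n →
    solve 3 (λ z x y → z :* (y :- x) := z :* y :- z :* x) ≡.refl (seq z n) (seq x n) (seq y n)

  geometric-step : ∀ t g → (t ⊕ ⊖ ι 1ℚ) ⊗ (ι 1ℚ ⊕ t ⊗ g) ≃ (t ⊕ ⊖ ι 1ℚ) ⊕ t ⊗ ((t ⊕ ⊖ ι 1ℚ) ⊗ g)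
  geometric-step t g = pointwise λ n → solve 2 (λ t g →
    (t :- con 1ℚ) :* (con 1ℚ :+ t :* g) := (t :- con 1ℚ) :+ t :* ((t :- con 1ℚ) :* g)) ≡.refl (seq t n) (seq g n)

  geometric-telescope : ∀ t s → (t ⊕ ⊖ ι 1ℚ) ⊕ t ⊗ (s ⊕ ⊖ ι 1ℚ) ≃ t ⊗ s ⊕ ⊖ ι 1ℚ
  geometric-telescope t s = pointwise λ n → solve 2 (λ t s →
    (t :- con 1ℚ) :+ t :* (s :- con 1ℚ) := t :* s :- con 1ℚ) ≡.refl (seq t n) (seq s n)

  1≼⇒0< : ∀ {x} → ι 1ℚ ≼ x → 0ʳ <ʳ x
  -- One half serves twice: as the tolerance in 1 ≤ xₙ + ½ and as the resulting lower bound for xₙ.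
  1≼⇒0< {x} (mk≼ p) = ½ , 0<½ , eventually₁ (p ½ 0<½) λ n 1≤x+½ →
    ≡.subst₂ ℚ._≤_ ≡.refl (solve 1 (λ q → q :+ con ½ :- con ½ := q) ≡.refl (seq x n))
      (ℚₚ.+-monoˡ-≤ (ℚ.- ½) 1≤x+½)
    where
    0<½ : 0ℚ ℚ.< ½
    0<½ = ℚₚ.positive⁻¹ ½

  *ʳ-⊗ : ∀ x y → x *ʳ y ≡ x ⊗ y
  *ʳ-⊗ x y = ≡.refl

  fromℚ-ι : ∀ q → fromℚ q ≡ ι q
  fromℚ-ι q = ≡.refl

opaque
  unfolding recip

  inv-recip : ∀ x 0<x → inv x 0<x ≡ recip x 0<x
  inv-recip x 0<x = ≡.refl

fromℤ-ι : ∀ z → fromℤ z ≡ ι (z ℚ./ 1)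
fromℤ-ι z = fromℚ-ι (z ℚ./ 1)

-- Here and below an operation is a variable wherever its instance on ℝ or ℂ
-- would be unfolded by the conversion checker.
×-unique : ∀ {c ℓ} (M : RawMonoid c ℓ) → let open RawMonoid M in
           (_·_ : Carrier → Carrier → Carrier) (e : Carrier) →
           ε ≡ e → (∀ x y → x ∙ y ≡ x · y) →
           ∀ x n → RawMonoidDefs._×_ M n x ≡ fold e (x ·_) n
×-unique M _·_ e ε≡e ∙≡· x zero    = ε≡e
×-unique M _·_ e ε≡e ∙≡· x (suc n) =
  ≡.trans (∙≡· x (RawMonoidDefs._×_ M n x)) (cong (x ·_) (×-unique M _·_ e ε≡e ∙≡· x n))

^ʳ-^ : ∀ x n → x ^ʳ n ≡ x ^ᴿ n
^ʳ-^ x n = ≡.trans (×-unique (RawRing.*-rawMonoid ℝ-rawRing) _⊗_ (ι 1ℚ) (fromℚ-ι 1ℚ) *ʳ-⊗ x n)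
  (≡.sym (×-unique (RawSemiring.*-rawMonoid (RawRing.rawSemiring R.rawRing)) _⊗_ (ι 1ℚ) ≡.refl (λ _ _ → ≡.refl) x n))

x≼y⇒0≼y-x : ∀ {x y} → x ≼ y → ι 0ℚ ≼ y ⊕ ⊖ x
x≼y⇒0≼y-x {x} {y} x≼y = begin
  ι 0ℚ       ≈⟨ R.-‿inverseʳ x ⟨
  x ⊕ ⊖ x    ≲⟨ +-mono-≼ x≼y ≼-refl ⟩
  y ⊕ ⊖ x    ∎
  where open ≼-Reasoning

0≼y-x⇒x≼y : ∀ {x y} → ι 0ℚ ≼ y ⊕ ⊖ x → x ≼ y
0≼y-x⇒x≼y {x} {y} 0≼y-x = begin
  x                ≈⟨ R.+-identityˡ x ⟨
  ι 0ℚ ⊕ x         ≲⟨ +-mono-≼ 0≼y-x ≼-refl ⟩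
  (y ⊕ ⊖ x) ⊕ x    ≈⟨ difference-cancel x y ⟩
  y                ∎
  where open ≼-Reasoning

-- Passing to differences reduces monotonicity to `*-nonNeg`, the only product estimate that has to
-- be made on sequences.
⊗-monoˡ-≼ : ∀ {x y z} → ι 0ℚ ≼ z → x ≼ y → z ⊗ x ≼ z ⊗ y
⊗-monoˡ-≼ {x} {y} {z} 0≼z x≼y =
  0≼y-x⇒x≼y (≼-trans (*-nonNeg 0≼z (x≼y⇒0≼y-x x≼y)) (≼-reflexive (⊗-difference z x y)))

⊗-monoʳ-≼ : ∀ {x y z} → ι 0ℚ ≼ z → x ≼ y → x ⊗ z ≼ y ⊗ z
⊗-monoʳ-≼ 0≼z x≼y = ≼-trans (≼-reflexive (R.*-comm _ _))
  (≼-trans (⊗-monoˡ-≼ 0≼z x≼y) (≼-reflexive (R.*-comm _ _)))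

0≼1 : ι 0ℚ ≼ ι 1ℚ
0≼1 = ι-mono (ℚₚ.nonNegative⁻¹ 1ℚ)

^-nonNeg : ∀ {x} n → ι 0ℚ ≼ x → ι 0ℚ ≼ x ^ᴿ n
^-nonNeg zero    0≼x = 0≼1
^-nonNeg (suc n) 0≼x = *-nonNeg 0≼x (^-nonNeg n 0≼x)

^-mono : ∀ {x y} n → ι 0ℚ ≼ x → x ≼ y → x ^ᴿ n ≼ y ^ᴿ n
^-mono zero    0≼x x≼y = ≼-refl
^-mono (suc n) 0≼x x≼y = ≼-trans (⊗-monoʳ-≼ (^-nonNeg n 0≼x) x≼y)
  (⊗-monoˡ-≼ (≼-trans 0≼x x≼y) (^-mono n 0≼x x≼y))

1^n≃1 : ∀ n → ι 1ℚ ^ᴿ n ≃ ι 1ℚ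
1^n≃1 zero    = R.refl
1^n≃1 (suc n) = R.trans (R.*-identityˡ _) (1^n≃1 n)

-- The sum 1 + t + ... + tⁿ, with n + 1 terms, in Horner form.
geometric : ℝ → ℕ → ℝ
geometric t zero    = ι 1ℚ
geometric t (suc n) = ι 1ℚ ⊕ t ⊗ geometric t n

geometric-sum : ∀ t n → (t ⊕ ⊖ ι 1ℚ) ⊗ geometric t n ≃ t ^ᴿ suc n ⊕ ⊖ ι 1ℚ
geometric-sum t zero    = R.trans (R.*-identityʳ _) (R.+-congʳ (R.sym (R.*-identityʳ t)))
geometric-sum t (suc n) = begin
  (t ⊕ ⊖ ι 1ℚ) ⊗ (ι 1ℚ ⊕ t ⊗ geometric t n)               ≈⟨ geometric-step t (geometric t n) ⟩
  (t ⊕ ⊖ ι 1ℚ) ⊕ t ⊗ ((t ⊕ ⊖ ι 1ℚ) ⊗ geometric t n)       ≈⟨ R.+-congˡ (R.*-congˡ (geometric-sum t n)) ⟩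
  (t ⊕ ⊖ ι 1ℚ) ⊕ t ⊗ (t ^ᴿ suc n ⊕ ⊖ ι 1ℚ)                 ≈⟨ geometric-telescope t (t ^ᴿ suc n) ⟩
  t ^ᴿ suc (suc n) ⊕ ⊖ ι 1ℚ                                ∎
  where open ≃-Reasoning

1≼geometric : ∀ {t} n → ι 0ℚ ≼ t → ι 1ℚ ≼ geometric t n
1≼geometric zero    0≼t = ≼-refl
1≼geometric {t} (suc n) 0≼t = begin
  ι 1ℚ                          ≈⟨ R.+-identityʳ _ ⟨
  ι 1ℚ ⊕ ι 0ℚ                   ≲⟨ +-mono-≼ ≼-refl (*-nonNeg 0≼t (≼-trans 0≼1 (1≼geometric n 0≼t))) ⟩
  ι 1ℚ ⊕ t ⊗ geometric t n      ∎
  where open ≼-Reasoning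

-- Whether t < 1 or t > 1 cannot be decided for a real. Instead (t - 1)(1 + t + ... + tⁿ) = tⁿ⁺¹ - 1
-- = 0, and the second factor is at least 1 for t ≥ 0, hence invertible, so that t - 1 = 0.
^≃1⇒≃1 : ∀ {t} n → ι 0ℚ ≼ t → t ^ᴿ suc n ≃ ι 1ℚ → t ≃ ι 1ℚ
^≃1⇒≃1 {t} n 0≼t t^n≃1 = begin
  t                                            ≈⟨ difference-cancel (ι 1ℚ) t ⟨
  (t ⊕ ⊖ ι 1ℚ) ⊕ ι 1ℚ                          ≈⟨ R.+-congʳ (R.*-identityʳ _) ⟨
  (t ⊕ ⊖ ι 1ℚ) ⊗ ι 1ℚ ⊕ ι 1ℚ                   ≈⟨ R.+-congʳ (R.*-congˡ (recip-inverseʳ g 0<g)) ⟨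
  (t ⊕ ⊖ ι 1ℚ) ⊗ (g ⊗ recip g 0<g) ⊕ ι 1ℚ      ≈⟨ R.+-congʳ (R.*-assoc _ _ _) ⟨
  (t ⊕ ⊖ ι 1ℚ) ⊗ g ⊗ recip g 0<g ⊕ ι 1ℚ        ≈⟨ R.+-congʳ (R.*-congʳ (R.trans (geometric-sum t n)
                                                    (R.trans (R.+-congʳ t^n≃1) (R.-‿inverseʳ _)))) ⟩
  ι 0ℚ ⊗ recip g 0<g ⊕ ι 1ℚ                    ≈⟨ R.+-congʳ (R.zeroˡ _) ⟩
  ι 0ℚ ⊕ ι 1ℚ                                  ≈⟨ R.+-identityˡ _ ⟩
  ι 1ℚ                                         ∎
  where
  open ≃-Reasoning
  g = geometric t n
  0<g = 1≼⇒0< (1≼geometric n 0≼t)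

-- Complex numbers

infix 4 _≃ᶜ_

record _≃ᶜ_ (z w : ℂ) : Set where
  constructor mk≃ᶜ
  field
    re-≃ : re z ≃ re w
    im-≃ : im z ≃ im w
open _≃ᶜ_

≃ᶜ-isEquivalence : IsEquivalence _≃ᶜ_
≃ᶜ-isEquivalence = record
  { refl  = mk≃ᶜ R.refl R.refl
  ; sym   = λ (mk≃ᶜ p q) → mk≃ᶜ (R.sym p) (R.sym q)
  ; trans = λ (mk≃ᶜ p q) (mk≃ᶜ r s) → mk≃ᶜ (R.trans p r) (R.trans q s)
  }

infixl 6 _⊞_
infixl 7 _⊠_
infix  8 ⊟_ _†

opaque
  _⊞_ _⊠_ : ℂ → ℂ → ℂ
  z ⊞ w = (re z ⊕ re w) +i (im z ⊕ im w)
  z ⊠ w = (re z ⊗ re w ⊕ ⊖ (im z ⊗ im w)) +i (re z ⊗ im w ⊕ im z ⊗ re w)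

  ⊟_ _† : ℂ → ℂ
  ⊟ z = (⊖ re z) +i (⊖ im z)
  z † = re z +i (⊖ im z)

  real : ℝ → ℂ
  real x = x +i ι 0ℚ

  ‖_‖² : ℂ → ℝ
  ‖ z ‖² = re z ⊗ re z ⊕ im z ⊗ im z

opaque
  unfolding _⊞_

  ⊞-cong : ∀ {x y u v} → x ≃ᶜ y → u ≃ᶜ v → x ⊞ u ≃ᶜ y ⊞ v
  ⊞-cong (mk≃ᶜ p q) (mk≃ᶜ r s) = mk≃ᶜ (R.+-cong p r) (R.+-cong q s)

  ⊠-cong : ∀ {x y u v} → x ≃ᶜ y → u ≃ᶜ v → x ⊠ u ≃ᶜ y ⊠ v
  ⊠-cong (mk≃ᶜ p q) (mk≃ᶜ r s) = mk≃ᶜ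
    (R.+-cong (R.*-cong p r) (R.-‿cong (R.*-cong q s))) (R.+-cong (R.*-cong p s) (R.*-cong q r))

  ⊟-cong : ∀ {z w} → z ≃ᶜ w → ⊟ z ≃ᶜ ⊟ w
  ⊟-cong (mk≃ᶜ p q) = mk≃ᶜ (R.-‿cong p) (R.-‿cong q)

  †-cong : ∀ {z w} → z ≃ᶜ w → z † ≃ᶜ w †
  †-cong (mk≃ᶜ p q) = mk≃ᶜ p (R.-‿cong q)

  real-cong : ∀ {x y} → x ≃ y → real x ≃ᶜ real y
  real-cong p = mk≃ᶜ p R.refl

  ‖‖²-cong : ∀ {z w} → z ≃ᶜ w → ‖ z ‖² ≃ ‖ w ‖²
  ‖‖²-cong (mk≃ᶜ p q) = R.+-cong (R.*-cong p p) (R.*-cong q q)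

  ⊞-assoc : ∀ x y z → (x ⊞ y) ⊞ z ≃ᶜ x ⊞ (y ⊞ z)
  ⊞-assoc x y z = mk≃ᶜ (R.+-assoc _ _ _) (R.+-assoc _ _ _)

  ⊞-comm : ∀ x y → x ⊞ y ≃ᶜ y ⊞ x
  ⊞-comm x y = mk≃ᶜ (R.+-comm _ _) (R.+-comm _ _)

  ⊞-identityˡ : ∀ z → real (ι 0ℚ) ⊞ z ≃ᶜ z
  ⊞-identityˡ z = mk≃ᶜ (R.+-identityˡ _) (R.+-identityˡ _)

  ⊟-inverseˡ : ∀ z → ⊟ z ⊞ z ≃ᶜ real (ι 0ℚ)
  ⊟-inverseˡ z = mk≃ᶜ (R.-‿inverseˡ _) (R.-‿inverseˡ _)

  re-⊞ : ∀ z w → re (z ⊞ w) ≃ re z ⊕ re w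
  re-⊞ z w = R.refl

  re-real : ∀ x → re (real x) ≃ x
  re-real x = R.refl

  ‖‖²-nonNeg : ∀ z → ι 0ℚ ≼ ‖ z ‖²
  ‖‖²-nonNeg z = ≼-trans (≼-reflexive (R.sym (R.+-identityˡ _)))
    (+-mono-≼ (square-nonNeg (re z)) (square-nonNeg (im z)))

  ‖‖²-null : ∀ {z} → ‖ z ‖² ≼ ι 0ℚ → z ≃ᶜ real (ι 0ℚ)
  ‖‖²-null {z} p = mk≃ᶜ
    (square-null (≼-trans (≼-trans (≼-reflexive (R.sym (R.+-identityʳ _))) (+-mono-≼ ≼-refl (square-nonNeg (im z)))) p))
    (square-null (≼-trans (≼-trans (≼-reflexive (R.sym (R.+-identityˡ _))) (+-mono-≼ (square-nonNeg (re z)) ≼-refl)) p))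

opaque
  unfolding _⊞_ _⊕_

  ⊠-assoc : ∀ x y z → (x ⊠ y) ⊠ z ≃ᶜ x ⊠ (y ⊠ z)
  ⊠-assoc (a +i b) (c +i d) (e +i f) = mk≃ᶜ
    (pointwise λ n → solve 6 (λ a b c d e f →
      (a :* c :- b :* d) :* e :- (a :* d :+ b :* c) :* f := a :* (c :* e :- d :* f) :- b :* (c :* f :+ d :* e))
      ≡.refl (seq a n) (seq b n) (seq c n) (seq d n) (seq e n) (seq f n))
    (pointwise λ n → solve 6 (λ a b c d e f →
      (a :* c :- b :* d) :* f :+ (a :* d :+ b :* c) :* e := a :* (c :* f :+ d :* e) :+ b :* (c :* e :- d :* f))
      ≡.refl (seq a n) (seq b n) (seq c n) (seq d n) (seq e n) (seq f n))

  ⊠-comm : ∀ x y → x ⊠ y ≃ᶜ y ⊠ x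
  ⊠-comm (a +i b) (c +i d) = mk≃ᶜ
    (pointwise λ n → solve 4 (λ a b c d → a :* c :- b :* d := c :* a :- d :* b)
      ≡.refl (seq a n) (seq b n) (seq c n) (seq d n))
    (pointwise λ n → solve 4 (λ a b c d → a :* d :+ b :* c := c :* b :+ d :* a)
      ≡.refl (seq a n) (seq b n) (seq c n) (seq d n))

  ⊠-distribˡ : ∀ x y z → x ⊠ (y ⊞ z) ≃ᶜ (x ⊠ y) ⊞ (x ⊠ z)
  ⊠-distribˡ (a +i b) (c +i d) (e +i f) = mk≃ᶜ
    (pointwise λ n → solve 6 (λ a b c d e f →
      a :* (c :+ e) :- b :* (d :+ f) := (a :* c :- b :* d) :+ (a :* e :- b :* f))
      ≡.refl (seq a n) (seq b n) (seq c n) (seq d n) (seq e n) (seq f n))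
    (pointwise λ n → solve 6 (λ a b c d e f →
      a :* (d :+ f) :+ b :* (c :+ e) := (a :* d :+ b :* c) :+ (a :* f :+ b :* e))
      ≡.refl (seq a n) (seq b n) (seq c n) (seq d n) (seq e n) (seq f n))

  ⊠-identityˡ : ∀ z → real (ι 1ℚ) ⊠ z ≃ᶜ z
  ⊠-identityˡ (a +i b) = mk≃ᶜ
    (pointwise λ n → solve 2 (λ a b → con 1ℚ :* a :- con 0ℚ :* b := a) ≡.refl (seq a n) (seq b n))
    (pointwise λ n → solve 2 (λ a b → con 1ℚ :* b :+ con 0ℚ :* a := b) ≡.refl (seq a n) (seq b n))

  †-⊞ : ∀ z w → (z ⊞ w) † ≃ᶜ z † ⊞ w †
  †-⊞ (a +i b) (c +i d) = mk≃ᶜ (pointwise λ n → ≡.refl)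
    (pointwise λ n → solve 2 (λ b d → :- (b :+ d) := :- b :+ :- d) ≡.refl (seq b n) (seq d n))

  †-⊠ : ∀ z w → (z ⊠ w) † ≃ᶜ z † ⊠ w †
  †-⊠ (a +i b) (c +i d) = mk≃ᶜ
    (pointwise λ n → solve 4 (λ a b c d → a :* c :- b :* d := a :* c :- (:- b) :* (:- d))
      ≡.refl (seq a n) (seq b n) (seq c n) (seq d n))
    (pointwise λ n → solve 4 (λ a b c d → :- (a :* d :+ b :* c) := a :* (:- d) :+ (:- b) :* c)
      ≡.refl (seq a n) (seq b n) (seq c n) (seq d n))

  †-real : ∀ x → real x † ≃ᶜ real x
  †-real x = mk≃ᶜ (pointwise λ n → ≡.refl) (pointwise λ n → ≡.refl)

  ‖†‖² : ∀ z → ‖ z † ‖² ≃ ‖ z ‖²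
  ‖†‖² (a +i b) = pointwise λ n →
    solve 2 (λ a b → a :* a :+ (:- b) :* (:- b) := a :* a :+ b :* b) ≡.refl (seq a n) (seq b n)

  -- The two-square identity of Brahmagupta and Fibonacci.
  ‖⊠‖² : ∀ z w → ‖ z ⊠ w ‖² ≃ ‖ z ‖² ⊗ ‖ w ‖²
  ‖⊠‖² (a +i b) (c +i d) = pointwise λ n → solve 4 (λ a b c d →
    (a :* c :- b :* d) :* (a :* c :- b :* d) :+ (a :* d :+ b :* c) :* (a :* d :+ b :* c)
      := (a :* a :+ b :* b) :* (c :* c :+ d :* d)) ≡.refl (seq a n) (seq b n) (seq c n) (seq d n)

  ‖real‖² : ∀ x → ‖ real x ‖² ≃ x ⊗ x
  ‖real‖² x = pointwise λ n → solve 1 (λ a → a :* a :+ con 0ℚ :* con 0ℚ := a :* a) ≡.refl (seq x n)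

  z⊠z† : ∀ z → z ⊠ z † ≃ᶜ real ‖ z ‖²
  z⊠z† (a +i b) = mk≃ᶜ
    (pointwise λ n → solve 2 (λ a b → a :* a :- b :* (:- b) := a :* a :+ b :* b) ≡.refl (seq a n) (seq b n))
    (pointwise λ n → solve 2 (λ a b → a :* (:- b) :+ b :* a := con 0ℚ) ≡.refl (seq a n) (seq b n))

  ‖⊟‖² : ∀ z → ‖ ⊟ z ‖² ≃ ‖ z ‖²
  ‖⊟‖² (a +i b) = pointwise λ n →
    solve 2 (λ a b → (:- a) :* (:- a) :+ (:- b) :* (:- b) := a :* a :+ b :* b) ≡.refl (seq a n) (seq b n)

  ⊟-telescope : ∀ z v w → ⊟ (z ⊞ ⊟ v) ⊞ (z ⊞ ⊟ w) ≃ᶜ v ⊞ ⊟ w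
  ⊟-telescope (a +i b) (c +i d) (e +i f) = mk≃ᶜ
    (pointwise λ n → solve 3 (λ z v w → :- (z :- v) :+ (z :- w) := v :- w) ≡.refl (seq a n) (seq c n) (seq e n))
    (pointwise λ n → solve 3 (λ z v w → :- (z :- v) :+ (z :- w) := v :- w) ≡.refl (seq b n) (seq d n) (seq f n))

  re-real-⊠ : ∀ c z → re (real c ⊠ z) ≃ c ⊗ re z
  re-real-⊠ c (a +i b) = pointwise λ n →
    solve 3 (λ c a b → c :* a :- con 0ℚ :* b := c :* a) ≡.refl (seq c n) (seq a n) (seq b n)

  parallelogram : ∀ z w → ‖ z ⊞ w ‖² ⊕ ‖ z ⊞ ⊟ w ‖² ≃ ‖ z ‖² ⊕ ‖ z ‖² ⊕ (‖ w ‖² ⊕ ‖ w ‖²)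
  parallelogram (a +i b) (c +i d) = pointwise λ n → solve 4 (λ a b c d →
    ((a :+ c) :* (a :+ c) :+ (b :+ d) :* (b :+ d)) :+ ((a :- c) :* (a :- c) :+ (b :- d) :* (b :- d))
    := (a :* a :+ b :* b) :+ (a :* a :+ b :* b) :+ ((c :* c :+ d :* d) :+ (c :* c :+ d :* d)))
    ≡.refl (seq a n) (seq b n) (seq c n) (seq d n)

  -- The square behind Cauchy–Schwarz.
  ‖tf*-a‖² : ∀ t f a → ‖ real t ⊠ f † ⊞ ⊟ a ‖²
                       ≃ (t ⊗ t ⊗ ‖ f ‖² ⊕ ‖ a ‖²) ⊕ ⊖ (t ⊗ re (f ⊠ a) ⊕ t ⊗ re (f ⊠ a))
  ‖tf*-a‖² t (f +i g) (a +i b) = pointwise λ n → solve 5 (λ t f g a b →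
    let x = (t :* f :- con 0ℚ :* (:- g)) :- a
        y = (t :* (:- g) :+ con 0ℚ :* f) :- b
    in x :* x :+ y :* y
       := (t :* t :* (f :* f :+ g :* g) :+ (a :* a :+ b :* b)) :- (t :* (f :* a :- g :* b) :+ t :* (f :* a :- g :* b)))
    ≡.refl (seq t n) (seq f n) (seq g n) (seq a n) (seq b n)

ℂ-setoid : Setoid 0ℓ 0ℓ
ℂ-setoid = record { isEquivalence = ≃ᶜ-isEquivalence }

ℂ-commutativeRing : CommutativeRing 0ℓ 0ℓ
ℂ-commutativeRing = record
  { Carrier = ℂ ; _≈_ = _≃ᶜ_ ; _+_ = _⊞_ ; _*_ = _⊠_ ; -_ = ⊟_ ; 0# = real (ι 0ℚ) ; 1# = real (ι 1ℚ)
  ; isCommutativeRing = record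
    { isRing = record
      { +-isAbelianGroup = record
        { isGroup = record
          { isMonoid = record
            { isSemigroup = record
              { isMagma = record { isEquivalence = ≃ᶜ-isEquivalence ; ∙-cong = ⊞-cong }
              ; assoc = ⊞-assoc
              }
            ; identity = comm∧idˡ⇒id ⊞-comm ⊞-identityˡ
            }
          ; inverse = comm∧invˡ⇒inv ⊞-comm ⊟-inverseˡ
          ; ⁻¹-cong = ⊟-cong
          }
        ; comm = ⊞-comm
        }
      ; *-cong = ⊠-cong
      ; *-assoc = ⊠-assoc
      ; *-identity = comm∧idˡ⇒id ⊠-comm ⊠-identityˡ
      ; distrib = ⊠-distribˡ , comm∧distrˡ⇒distrʳ ⊞-cong ⊠-comm ⊠-distribˡ
      }
    ; *-comm = ⊠-comm
    }
  }
  where open Consequences ℂ-setoid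

module C = CommutativeRing ℂ-commutativeRing

⊠-difference : ∀ z u w v → z ⊠ (u ⊞ ⊟ v) ⊞ (z ⊞ ⊟ w) ⊠ v ≃ᶜ z ⊠ u ⊞ ⊟ (w ⊠ v)
⊠-difference z u w v = begin
  z ⊠ (u ⊞ ⊟ v) ⊞ (z ⊞ ⊟ w) ⊠ v                   ≈⟨ C.+-cong (C.distribˡ z u (⊟ v)) (C.distribʳ v z (⊟ w)) ⟩
  (z ⊠ u ⊞ z ⊠ ⊟ v) ⊞ (z ⊠ v ⊞ ⊟ w ⊠ v)           ≈⟨ C.+-assoc _ _ _ ⟩
  z ⊠ u ⊞ (z ⊠ ⊟ v ⊞ (z ⊠ v ⊞ ⊟ w ⊠ v))           ≈⟨ C.+-congˡ (C.+-assoc _ _ _) ⟨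
  z ⊠ u ⊞ ((z ⊠ ⊟ v ⊞ z ⊠ v) ⊞ ⊟ w ⊠ v)           ≈⟨ C.+-congˡ (C.+-congʳ (C.distribˡ z (⊟ v) v)) ⟨
  z ⊠ u ⊞ (z ⊠ (⊟ v ⊞ v) ⊞ ⊟ w ⊠ v)               ≈⟨ C.+-congˡ (C.+-congʳ (C.*-congˡ (C.-‿inverseˡ v))) ⟩
  z ⊠ u ⊞ (z ⊠ real (ι 0ℚ) ⊞ ⊟ w ⊠ v)             ≈⟨ C.+-congˡ (C.+-congʳ (C.zeroʳ z)) ⟩
  z ⊠ u ⊞ (real (ι 0ℚ) ⊞ ⊟ w ⊠ v)                 ≈⟨ C.+-congˡ (C.+-identityˡ _) ⟩
  z ⊠ u ⊞ ⊟ w ⊠ v                                 ≈⟨ C.+-congˡ (RingProperties.-‿distribˡ-* C.ring w v) ⟨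
  z ⊠ u ⊞ ⊟ (w ⊠ v)                               ∎
  where open SetoidReasoning C.setoid

module ℂ^ = Exp C.semiring
open ℂ^ using () renaming (_^_ to _^ᶜ′_)
module ℂ^ᶜ = CommutativeExp C.commutativeSemiring

-- Agreement of the opaque operations with those of the definitions

opaque
  unfolding _⊕_

  +ʳ-⊕ : ∀ x y → x +ʳ y ≡ x ⊕ y
  +ʳ-⊕ x y = ≡.refl

  -ʳ-⊖ : ∀ x → -ʳ x ≡ ⊖ x
  -ʳ-⊖ x = ≡.refl

-ʳ-⊕⊖ : ∀ x y → x -ʳ y ≡ x ⊕ ⊖ y
-ʳ-⊕⊖ x y = ≡.trans (+ʳ-⊕ x (-ʳ y)) (cong (x ⊕_) (-ʳ-⊖ y))

opaque
  unfolding _⊞_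

  +ᶜ-⊞ : ∀ z w → z +ᶜ w ≡ z ⊞ w
  +ᶜ-⊞ z w = ≡.cong₂ _+i_ (+ʳ-⊕ (re z) (re w)) (+ʳ-⊕ (im z) (im w))

  ⊠-unique : ∀ (_+_ _-_ _·_ : ℝ → ℝ → ℝ) → (∀ x y → x + y ≡ x ⊕ y) →
             (∀ x y → x - y ≡ x ⊕ ⊖ y) → (∀ x y → x · y ≡ x ⊗ y) → ∀ z w →
             ((re z · re w) - (im z · im w)) +i ((re z · im w) + (im z · re w)) ≡ z ⊠ w
  ⊠-unique _+_ _-_ _·_ +≡ -≡ ·≡ z w = ≡.cong₂ _+i_
    (≡.trans (-≡ _ _) (≡.cong₂ (λ x y → x ⊕ ⊖ y) (·≡ (re z) (re w)) (·≡ (im z) (im w))))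
    (≡.trans (+≡ _ _) (≡.cong₂ _⊕_ (·≡ (re z) (im w)) (·≡ (im z) (re w))))

  *ᶜ-⊠ : ∀ z w → z *ᶜ w ≡ z ⊠ w
  *ᶜ-⊠ = ⊠-unique _+ʳ_ _-ʳ_ _*ʳ_ +ʳ-⊕ -ʳ-⊕⊖ *ʳ-⊗

  -ᶜ-⊟ : ∀ z → -ᶜ z ≡ ⊟ z
  -ᶜ-⊟ z = ≡.cong₂ _+i_ (-ʳ-⊖ (re z)) (-ʳ-⊖ (im z))

  conj-† : ∀ z → conj z ≡ z †
  conj-† z = cong (re z +i_) (-ʳ-⊖ (im z))

  ‖‖²-unique : ∀ (_+_ _·_ : ℝ → ℝ → ℝ) → (∀ x y → x + y ≡ x ⊕ y) → (∀ x y → x · y ≡ x ⊗ y) →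
               ∀ z → (re z · re z) + (im z · im z) ≡ ‖ z ‖²
  ‖‖²-unique _+_ _·_ +≡ ·≡ z = ≡.trans (+≡ _ _) (≡.cong₂ _⊕_ (·≡ (re z) (re z)) (·≡ (im z) (im z)))

  ∣∣²-‖‖² : ∀ z → ∣ z ∣² ≡ ‖ z ‖²
  ∣∣²-‖‖² = ‖‖²-unique _+ʳ_ _*ʳ_ +ʳ-⊕ *ʳ-⊗

  fromℝ-real : ∀ x → fromℝ x ≡ real x
  fromℝ-real x = cong (x +i_) (fromℚ-ι 0ℚ)

fromℝ0-real : fromℝ 0ʳ ≡ real (ι 0ℚ)
fromℝ0-real = ≡.trans (fromℝ-real 0ʳ) (cong real (fromℚ-ι 0ℚ))

fromℝ1-real : fromℝ 1ʳ ≡ real (ι 1ℚ)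
fromℝ1-real = ≡.trans (fromℝ-real 1ʳ) (cong real (fromℚ-ι 1ℚ))

^ᶜ-^ : ∀ z n → z ^ᶜ n ≡ z ^ᶜ′ n
^ᶜ-^ z n = ≡.trans (×-unique (RawRing.*-rawMonoid ℂ-rawRing) _⊠_ (real (ι 1ℚ)) fromℝ1-real *ᶜ-⊠ z n)
  (≡.sym (×-unique (RawSemiring.*-rawMonoid (RawRing.rawSemiring C.rawRing)) _⊠_ (real (ι 1ℚ)) ≡.refl (λ _ _ → ≡.refl) z n))

-- A substitute for the triangle inequality that avoids square roots: drop |z - w|² from the
-- parallelogram law. The lost factor 2 is harmless for limits.
‖⊞‖²≼ : ∀ z w → ‖ z ⊞ w ‖² ≼ ‖ z ‖² ⊕ ‖ z ‖² ⊕ (‖ w ‖² ⊕ ‖ w ‖²)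
‖⊞‖²≼ z w = begin
  ‖ z ⊞ w ‖²                          ≈⟨ R.+-identityʳ _ ⟨
  ‖ z ⊞ w ‖² ⊕ ι 0ℚ                   ≲⟨ +-mono-≼ ≼-refl (‖‖²-nonNeg (z ⊞ ⊟ w)) ⟩
  ‖ z ⊞ w ‖² ⊕ ‖ z ⊞ ⊟ w ‖²           ≈⟨ parallelogram z w ⟩
  ‖ z ‖² ⊕ ‖ z ‖² ⊕ (‖ w ‖² ⊕ ‖ w ‖²) ∎
  where open ≼-Reasoning

-- Expand |t f* - a|² ≥ 0 and use |f|² ≤ 1. The bound is linear in `re (f ⊠ a)`, so it can be
-- averaged over all points as it stands.
2t·re≼ : ∀ t f a → ‖ f ‖² ≼ ι 1ℚ → t ⊗ re (f ⊠ a) ⊕ t ⊗ re (f ⊠ a) ≼ t ⊗ t ⊕ ‖ a ‖²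
2t·re≼ t f a f≼1 = ≼-trans
  (0≼y-x⇒x≼y (≼-trans (‖‖²-nonNeg _) (≼-reflexive (‖tf*-a‖² t f a))))
  (+-mono-≼ (≼-trans (⊗-monoˡ-≼ (square-nonNeg t) f≼1) (≼-reflexive (R.*-identityʳ _))) ≼-refl)

‖‖²-^ : ∀ z n → ‖ z ^ᶜ′ n ‖² ≃ ‖ z ‖² ^ᴿ n
‖‖²-^ z zero    = R.trans (‖real‖² (ι 1ℚ)) (R.*-identityˡ _)
‖‖²-^ z (suc n) = R.trans (‖⊠‖² z _) (R.*-congˡ (‖‖²-^ z n))

module ≃ᶜ-Reasoning = SetoidReasoning C.setoid

-- The root of unity

-- Stated with the squared modulus, which tends to 0 exactly when the modulus does.
Null : (ℕ → ℂ) → Set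
Null z = ∀ ε → 0ℚ ℚ.< ε → Eventually (λ n → ‖ z n ‖² ≼ ι ε)

Limit : (ℕ → ℂ) → ℂ → Set
Limit z w = Null (λ n → z n ⊞ ⊟ w)

opaque
  unfolding _⊕_

  -- The quarter matches the four squared moduli on the right of `‖⊞‖²≼`.
  ε≡4·¼ε : ∀ ε → let δ = ½ ℚ.* (½ ℚ.* ε) in ι δ ⊕ ι δ ⊕ (ι δ ⊕ ι δ) ≃ ι ε
  ε≡4·¼ε ε = pointwise λ _ → solve 1 (λ ε → let δ = con ½ :* (con ½ :* ε) in δ :+ δ :+ (δ :+ δ) := ε) ≡.refl ε

  0<ʳι : ∀ {q} → 0ℚ ℚ.< q → 0ʳ <ʳ ι q
  0<ʳι {q} 0<q = q , 0<q , 0 , λ _ _ → ℚₚ.≤-reflexive (ℚₚ.+-identityˡ q)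

null-cong : ∀ {z w} → (∀ n → z n ≃ᶜ w n) → Null z → Null w
null-cong z≃w null ε 0<ε = eventually₁ (null ε 0<ε) λ n z≼ε →
  ≼-trans (≼-reflexive (‖‖²-cong (C.sym (z≃w n)))) z≼ε

null-+ : ∀ {z w} → Null z → Null w → Null (λ n → z n ⊞ w n)
null-+ nullᶻ nullʷ ε 0<ε = eventually₂ (nullᶻ _ 0<δ) (nullʷ _ 0<δ) λ n z≼δ w≼δ →
  ≼-trans (‖⊞‖²≼ _ _) (≼-trans (+-mono-≼ (+-mono-≼ z≼δ z≼δ) (+-mono-≼ w≼δ w≼δ)) (≼-reflexive (ε≡4·¼ε ε)))
  where 0<δ = half-positive (half-positive 0<ε)

null-neg : ∀ {z} → Null z → Null (λ n → ⊟ z n)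
null-neg null ε 0<ε = eventually₁ (null ε 0<ε) λ n z≼ε → ≼-trans (≼-reflexive (‖⊟‖² _)) z≼ε

Bounded : (ℕ → ℂ) → Set
Bounded z = ∃[ B ] (0ℚ ℚ.< B × Eventually (λ n → ‖ z n ‖² ≼ ι B))

null-* : ∀ {z w} → Bounded z → Null w → Null (λ n → z n ⊠ w n)
null-* {z} {w} (B , 0<B , z≼B) null ε 0<ε =
  let δ , 0<δ , Bδ≡ε = divide 0<ε 0<B
  in eventually₂ z≼B (null δ 0<δ) λ n z≼B w≼δ → begin
     ‖ z n ⊠ w n ‖²          ≈⟨ ‖⊠‖² (z n) (w n) ⟩
     ‖ z n ‖² ⊗ ‖ w n ‖²     ≲⟨ ⊗-monoˡ-≼ (‖‖²-nonNeg (z n)) w≼δ ⟩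
     ‖ z n ‖² ⊗ ι δ          ≲⟨ ⊗-monoʳ-≼ (ι-mono (ℚₚ.<⇒≤ 0<δ)) z≼B ⟩
     ι B ⊗ ι δ               ≈⟨ ι-* B δ ⟨
     ι (B ℚ.* δ)             ≡⟨ cong ι Bδ≡ε ⟩
     ι ε                     ∎
  where open ≼-Reasoning

null-const : ∀ {w} → Null (λ _ → w) → w ≃ᶜ real (ι 0ℚ)
null-const null = ‖‖²-null (≼-limit λ ε 0<ε → let N , le = null ε 0<ε in
  ≼-trans (le N ℕₚ.≤-refl) (≼-reflexive (R.sym (R.+-identityˡ _))))

bounded-const : ∀ w → Bounded (λ _ → w)
bounded-const w = let B , 0<B , w≼B = bounded-by-rational ‖ w ‖² in B , 0<B , 0 , λ _ _ → w≼B

limit-bounded : ∀ {z w} → Limit z w → Bounded z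
limit-bounded {z} {w} lim =
  let B , 0<B , N , w≼B = bounded-const w
      D = 1ℚ ℚ.+ 1ℚ ℚ.+ (B ℚ.+ B)
  in D , ℚₚ.+-mono-< (ℚₚ.positive⁻¹ (1ℚ ℚ.+ 1ℚ)) (ℚₚ.+-mono-< 0<B 0<B) ,
     eventually₁ (lim 1ℚ (ℚₚ.positive⁻¹ 1ℚ)) λ n z-w≼1 → begin
     ‖ z n ‖²                                                     ≈⟨ ‖‖²-cong (cancel (z n) w) ⟨
     ‖ (z n ⊞ ⊟ w) ⊞ w ‖²                                         ≲⟨ ‖⊞‖²≼ _ _ ⟩
     ‖ z n ⊞ ⊟ w ‖² ⊕ ‖ z n ⊞ ⊟ w ‖² ⊕ (‖ w ‖² ⊕ ‖ w ‖²)
       ≲⟨ +-mono-≼ (+-mono-≼ z-w≼1 z-w≼1) (+-mono-≼ (w≼B N ℕₚ.≤-refl) (w≼B N ℕₚ.≤-refl)) ⟩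
     ι 1ℚ ⊕ ι 1ℚ ⊕ (ι B ⊕ ι B)                                    ≈⟨ R.+-cong (ι-+ 1ℚ 1ℚ) (ι-+ B B) ⟨
     ι (1ℚ ℚ.+ 1ℚ) ⊕ ι (B ℚ.+ B)                                  ≈⟨ ι-+ (1ℚ ℚ.+ 1ℚ) (B ℚ.+ B) ⟨
     ι D                                                          ∎
  where
  open ≼-Reasoning
  cancel : ∀ a b → (a ⊞ ⊟ b) ⊞ b ≃ᶜ a
  cancel a b = C.trans (C.+-assoc _ _ _) (C.trans (C.+-congˡ (C.-‿inverseˡ b)) (C.+-identityʳ a))

limit-unique : ∀ {z v w} → Limit z v → Limit z w → v ≃ᶜ w
limit-unique {z} {v} {w} limᵛ limʷ = begin
  v                      ≈⟨ C.+-identityʳ v ⟨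
  v ⊞ real (ι 0ℚ)        ≈⟨ C.+-congˡ (C.-‿inverseˡ w) ⟨
  v ⊞ (⊟ w ⊞ w)          ≈⟨ C.+-assoc _ _ _ ⟨
  (v ⊞ ⊟ w) ⊞ w          ≈⟨ C.+-congʳ (null-const (null-cong split (null-+ (null-neg limᵛ) limʷ))) ⟩
  real (ι 0ℚ) ⊞ w        ≈⟨ C.+-identityˡ w ⟩
  w                      ∎
  where
  open ≃ᶜ-Reasoning
  split : ∀ n → ⊟ (z n ⊞ ⊟ v) ⊞ (z n ⊞ ⊟ w) ≃ᶜ v ⊞ ⊟ w
  split n = ⊟-telescope (z n) v w

-- Induction through zᵐ⁺¹ - wᵐ⁺¹ = z(zᵐ - wᵐ) + wᵐ(z - w): each term is a bounded sequence times a
-- null one.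
limit-^ : ∀ {z w} m → Limit z w → Limit (λ n → z n ^ᶜ′ m) (w ^ᶜ′ m)
limit-^ {z} {w} zero lim = null-cong (λ _ → C.sym (C.-‿inverseʳ _))
  λ ε 0<ε → 0 , λ _ _ → ≼-trans (≼-reflexive (R.trans (‖real‖² (ι 0ℚ)) (R.zeroˡ _))) (ι-mono (ℚₚ.<⇒≤ 0<ε))
limit-^ {z} {w} (suc m) lim = null-cong
  (λ n → C.trans (C.+-congˡ (C.*-comm _ _)) (⊠-difference (z n) (z n ^ᶜ′ m) w (w ^ᶜ′ m)))
  (null-+ (null-* (limit-bounded lim) (limit-^ m lim)) (null-* (bounded-const (w ^ᶜ′ m)) lim))

⟶⇒limit : ∀ {z w} → z ⟶ w → Limit z w
⟶⇒limit {z} {w} conv ε 0<ε = eventually₁ (conv (ι δ) (0<ʳι 0<δ)) λ n z-w<δ² → begin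
  ‖ z n ⊞ ⊟ w ‖²     ≡⟨ to-‖‖² n ⟨
  ∣ z n +ᶜ (-ᶜ w) ∣² ≲⟨ <ʳ⇒≼ z-w<δ² ⟩
  ι δ *ʳ ι δ         ≡⟨ *ʳ-⊗ (ι δ) (ι δ) ⟩
  ι δ ⊗ ι δ          ≈⟨ ι-* δ δ ⟨
  ι (δ ℚ.* δ)        ≲⟨ ι-mono δ²≤ε ⟩
  ι ε                ∎
  where
  open ≼-Reasoning
  -- `_⟶_` bounds the squared modulus by δ², and δ ≤ 1 together with δ ≤ ε gives δ² ≤ ε without a
  -- root of ε.
  δ = ε ℚ.⊓ 1ℚ
  0<δ : 0ℚ ℚ.< δ
  0<δ with ℚₚ.⊓-sel ε 1ℚ
  ... | inj₁ δ≡ε = subst (0ℚ ℚ.<_) (≡.sym δ≡ε) 0<ε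
  ... | inj₂ δ≡1 = subst (0ℚ ℚ.<_) (≡.sym δ≡1) (ℚₚ.positive⁻¹ 1ℚ)
  δ²≤ε : δ ℚ.* δ ℚ.≤ ε
  δ²≤ε = ℚₚ.≤-trans (ℚₚ.*-monoˡ-≤-nonNeg δ {{ℚ.nonNegative (ℚₚ.<⇒≤ 0<δ)}} (ℚₚ.p⊓q≤q ε 1ℚ))
    (ℚₚ.≤-trans (ℚₚ.≤-reflexive (ℚₚ.*-identityʳ δ)) (ℚₚ.p⊓q≤p ε 1ℚ))
  to-‖‖² : ∀ n → ∣ z n +ᶜ (-ᶜ w) ∣² ≡ ‖ z n ⊞ ⊟ w ‖²
  to-‖‖² n = ≡.trans (∣∣²-‖‖² (z n +ᶜ (-ᶜ w)))
    (cong ‖_‖² (≡.trans (+ᶜ-⊞ (z n) (-ᶜ w)) (cong (z n ⊞_) (-ᶜ-⊟ w))))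

-- At q = 1/(n+1) this is the base of the approximant (1 + iy/(n+1))ⁿ⁺¹ of e^{iy}.
factor : ℚ → ℝ → ℂ
factor q y = ι 1ℚ +i (ι q ⊗ y)

opaque
  unfolding _⊕_ _⊞_

  factor-correct : ∀ q y → real (ι 1ℚ) ⊞ real (ι q) ⊠ (ι 0ℚ +i y) ≃ᶜ factor q y
  factor-correct q y = mk≃ᶜ
    (pointwise λ n → solve 2 (λ q y → con 1ℚ :+ (q :* con 0ℚ :- con 0ℚ :* y) := con 1ℚ) ≡.refl q (seq y n))
    (pointwise λ n → solve 2 (λ q y → con 0ℚ :+ (q :* y :+ con 0ℚ :* con 0ℚ) := q :* y) ≡.refl q (seq y n))

^ᶜ-^-≡ : ∀ {z w} n → z ≡ w → z ^ᶜ n ≡ w ^ᶜ′ n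
^ᶜ-^-≡ {z} n ≡.refl = ^ᶜ-^ z n

exp-limit : ∀ y w → IsExp (0ʳ +i y) w → Limit (λ n → factor (1ℤ ℚ./ suc n) y ^ᶜ′ suc n) w
exp-limit y w exp = null-cong {λ n → (fromℝ 1ʳ +ᶜ fromℝ (fromℚ (1ℤ ℚ./ suc n)) *ᶜ (0ʳ +i y)) ^ᶜ suc n ⊞ ⊟ w} term≃ (⟶⇒limit {λ n → (fromℝ 1ʳ +ᶜ fromℝ (fromℚ (1ℤ ℚ./ suc n)) *ᶜ (0ʳ +i y)) ^ᶜ suc n} {w} exp)
  where
  base≡ : ∀ n → (fromℝ 1ʳ +ᶜ fromℝ (fromℚ (1ℤ ℚ./ suc n)) *ᶜ (0ʳ +i y)) ≡ real (ι 1ℚ) ⊞ real (ι (1ℤ ℚ./ suc n)) ⊠ (ι 0ℚ +i y)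
  base≡ n = ≡.trans (+ᶜ-⊞ (fromℝ 1ʳ) (fromℝ (fromℚ (1ℤ ℚ./ suc n)) *ᶜ (0ʳ +i y)))
    (≡.cong₂ _⊞_ fromℝ1-real (≡.trans (*ᶜ-⊠ (fromℝ (fromℚ (1ℤ ℚ./ suc n))) (0ʳ +i y))
      (≡.cong₂ _⊠_ (≡.trans (fromℝ-real (fromℚ (1ℤ ℚ./ suc n))) (cong real (fromℚ-ι (1ℤ ℚ./ suc n))))
        (cong (_+i y) (fromℚ-ι 0ℚ)))))
  term≡ : ∀ n → (fromℝ 1ʳ +ᶜ fromℝ (fromℚ (1ℤ ℚ./ suc n)) *ᶜ (0ʳ +i y)) ^ᶜ suc n ≡ (real (ι 1ℚ) ⊞ real (ι (1ℤ ℚ./ suc n)) ⊠ (ι 0ℚ +i y)) ^ᶜ′ suc n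
  term≡ n = ^ᶜ-^-≡ {(fromℝ 1ʳ +ᶜ fromℝ (fromℚ (1ℤ ℚ./ suc n)) *ᶜ (0ʳ +i y))} (suc n) (base≡ n)
  term≃ : ∀ n → (fromℝ 1ʳ +ᶜ fromℝ (fromℚ (1ℤ ℚ./ suc n)) *ᶜ (0ʳ +i y)) ^ᶜ suc n ⊞ ⊟ w ≃ᶜ factor (1ℤ ℚ./ suc n) y ^ᶜ′ suc n ⊞ ⊟ w
  term≃ n = C.+-congʳ (C.trans {(fromℝ 1ʳ +ᶜ fromℝ (fromℚ (1ℤ ℚ./ suc n)) *ᶜ (0ʳ +i y)) ^ᶜ suc n} (C.reflexive (term≡ n)) (ℂ^.^-congˡ (suc n) (factor-correct (1ℤ ℚ./ suc n) y)))

-- Fractions in ℚ are reduced to lowest terms, so the two sides do not compute to the same form; the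
-- unnormalised rationals multiply without cancelling.
/-*-/ : ∀ i j a b → (i ℚ./ suc a) ℚ.* (j ℚ./ suc b) ≡ (i ℤ.* j) ℚ./ (suc a ℕ.* suc b)
/-*-/ i j a b = ℚₚ.toℚᵘ-injective (begin
  ℚ.toℚᵘ ((i ℚ./ suc a) ℚ.* (j ℚ./ suc b))               ≈⟨ ℚₚ.toℚᵘ-homo-* (i ℚ./ suc a) (j ℚ./ suc b) ⟩
  ℚ.toℚᵘ (i ℚ./ suc a) ℚᵘ.* ℚ.toℚᵘ (j ℚ./ suc b)         ≈⟨ ℚᵘₚ.*-cong (ℚₚ.toℚᵘ-fromℚᵘ (ℚᵘ.mkℚᵘ i a)) (ℚₚ.toℚᵘ-fromℚᵘ (ℚᵘ.mkℚᵘ j b)) ⟩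
  ℚᵘ.mkℚᵘ i a ℚᵘ.* ℚᵘ.mkℚᵘ j b                           ≈⟨ ℚₚ.toℚᵘ-fromℚᵘ _ ⟨
  ℚ.toℚᵘ ((i ℤ.* j) ℚ./ (suc a ℕ.* suc b))               ∎)
  where open SetoidReasoning ℚᵘₚ.≃-setoid

-- (1 + iθ/(p(n+1)))^{n+1} tends to e^{iθ/p}, and its p-th power is a term of
-- the sequence tending to e^{iθ}.
root-of-unity′ : ∀ p ω π θ θ/p → θ ≡ ι (+ 2 ℚ./ 1) ⊗ π → θ/p ≡ ι (+ 2 ℚ./ suc p) ⊗ π →
                 IsExp (0ʳ +i θ) (fromℝ 1ʳ) → IsExp (0ʳ +i θ/p) ω → ω ^ᶜ′ suc p ≃ᶜ real (ι 1ℚ)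
root-of-unity′ p ω π θ θ/p θ≡ θ/p≡ exp2πi exp2πi/p =
  limit-unique (limit-^ (suc p) (exp-limit θ/p ω exp2πi/p)) (null-cong power≃ subsequence)
  where
  -- The order of the root is `suc p` here, and `suc (index n)` computes to `suc n * suc p`, so that
  -- the exponents agree by definition.
  index : ℕ → ℕ
  index n = p ℕ.+ n ℕ.* suc p
  whole : Limit (λ n → factor (1ℤ ℚ./ suc n) θ ^ᶜ′ suc n) (real (ι 1ℚ))
  whole = subst (Limit (λ n → factor (1ℤ ℚ./ suc n) θ ^ᶜ′ suc n)) fromℝ1-real (exp-limit θ (fromℝ 1ʳ) exp2πi)
  subsequence : Null (λ n → factor (1ℤ ℚ./ suc (index n)) θ ^ᶜ′ suc (index n) ⊞ ⊟ real (ι 1ℚ))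
  subsequence ε 0<ε = let N , small = whole ε 0<ε in N , λ n N≤n →
    small (index n) (ℕₚ.≤-trans N≤n (ℕₚ.≤-trans (ℕₚ.m≤m*n n (suc p)) (ℕₚ.m≤n+m _ p)))
  rational : ∀ n → (1ℤ ℚ./ suc (index n)) ℚ.* (+ 2 ℚ./ 1) ≡ (1ℤ ℚ./ suc n) ℚ.* (+ 2 ℚ./ suc p)
  rational n = ≡.trans (/-*-/ 1ℤ (+ 2) (index n) 0)
    (≡.trans (ℚₚ./-cong {1ℤ ℤ.* + 2} ≡.refl (ℕₚ.*-identityʳ (suc (index n)))) (≡.sym (/-*-/ 1ℤ (+ 2) n p)))
  factor≃ : ∀ n → factor (1ℤ ℚ./ suc (index n)) θ ≃ᶜ factor (1ℤ ℚ./ suc n) θ/p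
  factor≃ n = mk≃ᶜ R.refl (begin
    ι (1ℤ ℚ./ suc (index n)) ⊗ θ                                ≡⟨ cong (ι (1ℤ ℚ./ suc (index n)) ⊗_) θ≡ ⟩
    ι (1ℤ ℚ./ suc (index n)) ⊗ (ι (+ 2 ℚ./ 1) ⊗ π)              ≈⟨ R.*-assoc _ _ _ ⟨
    ι (1ℤ ℚ./ suc (index n)) ⊗ ι (+ 2 ℚ./ 1) ⊗ π                ≈⟨ R.*-congʳ (ι-* (1ℤ ℚ./ suc (index n)) (+ 2 ℚ./ 1)) ⟨
    ι ((1ℤ ℚ./ suc (index n)) ℚ.* (+ 2 ℚ./ 1)) ⊗ π              ≡⟨ cong (λ q → ι q ⊗ π) (rational n) ⟩
    ι ((1ℤ ℚ./ suc n) ℚ.* (+ 2 ℚ./ suc p)) ⊗ π                  ≈⟨ R.*-congʳ (ι-* (1ℤ ℚ./ suc n) (+ 2 ℚ./ suc p)) ⟩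
    ι (1ℤ ℚ./ suc n) ⊗ ι (+ 2 ℚ./ suc p) ⊗ π                    ≈⟨ R.*-assoc _ _ _ ⟩
    ι (1ℤ ℚ./ suc n) ⊗ (ι (+ 2 ℚ./ suc p) ⊗ π)                  ≡⟨ cong (ι (1ℤ ℚ./ suc n) ⊗_) θ/p≡ ⟨
    ι (1ℤ ℚ./ suc n) ⊗ θ/p                                      ∎)
    where
    open ≃-Reasoning
  power≃ : ∀ n → factor (1ℤ ℚ./ suc (index n)) θ ^ᶜ′ suc (index n) ⊞ ⊟ real (ι 1ℚ)
                 ≃ᶜ (factor (1ℤ ℚ./ suc n) θ/p ^ᶜ′ suc n) ^ᶜ′ suc p ⊞ ⊟ real (ι 1ℚ)
  power≃ n = C.+-congʳ (C.trans (ℂ^.^-congˡ (suc (index n)) (factor≃ n))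
    (C.sym (ℂ^.^-assocʳ (factor (1ℤ ℚ./ suc n) θ/p) (suc n) (suc p))))

root-of-unity : ∀ p .{{_ : ℕ.NonZero p}} (ω : ℂ) → IsExp2πi/ p ω → ω ^ᶜ′ p ≃ᶜ real (ι 1ℚ)
root-of-unity zero    ω _ = contradiction ≡.refl (ℕ.≢-nonZero⁻¹ 0)
root-of-unity (suc p) {{p≢0}} ω (π , (_ , exp2πi , _) , exp2πi/p) = root-of-unity′ p ω π
  (fromℤ (+ 2) *ʳ π) (fromℚ (ℚ._/_ (+ 2) (suc p) {{p≢0}}) *ʳ π)
  (≡.trans (*ʳ-⊗ (fromℤ (+ 2)) π) (cong (_⊗ π) (fromℤ-ι (+ 2))))
  (≡.trans (*ʳ-⊗ (fromℚ (ℚ._/_ (+ 2) (suc p) {{p≢0}})) π) (cong (_⊗ π) (fromℚ-ι (ℚ._/_ (+ 2) (suc p) {{p≢0}}))))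
  exp2πi exp2πi/p

‖root-of-unity‖² : ∀ p .{{_ : ℕ.NonZero p}} {ω} → ω ^ᶜ′ p ≃ᶜ real (ι 1ℚ) → ‖ ω ‖² ≃ ι 1ℚ
‖root-of-unity‖² zero    _ = contradiction ≡.refl (ℕ.≢-nonZero⁻¹ 0)
‖root-of-unity‖² (suc p) {ω} ω^p≃1 = ^≃1⇒≃1 p (‖‖²-nonNeg ω)
  (R.trans (R.sym (‖‖²-^ ω (suc p))) (R.trans (‖‖²-cong ω^p≃1) (R.trans (‖real‖² (ι 1ℚ)) (R.*-identityˡ _))))

-- Characters and averages

module Character (p : ℕ) .{{_ : ℕ.NonZero p}} (ω : ℂ)
                 (ω^p≃1 : ω ^ᶜ′ p ≃ᶜ real (ι 1ℚ)) (‖ω‖²≃1 : ‖ ω ‖² ≃ ι 1ℚ) where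

  module F = CommutativeRing (𝔽 p)

  ^-period : ∀ k r → ω ^ᶜ′ (p ℕ.* k ℕ.+ r) ≃ᶜ ω ^ᶜ′ r
  ^-period k r = begin
    ω ^ᶜ′ (p ℕ.* k ℕ.+ r)             ≈⟨ ℂ^.^-homo-* ω (p ℕ.* k) r ⟩
    ω ^ᶜ′ (p ℕ.* k) ⊠ ω ^ᶜ′ r         ≈⟨ C.*-congʳ (ℂ^.^-assocʳ ω p k) ⟨
    (ω ^ᶜ′ p) ^ᶜ′ k ⊠ ω ^ᶜ′ r         ≈⟨ C.*-congʳ (ℂ^.^-congˡ k ω^p≃1) ⟩
    real (ι 1ℚ) ^ᶜ′ k ⊠ ω ^ᶜ′ r       ≈⟨ C.*-congʳ (1^k≃1 k) ⟩
    real (ι 1ℚ) ⊠ ω ^ᶜ′ r             ≈⟨ C.*-identityˡ _ ⟩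
    ω ^ᶜ′ r                           ∎
    where
    open ≃ᶜ-Reasoning
    1^k≃1 : ∀ k → real (ι 1ℚ) ^ᶜ′ k ≃ᶜ real (ι 1ℚ)
    1^k≃1 zero    = C.refl
    1^k≃1 (suc k) = C.trans (C.*-identityˡ _) (1^k≃1 k)

  ^-mod : ∀ m r → + m F.≈ + r → ω ^ᶜ′ m ≃ᶜ ω ^ᶜ′ r
  ^-mod m r (divides (+ k) eq) = step m r k eq
    where
    step : ∀ m r k → + m ℤ.- + r ≡ + k ℤ.* + p → ω ^ᶜ′ m ≃ᶜ ω ^ᶜ′ r
    step m r k eq = subst (λ n → ω ^ᶜ′ n ≃ᶜ ω ^ᶜ′ r) (≡.sym m≡) (^-period k r)
      where
      open ≡.≡-Reasoning
      m≡ : m ≡ p ℕ.* k ℕ.+ r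
      m≡ = ℤₚ.+-injective (begin
        + m                       ≡⟨ ℤS.solve 2 (λ m r → m ℤS.:= (m ℤS.:- r) ℤS.:+ r) ≡.refl (+ m) (+ r) ⟩
        (+ m ℤ.- + r) ℤ.+ + r     ≡⟨ cong (ℤ._+ + r) eq ⟩
        + k ℤ.* + p ℤ.+ + r       ≡⟨ cong (ℤ._+ + r) (ℤₚ.pos-* k p) ⟨
        + (k ℕ.* p ℕ.+ r)         ≡⟨ cong (λ n → + (n ℕ.+ r)) (ℕₚ.*-comm k p) ⟩
        + (p ℕ.* k ℕ.+ r)         ∎)
  -- A negative quotient means that `r` is the larger exponent, so the roles are exchanged.
  ^-mod m r (divides -[1+ k ] eq) = C.sym (^-mod r m (divides (+ suc k) (begin
    + r ℤ.- + m             ≡⟨ ℤS.solve 2 (λ m r → r ℤS.:- m ℤS.:= ℤS.:- (m ℤS.:- r)) ≡.refl (+ m) (+ r) ⟩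
    ℤ.- (+ m ℤ.- + r)       ≡⟨ cong ℤ.-_ eq ⟩
    ℤ.- (-[1+ k ] ℤ.* + p)  ≡⟨ ℤₚ.neg-distribˡ-* -[1+ k ] (+ p) ⟩
    + suc k ℤ.* + p         ∎)))
    where
    open ≡.≡-Reasoning

  -- The additive character of 𝔽 p. Reducing the exponent gives negative integers a meaning and
  -- matches `ω^_`.
  χ : ℤ → ℂ
  χ x = ω ^ᶜ′ (x %ℕ p)

  %ℕ-≈ : ∀ x → + (x %ℕ p) F.≈ x
  %ℕ-≈ x = divides (ℤ.- (x /ℕ p)) (begin
    + (x %ℕ p) ℤ.- x                                           ≡⟨ cong (ℤ._-_ (+ (x %ℕ p))) (a≡a%ℕn+[a/ℕn]*n x p) ⟩
    + (x %ℕ p) ℤ.- (+ (x %ℕ p) ℤ.+ (x /ℕ p) ℤ.* + p)           ≡⟨ ℤS.solve 3 (λ r q p → r ℤS.:- (r ℤS.:+ q ℤS.:* p) ℤS.:= (ℤS.:- q) ℤS.:* p) ≡.refl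
                                                                    (+ (x %ℕ p)) (x /ℕ p) (+ p) ⟩
    ℤ.- (x /ℕ p) ℤ.* + p                                       ∎)
    where
    open ≡.≡-Reasoning

  module F-Reasoning = SetoidReasoning F.setoid

  χ-cong : ∀ x y → x F.≈ y → χ x ≃ᶜ χ y
  χ-cong x y x≈y = ^-mod (x %ℕ p) (y %ℕ p) (begin
    + (x %ℕ p)   ≈⟨ %ℕ-≈ x ⟩
    x            ≈⟨ x≈y ⟩
    y            ≈⟨ %ℕ-≈ y ⟨
    + (y %ℕ p)   ∎)
    where open F-Reasoning

  χ-0 : χ 0ℤ ≃ᶜ real (ι 1ℚ)
  χ-0 = ^-mod (0ℤ %ℕ p) 0 (%ℕ-≈ 0ℤ)

  χ-+ : ∀ x y → χ (x ℤ.+ y) ≃ᶜ χ x ⊠ χ y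
  χ-+ x y = C.trans
    (^-mod ((x ℤ.+ y) %ℕ p) (x %ℕ p ℕ.+ y %ℕ p) (begin
      + ((x ℤ.+ y) %ℕ p)             ≈⟨ %ℕ-≈ (x ℤ.+ y) ⟩
      x ℤ.+ y                        ≈⟨ F.+-cong {+ (x %ℕ p)} {x} {+ (y %ℕ p)} {y} (%ℕ-≈ x) (%ℕ-≈ y) ⟨
      + (x %ℕ p) ℤ.+ + (y %ℕ p)      ∎))
    (ℂ^.^-homo-* ω (x %ℕ p) (y %ℕ p))
    where open F-Reasoning

  ‖χ‖² : ∀ x → ‖ χ x ‖² ≃ ι 1ℚ
  ‖χ‖² x = R.trans (‖‖²-^ ω (x %ℕ p)) (R.trans (ℝ^.^-congˡ (x %ℕ p) ‖ω‖²≃1) (1^n≃1 (x %ℕ p)))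

  -- χ(x)χ(-x) = 1 and |χ(x)| = 1, so the inverse of χ(x) is its conjugate.
  χ-neg : ∀ x → χ (ℤ.- x) ≃ᶜ χ x †
  χ-neg x = begin
    χ (ℤ.- x)                          ≈⟨ C.*-identityˡ _ ⟨
    real (ι 1ℚ) ⊠ χ (ℤ.- x)            ≈⟨ C.*-congʳ (real-cong (‖χ‖² x)) ⟨
    real ‖ χ x ‖² ⊠ χ (ℤ.- x)          ≈⟨ C.*-congʳ (z⊠z† (χ x)) ⟨
    χ x ⊠ χ x † ⊠ χ (ℤ.- x)            ≈⟨ C.*-congʳ (C.*-comm _ _) ⟩
    χ x † ⊠ χ x ⊠ χ (ℤ.- x)            ≈⟨ C.*-assoc _ _ _ ⟩
    χ x † ⊠ (χ x ⊠ χ (ℤ.- x))          ≈⟨ C.*-congˡ (χ-+ x (ℤ.- x)) ⟨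
    χ x † ⊠ χ (x ℤ.+ ℤ.- x)            ≡⟨ cong (λ y → χ x † ⊠ χ y) (ℤₚ.+-inverseʳ x) ⟩
    χ x † ⊠ χ 0ℤ                       ≈⟨ C.*-congˡ χ-0 ⟩
    χ x † ⊠ real (ι 1ℚ)                ≈⟨ C.*-identityʳ _ ⟩
    χ x †                              ∎
    where open ≃ᶜ-Reasoning

  χ-sub : ∀ x y → χ (x ℤ.- y) ≃ᶜ χ x ⊠ χ y †
  χ-sub x y = C.trans (χ-+ x (ℤ.- y)) (C.*-congˡ (χ-neg y))

-- Kept to a commutative monoid so as to serve twice: additively for averages, multiplicatively for
-- the products over subsets in the box norm.
module ListSum {c ℓ} (M : CommutativeMonoid c ℓ) where
  open CommutativeMonoid M renaming (Carrier to S)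
  open SetoidReasoning setoid
  open CommutativeSemigroupProperties commutativeSemigroup using (interchange)

  ∑ : List A → (A → S) → S
  ∑ xs h = foldr _∙_ ε (map h xs)

  ∑-cong : ∀ (xs : List A) {g h : A → S} → (∀ x → g x ≈ h x) → ∑ xs g ≈ ∑ xs h
  ∑-cong []       g≈h = refl
  ∑-cong (x ∷ xs) g≈h = ∙-cong (g≈h x) (∑-cong xs g≈h)

  ∑-∙ : ∀ (xs : List A) (g h : A → S) → ∑ xs (λ x → g x ∙ h x) ≈ ∑ xs g ∙ ∑ xs h
  ∑-∙ []       g h = sym (identityˡ ε)
  ∑-∙ (x ∷ xs) g h = trans (∙-congˡ (∑-∙ xs g h)) (interchange _ _ _ _)

  ∑-homo : (f : S → S) → f ε ≈ ε → (∀ x y → f (x ∙ y) ≈ f x ∙ f y) →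
           ∀ (xs : List A) h → ∑ xs (f ∘ h) ≈ f (∑ xs h)
  ∑-homo f f-ε f-∙ []       h = sym f-ε
  ∑-homo f f-ε f-∙ (x ∷ xs) h = trans (∙-congˡ (∑-homo f f-ε f-∙ xs h)) (sym (f-∙ _ _))

  ∑-++ : ∀ (xs ys : List A) h → ∑ (xs ++ ys) h ≈ ∑ xs h ∙ ∑ ys h
  ∑-++ []       ys h = sym (identityˡ _)
  ∑-++ (x ∷ xs) ys h = trans (∙-congˡ (∑-++ xs ys h)) (sym (assoc _ _ _))

  ∑-map : ∀ (f : A → B) xs h → ∑ (map f xs) h ≡ ∑ xs (h ∘ f)
  ∑-map f []       h = ≡.refl
  ∑-map f (x ∷ xs) h = cong (h (f x) ∙_) (∑-map f xs h)

  ∑-cartesianProductWith : ∀ (f : A → B → D) xs ys h →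
    ∑ (cartesianProductWith f xs ys) h ≈ ∑ xs (λ x → ∑ ys (λ y → h (f x y)))
  ∑-cartesianProductWith f []       ys h = refl
  ∑-cartesianProductWith f (x ∷ xs) ys h = begin
    ∑ (map (f x) ys ++ cartesianProductWith f xs ys) h             ≈⟨ ∑-++ (map (f x) ys) _ h ⟩
    ∑ (map (f x) ys) h ∙ ∑ (cartesianProductWith f xs ys) h        ≈⟨ ∙-cong (reflexive (∑-map (f x) ys h))
                                                                        (∑-cartesianProductWith f xs ys h) ⟩
    ∑ ys (λ y → h (f x y)) ∙ ∑ xs (λ x → ∑ ys (λ y → h (f x y)))   ∎

open ListSum R.+-commutativeMonoid
module ∏ = ListSum C.*-commutativeMonoid

∑-mono : ∀ (xs : List A) {g h : A → ℝ} → (∀ x → g x ≼ h x) → ∑ xs g ≼ ∑ xs h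
∑-mono []       g≼h = ≼-refl
∑-mono (x ∷ xs) g≼h = +-mono-≼ (g≼h x) (∑-mono xs g≼h)

weight : List A → ℝ
weight []       = ι 0ℚ
weight (_ ∷ xs) = ι (1ℤ ℚ./ suc (length xs))

-- Box averages and biases are compared with reals through their real parts, so every estimate can
-- be made in this real average. As `weight` vanishes on the empty list, linearity and monotonicity
-- need no case distinction.
𝔼ʳ : List A → (A → ℝ) → ℝ
𝔼ʳ xs h = weight xs ⊗ ∑ xs h

foldr-cong-≡ : ∀ (_·_ _•_ : B → B → B) e e′ → (∀ x y → x · y ≡ x • y) → e ≡ e′ →
               ∀ {g h : A → B} → (∀ x → g x ≡ h x) → ∀ xs → foldr _·_ e (map g xs) ≡ foldr _•_ e′ (map h xs)
foldr-cong-≡ _·_ _•_ e e′ ·≡• e≡e′ g≡h []       = e≡e′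
foldr-cong-≡ _·_ _•_ e e′ ·≡• e≡e′ {g} {h} g≡h (x ∷ xs) =
  ≡.trans (·≡• (g x) _) (≡.cong₂ _•_ (g≡h x) (foldr-cong-≡ _·_ _•_ e e′ ·≡• e≡e′ g≡h xs))

𝔼-∷ : ∀ (x : A) xs g →
      𝔼 (x ∷ xs) g ≡ fromℝ (fromℚ (1ℤ ℚ./ suc (length xs))) *ᶜ foldr _+ᶜ_ (fromℝ 0ʳ) (map g (x ∷ xs))
𝔼-∷ x xs g = ≡.refl

𝔼-real : ∀ (x : A) xs g → 𝔼 (x ∷ xs) g ≡ real (weight (x ∷ xs)) ⊠ foldr _⊞_ (real (ι 0ℚ)) (map g (x ∷ xs))
𝔼-real x xs g = ≡.trans (𝔼-∷ x xs g) (≡.trans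
  (*ᶜ-⊠ (fromℝ (fromℚ (1ℤ ℚ./ suc (length xs)))) (foldr _+ᶜ_ (fromℝ 0ʳ) (map g (x ∷ xs))))
  (≡.cong₂ _⊠_
    (≡.trans (fromℝ-real (fromℚ (1ℤ ℚ./ suc (length xs)))) (cong real (fromℚ-ι (1ℤ ℚ./ suc (length xs)))))
    (foldr-cong-≡ _+ᶜ_ _⊞_ (fromℝ 0ʳ) (real (ι 0ℚ)) +ᶜ-⊞ fromℝ0-real {g} {g} (λ _ → ≡.refl) (x ∷ xs))))

re-∑ : ∀ (xs : List A) g → re (foldr _⊞_ (real (ι 0ℚ)) (map g xs)) ≃ ∑ xs (re ∘ g)
re-∑ []       g = re-real (ι 0ℚ)
re-∑ (x ∷ xs) g = R.trans (re-⊞ _ _) (R.+-congˡ (re-∑ xs g))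

re-𝔼 : ∀ (xs : List A) g → re (𝔼 xs g) ≃ 𝔼ʳ xs (re ∘ g)
re-𝔼 []       g = R.trans (R.trans (R.reflexive (cong re fromℝ0-real)) (re-real (ι 0ℚ))) (R.sym (R.zeroˡ _))
re-𝔼 (x ∷ xs) g = R.trans (R.reflexive (cong re (𝔼-real x xs g)))
  (R.trans (re-real-⊠ _ _) (R.*-congˡ (re-∑ (x ∷ xs) g)))

0≼1/suc : ∀ n → ι 0ℚ ≼ ι (1ℤ ℚ./ suc n)
0≼1/suc n = ι-mono (ℚₚ.nonNegative⁻¹ (1ℤ ℚ./ suc n) {{ℚₚ.normalize-nonNeg 1 (suc n)}})

weight-nonNeg : ∀ (xs : List A) → ι 0ℚ ≼ weight xs
weight-nonNeg []       = ≼-refl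
weight-nonNeg (_ ∷ xs) = 0≼1/suc (length xs)

𝔼ʳ-cong : ∀ (xs : List A) {g h : A → ℝ} → (∀ x → g x ≃ h x) → 𝔼ʳ xs g ≃ 𝔼ʳ xs h
𝔼ʳ-cong xs g≃h = R.*-congˡ (∑-cong xs g≃h)

𝔼ʳ-mono : ∀ (xs : List A) {g h : A → ℝ} → (∀ x → g x ≼ h x) → 𝔼ʳ xs g ≼ 𝔼ʳ xs h
𝔼ʳ-mono xs g≼h = ⊗-monoˡ-≼ (weight-nonNeg xs) (∑-mono xs g≼h)

𝔼ʳ-⊕ : ∀ (xs : List A) g h → 𝔼ʳ xs (λ x → g x ⊕ h x) ≃ 𝔼ʳ xs g ⊕ 𝔼ʳ xs h
𝔼ʳ-⊕ xs g h = R.trans (R.*-congˡ (∑-∙ xs g h)) (R.distribˡ _ _ _)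

𝔼ʳ-⊗ : ∀ (xs : List A) c h → 𝔼ʳ xs (λ x → c ⊗ h x) ≃ c ⊗ 𝔼ʳ xs h
𝔼ʳ-⊗ xs c h = begin
  weight xs ⊗ ∑ xs (λ x → c ⊗ h x)     ≈⟨ R.*-congˡ (∑-homo (c ⊗_) (R.zeroʳ c) (R.distribˡ c) xs h) ⟩
  weight xs ⊗ (c ⊗ ∑ xs h)             ≈⟨ R.*-assoc _ _ _ ⟨
  weight xs ⊗ c ⊗ ∑ xs h               ≈⟨ R.*-congʳ (R.*-comm _ _) ⟩
  c ⊗ weight xs ⊗ ∑ xs h               ≈⟨ R.*-assoc _ _ _ ⟩
  c ⊗ 𝔼ʳ xs h                          ∎
  where open ≃-Reasoning

𝔼ʳ-0 : ∀ (xs : List A) → 𝔼ʳ xs (λ _ → ι 0ℚ) ≃ ι 0ℚ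
𝔼ʳ-0 xs = R.trans (𝔼ʳ-cong xs (λ _ → R.sym (R.zeroˡ (ι 0ℚ)))) (R.trans (𝔼ʳ-⊗ xs (ι 0ℚ) _) (R.zeroˡ _))

suc/1 : ∀ n → (+ suc n) ℚ./ 1 ≡ 1ℚ ℚ.+ (+ n ℚ./ 1)
suc/1 n = ℚₚ.toℚᵘ-injective (begin
  ℚ.toℚᵘ (+ suc n ℚ./ 1)                       ≈⟨ ℚₚ.toℚᵘ-fromℚᵘ (ℚᵘ.mkℚᵘ (+ suc n) 0) ⟩
  ℚᵘ.mkℚᵘ (+ suc n) 0                          ≈⟨ ℚᵘ.*≡* (ℤS.solve 1 (λ n →
      (ℤS.con 1ℤ ℤS.:+ n) ℤS.:* ℤS.con 1ℤ ℤS.:= (ℤS.con 1ℤ ℤS.:* ℤS.con 1ℤ ℤS.:+ n ℤS.:* ℤS.con 1ℤ) ℤS.:* ℤS.con 1ℤ) ≡.refl (+ n)) ⟩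
  ℚᵘ.1ℚᵘ ℚᵘ.+ ℚᵘ.mkℚᵘ (+ n) 0                  ≈⟨ ℚᵘₚ.+-congʳ ℚᵘ.1ℚᵘ (ℚₚ.toℚᵘ-fromℚᵘ (ℚᵘ.mkℚᵘ (+ n) 0)) ⟨
  ℚᵘ.1ℚᵘ ℚᵘ.+ ℚ.toℚᵘ (+ n ℚ./ 1)               ≈⟨ ℚₚ.toℚᵘ-homo-+ 1ℚ (+ n ℚ./ 1) ⟨
  ℚ.toℚᵘ (1ℚ ℚ.+ (+ n ℚ./ 1))                  ∎)
  where
  open SetoidReasoning ℚᵘₚ.≃-setoid

1/n*n : ∀ n → (1ℤ ℚ./ suc n) ℚ.* (+ suc n ℚ./ 1) ≡ 1ℚ
1/n*n n = ≡.trans (/-*-/ 1ℤ (+ suc n) n 0) (ℚₚ.fromℚᵘ-cong {ℚᵘ.mkℚᵘ (1ℤ ℤ.* + suc n) (n ℕ.* 1)} {ℚᵘ.1ℚᵘ}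
  (ℚᵘ.*≡* (≡.trans (ℤₚ.*-identityʳ (1ℤ ℤ.* + suc n)) (cong (λ m → + suc m)
    (≡.trans (ℕₚ.+-identityʳ n) (≡.sym (≡.trans (ℕₚ.+-identityʳ (n ℕ.* 1)) (ℕₚ.*-identityʳ n))))))))

∑-const : ∀ (xs : List A) c → ∑ xs (λ _ → c) ≃ ι (+ length xs ℚ./ 1) ⊗ c
∑-const []       c = R.sym (R.zeroˡ c)
∑-const (x ∷ xs) c = begin
  c ⊕ ∑ xs (λ _ → c)                         ≈⟨ R.+-cong (R.sym (R.*-identityˡ c)) (∑-const xs c) ⟩
  ι 1ℚ ⊗ c ⊕ ι (+ length xs ℚ./ 1) ⊗ c       ≈⟨ R.distribʳ c _ _ ⟨
  (ι 1ℚ ⊕ ι (+ length xs ℚ./ 1)) ⊗ c         ≈⟨ R.*-congʳ (ι-+ 1ℚ _) ⟨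
  ι (1ℚ ℚ.+ (+ length xs ℚ./ 1)) ⊗ c         ≡⟨ cong (λ q → ι q ⊗ c) (suc/1 (length xs)) ⟨
  ι (+ suc (length xs) ℚ./ 1) ⊗ c            ∎
  where open ≃-Reasoning

𝔼ʳ-const : ∀ (x : A) xs c → 𝔼ʳ (x ∷ xs) (λ _ → c) ≃ c
𝔼ʳ-const x xs c = begin
  ι (1ℤ ℚ./ n) ⊗ ∑ (x ∷ xs) (λ _ → c)        ≈⟨ R.*-congˡ (∑-const (x ∷ xs) c) ⟩
  ι (1ℤ ℚ./ n) ⊗ (ι (+ n ℚ./ 1) ⊗ c)         ≈⟨ R.*-assoc _ _ _ ⟨
  ι (1ℤ ℚ./ n) ⊗ ι (+ n ℚ./ 1) ⊗ c           ≈⟨ R.*-congʳ (ι-* (1ℤ ℚ./ n) (+ n ℚ./ 1)) ⟨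
  ι ((1ℤ ℚ./ n) ℚ.* (+ n ℚ./ 1)) ⊗ c         ≡⟨ cong (λ q → ι q ⊗ c) (1/n*n (length xs)) ⟩
  ι 1ℚ ⊗ c                                   ≈⟨ R.*-identityˡ c ⟩
  c                                          ∎
  where
  open ≃-Reasoning
  n = suc (length xs)

-- An inequality for c ≥ 0, because the average over the empty list is 0 and not c.
𝔼ʳ-const-≼ : ∀ (xs : List A) {c} → ι 0ℚ ≼ c → 𝔼ʳ xs (λ _ → c) ≼ c
𝔼ʳ-const-≼ []       0≼c = ≼-trans (≼-reflexive (R.zeroˡ _)) 0≼c
𝔼ʳ-const-≼ (x ∷ xs) 0≼c = ≼-reflexive (𝔼ʳ-const x xs _)

-- On the empty list both sides are 0.
𝔼ʳ-idem : ∀ (xs : List A) h → 𝔼ʳ xs (λ _ → 𝔼ʳ xs h) ≃ 𝔼ʳ xs h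
𝔼ʳ-idem []       h = R.trans (R.zeroˡ _) (R.sym (R.zeroˡ _))
𝔼ʳ-idem (x ∷ xs) h = 𝔼ʳ-const x xs _

-- Translation invariance

Respects : {A : Set a} → Rel A b → (A → ℝ) → Set _
Respects _~_ h = ∀ x y → x ~ y → h x ≃ h y

-- The map τ may leave the list and permutes its entries only up to `_~_`. Testing against sums of
-- functions that respect `_~_` expresses this without exhibiting a permutation.
Invariant : {A : Set a} → List A → Rel A b → (A → A) → Set _
Invariant xs _~_ τ = ∀ h → Respects _~_ h → ∑ xs (h ∘ τ) ≃ ∑ xs h

invariant-map : ∀ {A : Set a} {B : Set b} {_~_ : Rel A ℓ} {ℓ′} {_~′_ : Rel B ℓ′} xs τ τ′ (f : A → B) →
                (∀ x y → x ~ y → f x ~′ f y) → (∀ x → τ′ (f x) ~′ f (τ x)) →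
                Invariant xs _~_ τ → Invariant (map f xs) _~′_ τ′
invariant-map xs τ τ′ f f-cong τ′f~fτ inv h h-cong = begin
  ∑ (map f xs) (h ∘ τ′)   ≡⟨ ∑-map f xs (h ∘ τ′) ⟩
  ∑ xs (h ∘ τ′ ∘ f)       ≈⟨ ∑-cong xs (λ x → h-cong _ _ (τ′f~fτ x)) ⟩
  ∑ xs (h ∘ f ∘ τ)        ≈⟨ inv (h ∘ f) (λ x y x~y → h-cong _ _ (f-cong x y x~y)) ⟩
  ∑ xs (h ∘ f)            ≡⟨ ∑-map f xs h ⟨
  ∑ (map f xs) h          ∎
  where open ≃-Reasoning

-- Induction on the number of coordinates, with the sum over tuples written as an iterated sum: the
-- tail is translated for each fixed first entry, then the first entry under the sum over tails.
invariant-tuples : ∀ {k} {A : Fin k → Set a} {_~_ : ∀ i → Rel (A i) b} (L : ∀ i → List (A i)) (τ : ∀ i → A i → A i) →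
                   (∀ i x → _~_ i x x) → (∀ i → Invariant (L i) (_~_ i) (τ i)) →
                   Invariant (tuples L) (λ x y → ∀ i → _~_ i (x i) (y i)) (λ x i → τ i (x i))
invariant-tuples {k = zero}  L τ ~-refl inv h h-cong = R.+-congʳ (h-cong _ _ λ ())
invariant-tuples {k = suc k} {A = A} L τ ~-refl inv h h-cong = begin
  ∑ (tuples L) (λ x → h (λ i → τ i (x i)))
    ≈⟨ ∑-cartesianProductWith (∀-cons {P = A}) (L zero) T _ ⟩
  ∑ (L zero) (λ u → ∑ T (λ t → h (λ i → τ i (∀-cons {P = A} u t i))))
    -- Two tuples with the same entries need not be the same function, so `h-cong` compares them
    -- entry by entry.
    ≈⟨ ∑-cong (L zero) (λ u → ∑-cong T (λ t → h-cong _ _ λ { zero → ~-refl _ _ ; (suc i) → ~-refl _ _ })) ⟩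
  ∑ (L zero) (λ u → ∑ T (λ t → h (∀-cons {P = A} (τ zero u) (λ i → τ (suc i) (t i)))))
    ≈⟨ ∑-cong (L zero) (λ u → invariant-tuples (λ i → L (suc i)) (λ i → τ (suc i))
         (λ i → ~-refl (suc i)) (λ i → inv (suc i)) (λ t → h (∀-cons {P = A} (τ zero u) t))
         (λ x y x~y → h-cong _ _ λ { zero → ~-refl _ _ ; (suc i) → x~y i })) ⟩
  ∑ (L zero) (λ u → ∑ T (λ t → h (∀-cons {P = A} (τ zero u) t)))
    ≈⟨ inv zero (λ u → ∑ T (λ t → h (∀-cons {P = A} u t)))
         (λ x y x~y → ∑-cong T (λ t → h-cong _ _ λ { zero → x~y ; (suc i) → ~-refl _ _ })) ⟩
  ∑ (L zero) (λ u → ∑ T (λ t → h (∀-cons {P = A} u t)))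
    ≈⟨ ∑-cartesianProductWith (∀-cons {P = A}) (L zero) T h ⟨
  ∑ (tuples L) h ∎
  where
  open ≃-Reasoning
  T = tuples (λ i → L (suc i))

module _ (p : ℕ) where

  private module F = CommutativeRing (𝔽 p)

  residues : List ℤ
  residues = map +_ (upTo p)

  -- Both sides add up `g` over `f 0`, ..., `f n`; they split off opposite ends.
  ∑-applyUpTo-suc : ∀ (g : ℕ → ℝ) (f : ℕ → ℕ) n →
    ∑ (applyUpTo (f ∘ suc) n) g ⊕ g (f 0) ≃ ∑ (applyUpTo f n) g ⊕ g (f n)
  ∑-applyUpTo-suc g f zero    = R.refl
  ∑-applyUpTo-suc g f (suc n) = begin
    (g (f 1) ⊕ ∑ (applyUpTo (λ m → f (suc (suc m))) n) g) ⊕ g (f 0)       ≈⟨ R.+-comm _ _ ⟩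
    g (f 0) ⊕ (g (f 1) ⊕ ∑ (applyUpTo (λ m → f (suc (suc m))) n) g)       ≈⟨ R.+-congˡ (R.+-comm _ _) ⟩
    g (f 0) ⊕ (∑ (applyUpTo (λ m → f (suc (suc m))) n) g ⊕ g (f 1))       ≈⟨ R.+-congˡ (∑-applyUpTo-suc g (λ m → f (suc m)) n) ⟩
    g (f 0) ⊕ (∑ (applyUpTo (f ∘ suc) n) g ⊕ g (f (suc n)))       ≈⟨ R.+-assoc _ _ _ ⟨
    (g (f 0) ⊕ ∑ (applyUpTo (f ∘ suc) n) g) ⊕ g (f (suc n))       ∎
    where open ≃-Reasoning

  ∑-applyUpTo-∘ : ∀ (g : ℕ → ℝ) (f : ℕ → ℕ) n → ∑ (applyUpTo f n) (g ∘ suc) ≡ ∑ (applyUpTo (suc ∘ f) n) g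
  ∑-applyUpTo-∘ g f zero    = ≡.refl
  ∑-applyUpTo-∘ g f (suc n) = cong (g (suc (f 0)) ⊕_) (∑-applyUpTo-∘ g (f ∘ suc) n)

  -- The shift turns 0, ..., p - 1 into 1, ..., p, and the new entry p is congruent to the lost
  -- entry 0.
  invariant-1+ : Invariant residues F._≈_ (λ x → 1ℤ ℤ.+ x)
  invariant-1+ h h-cong = begin
    ∑ residues (λ x → h (1ℤ ℤ.+ x))           ≡⟨ ∑-map +_ (upTo p) (λ x → h (1ℤ ℤ.+ x)) ⟩
    ∑ (upTo p) (λ n → h (+ suc n))            ≡⟨ ∑-applyUpTo-∘ (h ∘ +_) id p ⟩
    ∑ (applyUpTo suc p) (h ∘ +_)              ≈⟨ GroupProperties.∙-cancelʳ R.+-group _ _ _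
                                                   (R.trans (∑-applyUpTo-suc (h ∘ +_) id p) (R.+-congˡ (h-cong _ _ p≈0))) ⟩
    ∑ (upTo p) (h ∘ +_)                       ≡⟨ ∑-map +_ (upTo p) h ⟨
    ∑ residues h                              ∎
    where
    open ≃-Reasoning
    p≈0 : + p F.≈ 0ℤ
    p≈0 = divides 1ℤ (≡.trans (ℤₚ.+-identityʳ (+ p)) (≡.sym (ℤₚ.*-identityˡ (+ p))))

  Shift : ℤ → Set
  Shift x = Invariant residues F._≈_ (λ y → x ℤ.+ y)

  shift-respects : ∀ x {h} → Respects F._≈_ h → Respects F._≈_ (λ y → h (x ℤ.+ y))
  shift-respects x h-cong y z y≈z = h-cong _ _ (F.+-cong {x} {x} {y} {z} (F.refl {x}) y≈z)

  shift-+ : ∀ x y → Shift x → Shift y → Shift (x ℤ.+ y)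
  shift-+ x y inv-x inv-y h h-cong = begin
    ∑ residues (λ z → h (x ℤ.+ y ℤ.+ z))       ≈⟨ ∑-cong residues (λ z → R.reflexive (cong h (ℤₚ.+-assoc x y z))) ⟩
    ∑ residues (λ z → h (x ℤ.+ (y ℤ.+ z)))     ≈⟨ inv-y (λ z → h (x ℤ.+ z)) (shift-respects x h-cong) ⟩
    ∑ residues (λ z → h (x ℤ.+ z))             ≈⟨ inv-x h h-cong ⟩
    ∑ residues h                               ∎
    where open ≃-Reasoning

  shift-neg : ∀ x → Shift x → Shift (ℤ.- x)
  shift-neg x inv h h-cong = begin
    ∑ residues (λ z → h (ℤ.- x ℤ.+ z))               ≈⟨ inv (λ z → h (ℤ.- x ℤ.+ z)) (shift-respects (ℤ.- x) h-cong) ⟨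
    ∑ residues (λ z → h (ℤ.- x ℤ.+ (x ℤ.+ z)))       ≈⟨ ∑-cong residues (λ z → R.reflexive (cong h (cancel z))) ⟩
    ∑ residues h                                     ∎
    where
    open ≃-Reasoning
    cancel : ∀ z → ℤ.- x ℤ.+ (x ℤ.+ z) ≡ z
    cancel z = ≡.trans (≡.sym (ℤₚ.+-assoc (ℤ.- x) x z))
      (≡.trans (cong (ℤ._+ z) (ℤₚ.+-inverseˡ x)) (ℤₚ.+-identityˡ z))

  shift-ℕ : ∀ n → Shift (+ n)
  shift-ℕ zero    h h-cong = ∑-cong residues (λ z → R.reflexive (cong h (ℤₚ.+-identityˡ z)))
  shift-ℕ (suc n)          = shift-+ 1ℤ (+ n) invariant-1+ (shift-ℕ n)

  -- The shifts that preserve sums are closed under addition and negation and include 1, which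
  -- generates ℤ.
  shift-ℤ : ∀ x → Shift x
  shift-ℤ (+ n)    = shift-ℕ n
  shift-ℤ -[1+ n ] = shift-neg (+ suc n) (shift-ℕ (suc n))

module _ {p : ℕ} (V : Module (𝔽 p) a b) where
  open Module V
  private
    module F = CommutativeRing (𝔽 p)
    module Sum = FinSum +ᴹ-commutativeMonoid
  open SetoidReasoning ≈ᴹ-setoid

  linComb-cong : ∀ {d} (v : Fin d → Carrierᴹ) x y → (∀ j → x j F.≈ y j) → linComb V v x ≈ᴹ linComb V v y
  linComb-cong v x y x≈y = Sum.sum-cong-≋ (λ j → *ₗ-cong (x≈y j) ≈ᴹ-refl)

  linComb-+ : ∀ {d} (v : Fin d → Carrierᴹ) x y →
              linComb V v (λ j → x j ℤ.+ y j) ≈ᴹ linComb V v x +ᴹ linComb V v y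
  linComb-+ v x y = ≈ᴹ-trans (Sum.sum-cong-≋ (λ j → *ₗ-distribʳ (v j) (x j) (y j)))
    (Sum.∑-distrib-+ (λ j → x j *ₗ v j) (λ j → y j *ₗ v j))

  -- In coordinates with respect to the basis, adding v adds its coefficients one by one, so the
  -- claim reduces to shifts of residues.
  invariant-elements : ∀ (fd : FiniteDimensional V) v → Invariant (elements V fd) _≈ᴹ_ (v +ᴹ_)
  invariant-elements fd v = invariant-map (tuples λ _ → residues p) (λ x j → c j ℤ.+ x j) (v +ᴹ_)
    (linComb V basis) (linComb-cong basis) translate
    (invariant-tuples (λ _ → residues p) (λ j x → c j ℤ.+ x) (λ _ x → F.refl {x}) (λ j → shift-ℤ p (c j)))
    where
    open FiniteDimensional fd
    c = proj₁ (spanning v)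
    translate : ∀ x → v +ᴹ linComb V basis x ≈ᴹ linComb V basis (λ j → c j ℤ.+ x j)
    translate x = begin
      v +ᴹ linComb V basis x                      ≈⟨ +ᴹ-congʳ (proj₂ (spanning v)) ⟩
      linComb V basis c +ᴹ linComb V basis x      ≈⟨ linComb-+ basis c x ⟨
      linComb V basis (λ j → c j ℤ.+ x j)         ∎

-- Box products

-- `iterate` applies the additional conjugation innermost; the induction on coordinates needs it
-- outermost, where it can leave the product.
iterate-† : ∀ z n → iterate _† z (suc n) ≃ᶜ iterate _† z n †
iterate-† z zero    = C.refl
iterate-† z (suc n) = iterate-† (z †) n

iterate-†-cong : ∀ {z w} n → z ≃ᶜ w → iterate _† z n ≃ᶜ iterate _† w n
iterate-†-cong zero    z≃w = z≃w
iterate-†-cong (suc n) z≃w = iterate-†-cong n (†-cong z≃w)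

iterate-†-⊠ : ∀ z w n → iterate _† (z ⊠ w) n ≃ᶜ iterate _† z n ⊠ iterate _† w n
iterate-†-⊠ z w zero    = C.refl
iterate-†-⊠ z w (suc n) = C.trans (iterate-†-cong n (†-⊠ z w)) (iterate-†-⊠ (z †) (w †) n)

‖iterate-†‖² : ∀ z n → ‖ iterate _† z n ‖² ≃ ‖ z ‖²
‖iterate-†‖² z zero    = R.refl
‖iterate-†‖² z (suc n) = R.trans (‖iterate-†‖² (z †) n) (‖†‖² z)

‖∏‖²≼1 : ∀ (xs : List A) {g : A → ℂ} → (∀ x → ‖ g x ‖² ≼ ι 1ℚ) → ‖ ∏.∑ xs g ‖² ≼ ι 1ℚ
‖∏‖²≼1 []       g≼1 = ≼-reflexive (R.trans (‖real‖² (ι 1ℚ)) (R.*-identityˡ _))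
‖∏‖²≼1 (x ∷ xs) {g} g≼1 = begin
  ‖ g x ⊠ ∏.∑ xs g ‖²          ≈⟨ ‖⊠‖² (g x) (∏.∑ xs g) ⟩
  ‖ g x ‖² ⊗ ‖ ∏.∑ xs g ‖²     ≲⟨ ⊗-monoˡ-≼ (‖‖²-nonNeg (g x)) (‖∏‖²≼1 xs g≼1) ⟩
  ‖ g x ‖² ⊗ ι 1ℚ              ≈⟨ R.*-identityʳ _ ⟩
  ‖ g x ‖²                     ≲⟨ g≼1 x ⟩
  ι 1ℚ                         ∎
  where open ≼-Reasoning

mixture : ∀ {k} {A : Fin k → Set a} → Subset k → (∀ i → A i) → (∀ i → A i) → ∀ i → A i
mixture I x y i = if lookup I i then x i else y i

-- The integrand of the box norm. An arbitrary family of types is allowed so that fixing the first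
-- coordinate of `g` gives an integrand of the same kind.
boxProduct : ∀ {k} {A : Fin k → Set a} → ((∀ i → A i) → ℂ) → (∀ i → A i) → (∀ i → A i) → ℂ
boxProduct {k = k} g x y = ∏.∑ (subsets k) (λ I → iterate _† (g (mixture I x y)) ∣ I ∣)

boxProduct-⊠ : ∀ {k} {A : Fin k → Set a} (g h : (∀ i → A i) → ℂ) x y →
               boxProduct (λ z → g z ⊠ h z) x y ≃ᶜ boxProduct g x y ⊠ boxProduct h x y
boxProduct-⊠ {k = k} g h x y = C.trans
  (∏.∑-cong (subsets k) (λ I → iterate-†-⊠ (g (mixture I x y)) (h (mixture I x y)) ∣ I ∣))
  (∏.∑-∙ (subsets k) (λ I → iterate _† (g (mixture I x y)) ∣ I ∣) (λ I → iterate _† (h (mixture I x y)) ∣ I ∣))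

‖boxProduct‖²≼1 : ∀ {k} {A : Fin k → Set a} (g : (∀ i → A i) → ℂ) → (∀ x → ‖ g x ‖² ≼ ι 1ℚ) →
                  ∀ x y → ‖ boxProduct g x y ‖² ≼ ι 1ℚ
‖boxProduct‖²≼1 {k = k} g g≼1 x y = ‖∏‖²≼1 (subsets k) λ I →
  ≼-trans (≼-reflexive (‖iterate-†‖² (g (mixture I x y)) ∣ I ∣)) (g≼1 (mixture I x y))

-- Multiplicativity in each variable makes the alternating product telescope,
-- one coordinate at a time.
boxProduct-multiplicative :
  ∀ {k} {A : Fin k → Set a} (_⊝_ : ∀ {i} → A i → A i → A i) (Φ : (∀ i → A i) → ℂ) →
  (∀ x y → (∀ i → x i ≡ y i) → Φ x ≃ᶜ Φ y) →
  (∀ i x u v → Φ (x [ i ≔ u ⊝ v ]) ≃ᶜ Φ (x [ i ≔ u ]) ⊠ Φ (x [ i ≔ v ]) †) →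
  ∀ x y → boxProduct Φ x y ≃ᶜ Φ (λ i → y i ⊝ x i)
boxProduct-multiplicative {k = zero} _⊝_ Φ Φ-cong Φ-⊝ x y =
  C.trans (C.*-identityʳ _) (Φ-cong _ _ λ ())
boxProduct-multiplicative {k = suc k} {A = A} _⊝_ Φ Φ-cong Φ-⊝ x y = begin
  boxProduct Φ x y
    ≈⟨ ∏.∑-cartesianProductWith _∷_ (outside ∷ inside ∷ []) (subsets k) _ ⟩
  ∏.∑ (subsets k) (λ I → iterate _† (Φ (mixture (outside ∷ I) x y)) ∣ I ∣)
    ⊠ (∏.∑ (subsets k) (λ I → iterate _† (Φ (mixture (inside ∷ I) x y)) (suc ∣ I ∣)) ⊠ real (ι 1ℚ))
    ≈⟨ C.*-congˡ (C.*-identityʳ _) ⟩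
  ∏.∑ (subsets k) (λ I → iterate _† (Φ (mixture (outside ∷ I) x y)) ∣ I ∣)
    ⊠ ∏.∑ (subsets k) (λ I → iterate _† (Φ (mixture (inside ∷ I) x y)) (suc ∣ I ∣))
    -- A subset that omits the first coordinate sets it to `y zero`; one that contains it sets it to
    -- `x zero` and brings one more conjugation. Each half is thus the box product of a slice, the
    -- second one conjugated.
    ≈⟨ C.*-cong
         (∏.∑-cong (subsets k) λ I → iterate-†-cong ∣ I ∣ (Φ-cong _ _ λ { zero → ≡.refl ; (suc i) → ≡.refl }))
         (∏.∑-cong (subsets k) λ I → C.trans (iterate-† _ ∣ I ∣)
           (†-cong (iterate-†-cong ∣ I ∣ (Φ-cong _ _ λ { zero → ≡.refl ; (suc i) → ≡.refl })))) ⟩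
  boxProduct (slice (y zero)) x′ y′
    ⊠ ∏.∑ (subsets k) (λ I → iterate _† (slice (x zero) (mixture I x′ y′)) ∣ I ∣ †)
    ≈⟨ C.*-congˡ (∏.∑-homo _† (†-real (ι 1ℚ)) †-⊠ (subsets k) _) ⟩
  boxProduct (slice (y zero)) x′ y′ ⊠ boxProduct (slice (x zero)) x′ y′ †
    ≈⟨ C.*-cong (slice-product (y zero)) (†-cong (slice-product (x zero))) ⟩
  slice (y zero) d ⊠ slice (x zero) d †
    ≈⟨ C.*-cong (update (y zero)) (†-cong (update (x zero))) ⟩
  Φ (z [ zero ≔ y zero ]) ⊠ Φ (z [ zero ≔ x zero ]) †
    ≈⟨ Φ-⊝ zero z (y zero) (x zero) ⟨
  Φ (z [ zero ≔ y zero ⊝ x zero ])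
    ≈⟨ Φ-cong _ _ (λ { zero → ≡.refl ; (suc i) → ≡.refl }) ⟩
  Φ (λ i → y i ⊝ x i) ∎
  where
  open ≃ᶜ-Reasoning
  x′ = λ i → x (suc i)
  y′ = λ i → y (suc i)
  d = λ i → y′ i ⊝ x′ i
  z = λ i → y i ⊝ x i
  slice : A zero → (∀ i → A (suc i)) → ℂ
  slice u t = Φ (∀-cons {P = A} u t)
  update : ∀ u → slice u d ≃ᶜ Φ (z [ zero ≔ u ])
  update u = Φ-cong _ _ λ { zero → ≡.refl ; (suc i) → ≡.refl }
  slice-product : ∀ u → boxProduct (slice u) x′ y′ ≃ᶜ slice u d
  slice-product u = boxProduct-multiplicative _⊝_ (slice u)
    (λ s t s≡t → Φ-cong _ _ λ { zero → ≡.refl ; (suc i) → s≡t i })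
    (λ i t v w → C.trans (lift i t (v ⊝ w))
      (C.trans (Φ-⊝ (suc i) (∀-cons {P = A} u t) v w)
        (C.*-cong (C.sym (lift i t v)) (†-cong (C.sym (lift i t w))))))
    x′ y′
    where
    lift : ∀ i t v → slice u (t [ i ≔ v ]) ≃ᶜ Φ (∀-cons {P = A} u t [ suc i ≔ v ])
    lift i t v = Φ-cong _ _ λ { zero → ≡.refl ; (suc j) → ≡.refl }

-- Finite sums indexed by the forms

module Σʳ = SemiringSum R.semiring
module Σᶜ = SemiringSum C.semiring

𝔼ʳ-Σ : ∀ (xs : List A) {n} (h : Fin n → A → ℝ) → 𝔼ʳ xs (λ x → Σʳ.sum (λ i → h i x)) ≃ Σʳ.sum (λ i → 𝔼ʳ xs (h i))
𝔼ʳ-Σ xs {zero}  h = 𝔼ʳ-0 xs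
𝔼ʳ-Σ xs {suc n} h = R.trans (𝔼ʳ-⊕ xs (h zero) _) (R.+-congˡ (𝔼ʳ-Σ xs (h ∘ suc)))

Σʳ-mono : ∀ {n} {g h : Fin n → ℝ} → (∀ i → g i ≼ h i) → Σʳ.sum g ≼ Σʳ.sum h
Σʳ-mono {zero}  g≼h = ≼-refl
Σʳ-mono {suc n} g≼h = +-mono-≼ (g≼h zero) (Σʳ-mono (g≼h ∘ suc))

ν : ℕ → ℝ
ν n = ι (+ n ℚ./ 1)

ν-suc : ∀ n → ν (suc n) ≃ ι 1ℚ ⊕ ν n
ν-suc n = R.trans (R.reflexive (cong ι (suc/1 n))) (ι-+ 1ℚ (+ n ℚ./ 1))

ν-nonNeg : ∀ n → ι 0ℚ ≼ ν n
ν-nonNeg zero    = ≼-refl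
ν-nonNeg (suc n) = begin
  ι 0ℚ             ≈⟨ R.+-identityˡ _ ⟨
  ι 0ℚ ⊕ ι 0ℚ      ≲⟨ +-mono-≼ 0≼1 (ν-nonNeg n) ⟩
  ι 1ℚ ⊕ ν n       ≈⟨ ν-suc n ⟨
  ν (suc n)        ∎
  where open ≼-Reasoning

Σʳ-const : ∀ n c → Σʳ.sum {n} (λ _ → c) ≃ ν n ⊗ c
Σʳ-const zero    c = R.sym (R.zeroˡ c)
Σʳ-const (suc n) c = begin
  c ⊕ Σʳ.sum {n} (λ _ → c)      ≈⟨ R.+-cong (R.sym (R.*-identityˡ c)) (Σʳ-const n c) ⟩
  ι 1ℚ ⊗ c ⊕ ν n ⊗ c            ≈⟨ R.distribʳ c _ _ ⟨
  (ι 1ℚ ⊕ ν n) ⊗ c              ≈⟨ R.*-congʳ (ν-suc n) ⟨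
  ν (suc n) ⊗ c                 ∎
  where open ≃-Reasoning

re-Σᶜ : ∀ {n} (z : Fin n → ℂ) → re (Σᶜ.sum z) ≃ Σʳ.sum (re ∘ z)
re-Σᶜ {zero}  z = re-real (ι 0ℚ)
re-Σᶜ {suc n} z = R.trans (re-⊞ _ _) (R.+-congˡ (re-Σᶜ (z ∘ suc)))

†-Σᶜ : ∀ {n} (z : Fin n → ℂ) → Σᶜ.sum z † ≃ᶜ Σᶜ.sum (λ i → z i †)
†-Σᶜ {zero}  z = †-real (ι 0ℚ)
†-Σᶜ {suc n} z = C.trans (†-⊞ _ _) (C.+-congˡ (†-Σᶜ (z ∘ suc)))

re-⊠-Σᶜ : ∀ {n} w (z : Fin n → ℂ) → re (w ⊠ Σᶜ.sum z) ≃ Σʳ.sum (λ i → re (w ⊠ z i))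
re-⊠-Σᶜ w z = R.trans (re-≃ (Σᶜ.*-distribˡ-sum w z)) (re-Σᶜ (λ i → w ⊠ z i))

‖Σᶜ‖² : ∀ {n} (z : Fin n → ℂ) → ‖ Σᶜ.sum z ‖² ≃ Σʳ.sum (λ i → Σʳ.sum (λ j → re (z i ⊠ z j †)))
‖Σᶜ‖² {n} z = begin
  ‖ s ‖²                                              ≈⟨ re-real ‖ s ‖² ⟨
  re (real ‖ s ‖²)                                    ≈⟨ re-≃ (z⊠z† s) ⟨
  re (s ⊠ s †)                                        ≈⟨ re-≃ (Σᶜ.*-distribʳ-sum (s †) z) ⟩
  re (Σᶜ.sum (λ i → z i ⊠ s †))                       ≈⟨ re-Σᶜ (λ i → z i ⊠ s †) ⟩
  Σʳ.sum (λ i → re (z i ⊠ s †))                       ≈⟨ Σʳ.sum-cong-≋ (λ i → R.trans (re-≃ (C.*-congˡ (†-Σᶜ z)))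
                                                           (re-⊠-Σᶜ (z i) (λ j → z j †))) ⟩
  Σʳ.sum (λ i → Σʳ.sum (λ j → re (z i ⊠ z j †)))      ∎
  where
  open ≃-Reasoning
  s = Σᶜ.sum z

⊕-cancelˡ-≼ : ∀ x {y z} → x ⊕ y ≼ x ⊕ z → y ≼ z
⊕-cancelˡ-≼ x {y} {z} p = begin
  y                    ≈⟨ cancel y ⟨
  ⊖ x ⊕ (x ⊕ y)        ≲⟨ +-mono-≼ ≼-refl p ⟩
  ⊖ x ⊕ (x ⊕ z)        ≈⟨ cancel z ⟩
  z                    ∎
  where
  open ≼-Reasoning
  cancel : ∀ w → ⊖ x ⊕ (x ⊕ w) ≃ w
  cancel w = R.trans (R.sym (R.+-assoc _ _ _)) (R.trans (R.+-congʳ (R.-‿inverseˡ x)) (R.+-identityˡ w))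

iterate-conj : ∀ {z w} n → z ≡ w → iterate conj z n ≡ iterate _† w n
iterate-conj zero    z≡w = z≡w
iterate-conj {z} (suc n) z≡w = iterate-conj n (≡.trans (conj-† z) (cong _† z≡w))

-- Correlations of the forms in the spectrum

module Spectrum {a b} (p : ℕ) .{{_ : ℕ.NonZero p}} (ω : ℂ)
                (ω^p≃1 : ω ^ᶜ′ p ≃ᶜ real (ι 1ℚ)) (‖ω‖²≃1 : ‖ ω ‖² ≃ ι 1ℚ)
                {k : ℕ} (G : Fin k → Module (𝔽 p) a b) (fd : ∀ i → FiniteDimensional (G i)) where

  open Character p ω ω^p≃1 ‖ω‖²≃1
  private module M {i} = Module (G i)

  _⊝_ : ∀ {i} → M.Carrierᴹ {i} → M.Carrierᴹ {i} → M.Carrierᴹ {i}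
  _⊝_ {i} u v = u M.+ᴹ M.-ᴹ v

  _⊖ᴳ_ : Tuple G → Tuple G → Tuple G
  (y ⊖ᴳ x) i = y i ⊝ x i

  points : List (Tuple G)
  points = tuples (λ i → elements (G i) (fd i))

  𝔼ʳ-translate : ∀ h → Respects (_≋_ G) h → ∀ x → 𝔼ʳ points (λ y → h (y ⊖ᴳ x)) ≃ 𝔼ʳ points h
  𝔼ʳ-translate h h-cong x = R.trans
    (𝔼ʳ-cong points λ y → h-cong _ _ λ i → M.+ᴹ-comm (y i) (M.-ᴹ x i))
    (R.*-congˡ (invariant-tuples (λ i → elements (G i) (fd i)) (λ i u → M.-ᴹ x i M.+ᴹ u)
      (λ i u → M.≈ᴹ-refl) (λ i → invariant-elements (G i) (fd i) (M.-ᴹ x i)) h h-cong))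

  𝔼² : (Tuple G → Tuple G → ℝ) → ℝ
  𝔼² h = 𝔼ʳ points (λ x → 𝔼ʳ points (h x))

  𝔼²-cong : ∀ {g h} → (∀ x y → g x y ≃ h x y) → 𝔼² g ≃ 𝔼² h
  𝔼²-cong g≃h = 𝔼ʳ-cong points (λ x → 𝔼ʳ-cong points (g≃h x))

  𝔼²-mono : ∀ {g h} → (∀ x y → g x y ≼ h x y) → 𝔼² g ≼ 𝔼² h
  𝔼²-mono g≼h = 𝔼ʳ-mono points (λ x → 𝔼ʳ-mono points (g≼h x))

  𝔼²-⊕ : ∀ g h → 𝔼² (λ x y → g x y ⊕ h x y) ≃ 𝔼² g ⊕ 𝔼² h
  𝔼²-⊕ g h = R.trans (𝔼ʳ-cong points (λ x → 𝔼ʳ-⊕ points (g x) (h x))) (𝔼ʳ-⊕ points _ _)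

  𝔼²-⊗ : ∀ c h → 𝔼² (λ x y → c ⊗ h x y) ≃ c ⊗ 𝔼² h
  𝔼²-⊗ c h = R.trans (𝔼ʳ-cong points (λ x → 𝔼ʳ-⊗ points c (h x))) (𝔼ʳ-⊗ points c _)

  𝔼²-Σ : ∀ {n} (h : Fin n → Tuple G → Tuple G → ℝ) →
         𝔼² (λ x y → Σʳ.sum (λ i → h i x y)) ≃ Σʳ.sum (λ i → 𝔼² (h i))
  𝔼²-Σ h = R.trans (𝔼ʳ-cong points (λ x → 𝔼ʳ-Σ points (λ i → h i x))) (𝔼ʳ-Σ points (λ i x → 𝔼ʳ points (h i x)))

  𝔼²-const-≼ : ∀ {c} → ι 0ℚ ≼ c → 𝔼² (λ _ _ → c) ≼ c
  𝔼²-const-≼ 0≼c = ≼-trans (𝔼ʳ-mono points (λ _ → 𝔼ʳ-const-≼ points 0≼c)) (𝔼ʳ-const-≼ points 0≼c)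

  phase : MultilinearForm G → Tuple G → ℂ
  phase μ x = χ (⟦ μ ⟧ x)

  phase-cong : ∀ μ {x y} → _≋_ G x y → phase μ x ≃ᶜ phase μ y
  phase-cong μ {x} {y} x≋y = χ-cong (⟦ μ ⟧ x) (⟦ μ ⟧ y) (⟦⟧-cong μ x≋y)

  phase-⊝ : ∀ μ i x u v → phase μ (x [ i ≔ u ⊝ v ]) ≃ᶜ phase μ (x [ i ≔ u ]) ⊠ phase μ (x [ i ≔ v ]) †
  phase-⊝ μ i x u v = C.trans (χ-cong (φ (u ⊝ v)) (φ u ℤ.- φ v) linear-⊝) (χ-sub (φ u) (φ v))
    where
    φ : M.Carrierᴹ {i} → ℤ
    φ w = ⟦ μ ⟧ (x [ i ≔ w ])
    open Morphisms.IsModuleHomomorphism (linear μ i x) using (+ᴹ-homo; -ᴹ-homo)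
    open F-Reasoning
    linear-⊝ : φ (u ⊝ v) F.≈ φ u ℤ.- φ v
    linear-⊝ = begin
      φ (u ⊝ v)              ≈⟨ +ᴹ-homo u (M.-ᴹ v) ⟩
      φ u ℤ.+ φ (M.-ᴹ v)     ≈⟨ F.+-cong {φ u} {φ u} {φ (M.-ᴹ v)} {ℤ.- φ v} (F.refl {φ u}) (-ᴹ-homo v) ⟩
      φ u ℤ.- φ v            ∎

  boxProduct-phase : ∀ μ x y → boxProduct (phase μ) x y ≃ᶜ phase μ (y ⊖ᴳ x)
  boxProduct-phase μ = boxProduct-multiplicative _⊝_ (phase μ)
    (λ x y x≡y → phase-cong μ (λ i → M.≈ᴹ-reflexive (x≡y i))) (phase-⊝ μ)

  *ᶜ-ω^ : ∀ (f : Tuple G → ℂ) μ x → f x *ᶜ Box.ω^_ p ω G fd ⟦ μ ⟧ x ≡ f x ⊠ phase μ x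
  *ᶜ-ω^ f μ x = ≡.trans (*ᶜ-⊠ (f x) (Box.ω^_ p ω G fd ⟦ μ ⟧ x)) (cong (f x ⊠_) (^ᶜ-^ ω (⟦ μ ⟧ x %ℕ p)))

  re-boxAverage-boxProduct : ∀ (g h : Tuple G → ℂ) → (∀ x → g x ≡ h x) →
                             re (Box.boxAverage p ω G fd g) ≃ 𝔼² (λ x y → re (boxProduct h x y))
  re-boxAverage-boxProduct g h g≡h = R.trans (re-𝔼 (Box.points p ω G fd) _) (𝔼ʳ-cong points λ x →
    R.trans (re-𝔼 (Box.points p ω G fd) _) (𝔼ʳ-cong points λ y → R.reflexive (cong re (foldr≡ x y))))
    where
    foldr≡ : ∀ x y → foldr _*ᶜ_ (fromℝ 1ʳ) (map (λ I → iterate conj (g (Box.mix p ω G fd I x y)) ∣ I ∣) (subsets k))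
                     ≡ boxProduct h x y
    foldr≡ x y = foldr-cong-≡ _*ᶜ_ _⊠_ (fromℝ 1ʳ) (real (ι 1ℚ)) *ᶜ-⊠ fromℝ1-real
      {λ I → iterate conj (g (Box.mix p ω G fd I x y)) ∣ I ∣} {λ I → iterate _† (h (mixture I x y)) ∣ I ∣}
      (λ I → iterate-conj {g (Box.mix p ω G fd I x y)} ∣ I ∣ (g≡h (mixture I x y))) (subsets k)

  re-boxAverage : ∀ f μ g → (∀ x → g x ≡ f x ⊠ phase μ x) →
                  re (Box.boxAverage p ω G fd g) ≃ 𝔼² (λ x y → re (boxProduct f x y ⊠ phase μ (y ⊖ᴳ x)))
  re-boxAverage f μ g g≡ = R.trans (re-boxAverage-boxProduct g (λ x → f x ⊠ phase μ x) g≡)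
    (𝔼²-cong λ x y → re-≃ (C.trans (boxProduct-⊠ f (phase μ) x y) (C.*-congˡ (boxProduct-phase μ x y))))

  -- The real part of the bias of μ - μ′, as `re-bias` shows.
  correlation : MultilinearForm G → MultilinearForm G → ℝ
  correlation μ μ′ = 𝔼ʳ points (λ x → re (χ (⟦ μ ⟧ x ℤ.- ⟦ μ′ ⟧ x)))

  re-bias : ∀ β → re (Box.bias p ω G fd β) ≃ 𝔼ʳ points (λ x → re (χ (β x)))
  re-bias β = R.trans (re-𝔼 (Box.points p ω G fd) (Box.ω^_ p ω G fd β))
    (𝔼ʳ-cong points λ x → R.reflexive (cong re (^ᶜ-^ ω (β x %ℕ p))))

  -- The summand depends on y - x only. For fixed x the translation z = y - x leaves the inner
  -- average unchanged, and the outer one is then of a constant.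
  𝔼²-correlation : ∀ μ μ′ → 𝔼² (λ x y → re (phase μ (y ⊖ᴳ x) ⊠ phase μ′ (y ⊖ᴳ x) †)) ≃ correlation μ μ′
  𝔼²-correlation μ μ′ = begin
    𝔼² (λ x y → re (phase μ (y ⊖ᴳ x) ⊠ phase μ′ (y ⊖ᴳ x) †))
      ≈⟨ 𝔼²-cong (λ x y → re-≃ (χ-sub (⟦ μ ⟧ (y ⊖ᴳ x)) (⟦ μ′ ⟧ (y ⊖ᴳ x)))) ⟨
    𝔼² (λ x y → h (y ⊖ᴳ x))
      ≈⟨ 𝔼ʳ-cong points (𝔼ʳ-translate h h-cong) ⟩
    𝔼ʳ points (λ _ → 𝔼ʳ points h)
      ≈⟨ 𝔼ʳ-idem points h ⟩
    correlation μ μ′ ∎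
    where
    open ≃-Reasoning
    h : Tuple G → ℝ
    h z = re (χ (⟦ μ ⟧ z ℤ.- ⟦ μ′ ⟧ z))
    h-cong : Respects (_≋_ G) h
    h-cong x y x≋y = re-≃ (C.trans (χ-sub (⟦ μ ⟧ x) (⟦ μ′ ⟧ x)) (C.trans
      (C.*-cong (phase-cong μ x≋y) (†-cong (phase-cong μ′ x≋y))) (C.sym (χ-sub (⟦ μ ⟧ y) (⟦ μ′ ⟧ y)))))

  correlation-self : ∀ μ → correlation μ μ ≼ ι 1ℚ
  correlation-self μ = begin
    𝔼ʳ points (λ x → re (χ (⟦ μ ⟧ x ℤ.- ⟦ μ ⟧ x)))         ≈⟨ 𝔼ʳ-cong points (λ x → R.trans (R.reflexive (cong (re ∘ χ) (ℤₚ.+-inverseʳ (⟦ μ ⟧ x))))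
                                                                (R.trans (re-≃ χ-0) (re-real (ι 1ℚ)))) ⟩
    𝔼ʳ points (λ _ → ι 1ℚ)                                 ≲⟨ 𝔼ʳ-const-≼ points 0≼1 ⟩
    ι 1ℚ                                                   ∎
    where open ≼-Reasoning

  -- Cauchy–Schwarz in the form 2t Re(FA) ≤ t² + |A|², where A is the sum of
  -- the phases, F the box product of f and t the sum of the lower bounds.
  correlations-large : ∀ f → (∀ x → ‖ f x ‖² ≼ ι 1ℚ) → ∀ {n} (μ : Fin n → MultilinearForm G)
    (g : Fin n → Tuple G → ℂ) → (∀ i x → g i x ≡ f x ⊠ phase (μ i) x) → ∀ q → ι 0ℚ ≼ q →
    (∀ i → q ≼ re (Box.boxAverage p ω G fd (g i))) →
    (ν n ⊗ q) ⊗ (ν n ⊗ q) ≼ Σʳ.sum (λ i → Σʳ.sum (λ j → correlation (μ i) (μ j)))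
  correlations-large f f≼1 {n} μ g g≡ q 0≼q q≼ = ⊕-cancelˡ-≼ (t ⊗ t) (begin
    t ⊗ t ⊕ t ⊗ t                                      ≲⟨ +-mono-≼ (⊗-monoˡ-≼ 0≼t t≼) (⊗-monoˡ-≼ 0≼t t≼) ⟩
    t ⊗ 𝔼² FA ⊕ t ⊗ 𝔼² FA                              ≈⟨ R.+-cong (𝔼²-⊗ t FA) (𝔼²-⊗ t FA) ⟨
    𝔼² (λ x y → t ⊗ FA x y) ⊕ 𝔼² (λ x y → t ⊗ FA x y)  ≈⟨ 𝔼²-⊕ (λ x y → t ⊗ FA x y) (λ x y → t ⊗ FA x y) ⟨
    𝔼² (λ x y → t ⊗ FA x y ⊕ t ⊗ FA x y)               ≲⟨ 𝔼²-mono (λ x y → 2t·re≼ t (F x y) (A′ x y) (‖boxProduct‖²≼1 f f≼1 x y)) ⟩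
    𝔼² (λ x y → t ⊗ t ⊕ ‖ A′ x y ‖²)                   ≈⟨ 𝔼²-⊕ (λ _ _ → t ⊗ t) (λ x y → ‖ A′ x y ‖²) ⟩
    𝔼² (λ _ _ → t ⊗ t) ⊕ 𝔼² (λ x y → ‖ A′ x y ‖²)      ≲⟨ +-mono-≼ (𝔼²-const-≼ (square-nonNeg t)) (≼-reflexive norm) ⟩
    t ⊗ t ⊕ Σʳ.sum (λ i → Σʳ.sum (λ j → correlation (μ i) (μ j))) ∎)
    where
    open ≼-Reasoning
    -- Using the lower bound for the average of `FA` also as the parameter of the quadratic
    -- inequality gives 2t² ≤ t² + ∑ᵢⱼ, from which one t² cancels.
    t = ν n ⊗ q
    F : Tuple G → Tuple G → ℂ
    F = boxProduct f
    A′ : Tuple G → Tuple G → ℂ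
    A′ x y = Σᶜ.sum (λ i → phase (μ i) (y ⊖ᴳ x))
    FA : Tuple G → Tuple G → ℝ
    FA x y = re (F x y ⊠ A′ x y)
    0≼t : ι 0ℚ ≼ t
    0≼t = *-nonNeg (ν-nonNeg n) 0≼q
    t≼ : t ≼ 𝔼² FA
    t≼ = begin
      ν n ⊗ q                                                            ≈⟨ Σʳ-const n q ⟨
      Σʳ.sum {n} (λ _ → q)                                               ≲⟨ Σʳ-mono (λ i → ≼-trans (q≼ i) (≼-reflexive (re-boxAverage f (μ i) (g i) (g≡ i)))) ⟩
      Σʳ.sum (λ i → 𝔼² (λ x y → re (F x y ⊠ phase (μ i) (y ⊖ᴳ x))))      ≈⟨ 𝔼²-Σ (λ i x y → re (F x y ⊠ phase (μ i) (y ⊖ᴳ x))) ⟨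
      𝔼² (λ x y → Σʳ.sum (λ i → re (F x y ⊠ phase (μ i) (y ⊖ᴳ x))))      ≈⟨ 𝔼²-cong (λ x y → re-⊠-Σᶜ (F x y) (λ i → phase (μ i) (y ⊖ᴳ x))) ⟨
      𝔼² FA                                                              ∎
    norm : 𝔼² (λ x y → ‖ A′ x y ‖²) ≃ Σʳ.sum (λ i → Σʳ.sum (λ j → correlation (μ i) (μ j)))
    norm = R.trans (𝔼²-cong (λ x y → ‖Σᶜ‖² (λ i → phase (μ i) (y ⊖ᴳ x))))
      (R.trans (𝔼²-Σ (λ i x y → Σʳ.sum (λ j → re (phase (μ i) (y ⊖ᴳ x) ⊠ phase (μ j) (y ⊖ᴳ x) †))))
        (Σʳ.sum-cong-≋ λ i → R.trans (𝔼²-Σ (λ j x y → re (phase (μ i) (y ⊖ᴳ x) ⊠ phase (μ j) (y ⊖ᴳ x) †)))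
          (Σʳ.sum-cong-≋ λ j → 𝔼²-correlation (μ i) (μ j))))

  correlations-small : ∀ {m} (μ : Fin (suc m) → MultilinearForm G) {c} →
    (∀ i j → i ≢ j → correlation (μ i) (μ j) ≼ c) →
    Σʳ.sum (λ i → Σʳ.sum (λ j → correlation (μ i) (μ j))) ≼ ν (suc m) ⊗ (ι 1ℚ ⊕ ν m ⊗ c)
  correlations-small {m} μ {c} small = begin
    Σʳ.sum (λ i → Σʳ.sum (λ j → correlation (μ i) (μ j)))     ≲⟨ Σʳ-mono row ⟩
    Σʳ.sum {suc m} (λ _ → ι 1ℚ ⊕ ν m ⊗ c)                     ≈⟨ Σʳ-const (suc m) _ ⟩
    ν (suc m) ⊗ (ι 1ℚ ⊕ ν m ⊗ c)                              ∎
    where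
    open ≼-Reasoning
    row : ∀ i → Σʳ.sum (λ j → correlation (μ i) (μ j)) ≼ ι 1ℚ ⊕ ν m ⊗ c
    row i = begin
      Σʳ.sum (λ j → correlation (μ i) (μ j))
        ≈⟨ Σʳ.sum-remove {i = i} (λ j → correlation (μ i) (μ j)) ⟩
      correlation (μ i) (μ i) ⊕ Σʳ.sum (λ j → correlation (μ i) (μ (punchIn i j)))
        ≲⟨ +-mono-≼ (correlation-self (μ i)) (Σʳ-mono λ j → small i (punchIn i j) (λ eq → punchInᵢ≢i i j (≡.sym eq))) ⟩
      ι 1ℚ ⊕ Σʳ.sum {m} (λ _ → c)
        ≈⟨ R.+-congˡ (Σʳ-const m c) ⟩
      ι 1ℚ ⊕ ν m ⊗ c ∎

-- Counting the forms

/1-mono : ∀ {i j} → i ℤ.≤ j → i ℚ./ 1 ℚ.≤ j ℚ./ 1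
/1-mono {i} {j} i≤j = ℚₚ.toℚᵘ-cancel-≤ (begin
  ℚ.toℚᵘ (i ℚ./ 1)   ≃⟨ ℚₚ.toℚᵘ-fromℚᵘ (ℚᵘ.mkℚᵘ i 0) ⟩
  ℚᵘ.mkℚᵘ i 0        ≤⟨ ℚᵘ.*≤* (ℤₚ.*-monoʳ-≤-nonNeg 1ℤ i≤j) ⟩
  ℚᵘ.mkℚᵘ j 0        ≃⟨ ℚₚ.toℚᵘ-fromℚᵘ (ℚᵘ.mkℚᵘ j 0) ⟨
  ℚ.toℚᵘ (j ℚ./ 1)   ∎)
  where open ℚᵘₚ.≤-Reasoning

^-≼-self : ∀ {x} n .{{_ : ℕ.NonZero n}} → ι 0ℚ ≼ x → x ≼ ι 1ℚ → x ^ᴿ n ≼ x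
^-≼-self zero          0≼x x≼1 = contradiction ≡.refl (ℕ.≢-nonZero⁻¹ 0)
^-≼-self {x} (suc n)   0≼x x≼1 = begin
  x ⊗ x ^ᴿ n      ≲⟨ ⊗-monoˡ-≼ 0≼x (^-mono n 0≼x x≼1) ⟩
  x ⊗ ι 1ℚ ^ᴿ n   ≈⟨ R.*-congˡ (1^n≃1 n) ⟩
  x ⊗ ι 1ℚ       ≈⟨ R.*-identityʳ x ⟩
  x              ∎
  where open ≼-Reasoning

-- The exponent 2^{2k+2} is the square of M = 2^{k+1}, and (ε/1000)^M ≤ ε^M/2.
threshold : ∀ ε M .{{_ : ℕ.NonZero M}} → ι 0ℚ ≼ ε → ε ^ᴿ M ≼ ι 1ℚ →
            (ε ⊗ ι (1ℤ ℚ./ 1000)) ^ᴿ (M ℕ.* M) ≼ ι ½ ⊗ ε ^ᴿ M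
threshold ε M 0≼ε e≼1 = begin
  (ε ⊗ c) ^ᴿ (M ℕ.* M)     ≈⟨ ℝ^.^-assocʳ (ε ⊗ c) M M ⟨
  -- The outer power can only decrease its base, which lies between 0 and 1 because it is at most
  -- e/2 and e ≤ 1.
  ((ε ⊗ c) ^ᴿ M) ^ᴿ M       ≲⟨ ^-≼-self M (^-nonNeg M (*-nonNeg 0≼ε 0≼c)) (≼-trans y≼e/2 e/2≼1) ⟩
  (ε ⊗ c) ^ᴿ M             ≲⟨ y≼e/2 ⟩
  ι ½ ⊗ ε ^ᴿ M             ∎
  where
  open ≼-Reasoning
  c = ι (1ℤ ℚ./ 1000)
  0≼c : ι 0ℚ ≼ c
  0≼c = ι-mono (from-yes (0ℚ ℚₚ.≤? (1ℤ ℚ./ 1000)))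
  0≼e = ^-nonNeg M 0≼ε
  y≼e/2 : (ε ⊗ c) ^ᴿ M ≼ ι ½ ⊗ ε ^ᴿ M
  y≼e/2 = begin
    (ε ⊗ c) ^ᴿ M       ≈⟨ ℝ^ᶜ.^-distrib-* ε c M ⟩
    -- Since M ≥ 1, the power of 1/1000 is at most 1/1000 and so at most ½.
    ε ^ᴿ M ⊗ c ^ᴿ M     ≲⟨ ⊗-monoˡ-≼ 0≼e (^-≼-self M 0≼c (ι-mono (from-yes ((1ℤ ℚ./ 1000) ℚₚ.≤? 1ℚ)))) ⟩
    ε ^ᴿ M ⊗ c         ≲⟨ ⊗-monoˡ-≼ 0≼e (ι-mono (from-yes ((1ℤ ℚ./ 1000) ℚₚ.≤? ½))) ⟩
    ε ^ᴿ M ⊗ ι ½       ≈⟨ R.*-comm _ _ ⟩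
    ι ½ ⊗ ε ^ᴿ M       ∎
  e/2≼1 : ι ½ ⊗ ε ^ᴿ M ≼ ι 1ℚ
  e/2≼1 = begin
    ι ½ ⊗ ε ^ᴿ M       ≲⟨ ⊗-monoˡ-≼ (ι-mono (from-yes (0ℚ ℚₚ.≤? ½))) e≼1 ⟩
    ι ½ ⊗ ι 1ℚ        ≈⟨ R.*-identityʳ _ ⟩
    ι ½               ≲⟨ ι-mono (from-yes (½ ℚₚ.≤? 1ℚ)) ⟩
    ι 1ℚ              ∎

ν-cancelˡ : ∀ m {x y} → ν (suc m) ⊗ x ≼ ν (suc m) ⊗ y → x ≼ y
ν-cancelˡ m {x} {y} νx≼νy = begin
  x                                           ≈⟨ cancel x ⟨
  ι (1ℤ ℚ./ suc m) ⊗ (ν (suc m) ⊗ x)          ≲⟨ ⊗-monoˡ-≼ (0≼1/suc m) νx≼νy ⟩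
  ι (1ℤ ℚ./ suc m) ⊗ (ν (suc m) ⊗ y)          ≈⟨ cancel y ⟩
  y                                           ∎
  where
  open ≼-Reasoning
  cancel : ∀ x → ι (1ℤ ℚ./ suc m) ⊗ (ν (suc m) ⊗ x) ≃ x
  cancel x = R.trans (R.sym (R.*-assoc _ _ _)) (R.trans (R.*-congʳ (R.trans (R.sym (ι-* (1ℤ ℚ./ suc m) (+ suc m ℚ./ 1)))
    (R.reflexive (cong ι (1/n*n m))))) (R.*-identityˡ x))

-- With n = m + 1, cancelling one factor n leaves ne ≤ 1 + (n - 1)b ≤ 1 + ne/2. Half of ne is
-- absorbed on the left, so ne/2 ≤ 1.
count-bound : ∀ m {e b} → ι 0ℚ ≼ e → b ≼ ι ½ ⊗ e →
              ν (suc m) ⊗ (ν (suc m) ⊗ e) ≼ ν (suc m) ⊗ (ι 1ℚ ⊕ ν m ⊗ b) → ν (suc m) ⊗ e ≼ ι (+ 2 ℚ./ 1)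
count-bound m {e} {b} 0≼e b≼e/2 νX≼ = begin
  X                          ≈⟨ halves X ⟨
  ι ½ ⊗ X ⊕ ι ½ ⊗ X          ≲⟨ +-mono-≼ X/2≼1 X/2≼1 ⟩
  ι 1ℚ ⊕ ι 1ℚ                ≈⟨ ι-+ 1ℚ 1ℚ ⟨
  ι (+ 2 ℚ./ 1)              ∎
  where
  open ≼-Reasoning
  X = ν (suc m) ⊗ e
  halves : ∀ x → ι ½ ⊗ x ⊕ ι ½ ⊗ x ≃ x
  halves x = R.trans (R.sym (R.distribʳ x (ι ½) (ι ½))) (R.trans (R.*-congʳ (R.sym (ι-+ ½ ½))) (R.*-identityˡ x))
  νm≼νsm : ν m ≼ ν (suc m)
  νm≼νsm = ι-mono (/1-mono (ℤ.+≤+ (ℕₚ.n≤1+n m)))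
  νb≼ : ν m ⊗ b ≼ ι ½ ⊗ X
  νb≼ = begin
    ν m ⊗ b                    ≲⟨ ⊗-monoˡ-≼ (ν-nonNeg m) b≼e/2 ⟩
    ν m ⊗ (ι ½ ⊗ e)            ≲⟨ ⊗-monoʳ-≼ (*-nonNeg (ι-mono (from-yes (0ℚ ℚₚ.≤? ½))) 0≼e) νm≼νsm ⟩
    ν (suc m) ⊗ (ι ½ ⊗ e)      ≈⟨ R.*-assoc _ _ _ ⟨
    ν (suc m) ⊗ ι ½ ⊗ e        ≈⟨ R.*-congʳ (R.*-comm _ _) ⟩
    ι ½ ⊗ ν (suc m) ⊗ e        ≈⟨ R.*-assoc _ _ _ ⟩
    ι ½ ⊗ X                    ∎
  X/2≼1 : ι ½ ⊗ X ≼ ι 1ℚ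
  X/2≼1 = ⊕-cancelˡ-≼ (ι ½ ⊗ X) (begin
    ι ½ ⊗ X ⊕ ι ½ ⊗ X          ≈⟨ halves X ⟩
    X                          ≲⟨ ν-cancelˡ m νX≼ ⟩
    ι 1ℚ ⊕ ν m ⊗ b             ≲⟨ +-mono-≼ ≼-refl νb≼ ⟩
    ι 1ℚ ⊕ ι ½ ⊗ X             ≈⟨ R.+-comm _ _ ⟩
    ι ½ ⊗ X ⊕ ι 1ℚ             ∎)

-- Multiplying by εᴹ clears the inverse: 10 = 10 ε⁻ᴹ εᴹ ≤ N εᴹ. In this form it can be set against
-- an upper bound for n εᴹ.
ceiling-bound : ∀ ε (0<ε : 0ʳ <ʳ ε) M N → fromℤ (+ 10) *ʳ inv ε 0<ε ^ʳ M ≤ʳ fromℤ N →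
                ι 0ℚ ≼ ε → ι (+ 10 ℚ./ 1) ≼ ι (N ℚ./ 1) ⊗ ε ^ᴿ M
ceiling-bound ε 0<ε M N 10ε⁻ᴹ≤N 0≼ε = begin
  ι (+ 10 ℚ./ 1)                                   ≈⟨ R.*-identityʳ _ ⟨
  ι (+ 10 ℚ./ 1) ⊗ ι 1ℚ                            ≈⟨ R.*-congˡ (1^n≃1 M) ⟨
  ι (+ 10 ℚ./ 1) ⊗ ι 1ℚ ^ᴿ M                        ≈⟨ R.*-congˡ (ℝ^.^-congˡ M (R.trans (R.*-comm _ _) (recip-inverseʳ ε 0<ε))) ⟨
  ι (+ 10 ℚ./ 1) ⊗ (recip ε 0<ε ⊗ ε) ^ᴿ M           ≈⟨ R.*-congˡ (ℝ^ᶜ.^-distrib-* (recip ε 0<ε) ε M) ⟩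
  ι (+ 10 ℚ./ 1) ⊗ (recip ε 0<ε ^ᴿ M ⊗ ε ^ᴿ M)       ≈⟨ R.*-assoc _ _ _ ⟨
  ι (+ 10 ℚ./ 1) ⊗ recip ε 0<ε ^ᴿ M ⊗ ε ^ᴿ M         ≲⟨ ⊗-monoʳ-≼ (^-nonNeg M 0≼ε) bound ⟩
  ι (N ℚ./ 1) ⊗ ε ^ᴿ M                              ∎
  where
  open ≼-Reasoning
  to-≼ : ∀ x y x′ y′ → x ≡ x′ → y ≡ y′ → x *ʳ y ≤ʳ fromℤ N → x′ ⊗ y′ ≼ ι (N ℚ./ 1)
  to-≼ x y .x .y ≡.refl ≡.refl le = ≡.subst₂ _≼_ (*ʳ-⊗ x y) (fromℤ-ι N) (mk≼ le)
  bound : ι (+ 10 ℚ./ 1) ⊗ recip ε 0<ε ^ᴿ M ≼ ι (N ℚ./ 1)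
  bound = to-≼ (fromℤ (+ 10)) (inv ε 0<ε ^ʳ M) (ι (+ 10 ℚ./ 1)) (recip ε 0<ε ^ᴿ M) (fromℤ-ι (+ 10))
    (≡.trans (^ʳ-^ (inv ε 0<ε) M) (cong (_^ᴿ M) (inv-recip ε 0<ε))) 10ε⁻ᴹ≤N

module _ {a b} (p : ℕ) .{{p≢0 : ℕ.NonZero p}} (ω : ℂ) (exp : IsExp2πi/ p ω)
         {k : ℕ} (G : Fin k → Module (𝔽 p) a b) (fd : ∀ i → FiniteDimensional (G i)) where

  private
    ω^p≃1 : ω ^ᶜ′ p ≃ᶜ real (ι 1ℚ)
    ω^p≃1 = root-of-unity p {{p≢0}} ω exp
    module S = Spectrum p {{p≢0}} ω ω^p≃1 (‖root-of-unity‖² p {{p≢0}} ω^p≃1) G fd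

  -- Raising ε ≤ r to the power 2^k reaches the box average directly, since the norm is given by
  -- that power.
  box-bound : ∀ g r ε → ι 0ℚ ≼ ε → Box.IsBoxNorm p {{p≢0}} ω G fd g r → ε ≤ʳ r →
              ε ^ᴿ (2 ^ k) ≼ re (Box.boxAverage p {{p≢0}} ω G fd g)
  box-bound g r ε 0≼ε (_ , r^≈ , _) ε≤r = begin
    ε ^ᴿ (2 ^ k)                          ≲⟨ ^-mono (2 ^ k) 0≼ε (mk≼ ε≤r) ⟩
    r ^ᴿ (2 ^ k)                          ≡⟨ ^ʳ-^ r (2 ^ k) ⟨
    r ^ʳ (2 ^ k)                           ≈⟨ mk≃ r^≈ ⟩
    re (Box.boxAverage p {{p≢0}} ω G fd g)         ∎
    where open ≼-Reasoning

  spectrum-bound : ∀ ε → ι 0ℚ ≼ ε → ∀ f → (∀ x → ‖ f x ‖² ≼ ι 1ℚ) →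
    ∀ m (μ : Fin (suc m) → MultilinearForm G) → (∀ i → Box.Specᵐˡ p {{p≢0}} ω G fd ε f (μ i)) →
    ∀ c → (∀ i j → i ≢ j → re (Box.bias p {{p≢0}} ω G fd (λ x → ⟦ μ i ⟧ x ℤ.- ⟦ μ j ⟧ x)) ≼ c) →
    ν (suc m) ⊗ (ν (suc m) ⊗ ε ^ᴿ (2 ^ (k + 1))) ≼ ν (suc m) ⊗ (ι 1ℚ ⊕ ν m ⊗ c)
  spectrum-bound ε 0≼ε f f≼1 m μ spec c small = begin
    ν (suc m) ⊗ (ν (suc m) ⊗ ε ^ᴿ (2 ^ (k + 1)))      ≈⟨ square ⟩
    (ν (suc m) ⊗ q) ⊗ (ν (suc m) ⊗ q)
      ≲⟨ S.correlations-large f f≼1 μ (λ i x → f x *ᶜ Box.ω^_ p {{p≢0}} ω G fd ⟦ μ i ⟧ x)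
           (λ i → S.*ᶜ-ω^ f (μ i)) q (^-nonNeg (2 ^ k) 0≼ε)
           (λ i → box-bound (λ x → f x *ᶜ Box.ω^_ p {{p≢0}} ω G fd ⟦ μ i ⟧ x) (proj₁ (spec i)) ε 0≼ε
             (proj₁ (proj₂ (spec i))) (proj₂ (proj₂ (spec i)))) ⟩
    Σʳ.sum (λ i → Σʳ.sum (λ j → S.correlation (μ i) (μ j)))
      ≲⟨ S.correlations-small μ (λ i j i≢j →
           ≼-trans (≼-reflexive (R.sym (S.re-bias (λ x → ⟦ μ i ⟧ x ℤ.- ⟦ μ j ⟧ x)))) (small i j i≢j)) ⟩
    ν (suc m) ⊗ (ι 1ℚ ⊕ ν m ⊗ c)                       ∎
    where
    open ≼-Reasoning
    q = ε ^ᴿ (2 ^ k)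
    n = ν (suc m)
    2^k+1 : 2 ^ (k + 1) ≡ 2 ^ k + 2 ^ k
    2^k+1 = ≡.trans (cong (2 ^_) (ℕₚ.+-comm k 1)) (cong (λ l → 2 ^ k + l) (ℕₚ.+-identityʳ (2 ^ k)))
    -- The exponent 2^{k+1} is twice 2^k: squaring nq in Cauchy-Schwarz turns ε^{2^k} into e.
    square : n ⊗ (n ⊗ ε ^ᴿ (2 ^ (k + 1))) ≃ (n ⊗ q) ⊗ (n ⊗ q)
    square = R.trans (R.reflexive (cong (λ l → n ⊗ (n ⊗ ε ^ᴿ l)) 2^k+1))
      (R.trans (R.*-congˡ (R.*-congˡ (ℝ^.^-homo-* ε (2 ^ k) (2 ^ k))))
      (R.trans (R.*-congˡ (R.trans (R.sym (R.*-assoc n q q)) (R.*-comm (n ⊗ q) q)))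
      (R.sym (R.*-assoc n q (n ⊗ q)))))

  unit-disc : ∀ z → InUnitDisc z → ‖ z ‖² ≼ ι 1ℚ
  unit-disc z z∈D = ≡.subst₂ _≼_ (∣∣²-‖‖² z) (fromℚ-ι 1ℚ) (mk≼ z∈D)

  count≼2 : ∀ ε → ι 0ℚ ≼ ε → ∀ f → (∀ x → ‖ f x ‖² ≼ ι 1ℚ) →
    ∀ n (μ : Fin n → MultilinearForm G) → (∀ i → Box.Specᵐˡ p {{p≢0}} ω G fd ε f (μ i)) →
    (∀ i j → i ≢ j → re (Box.bias p {{p≢0}} ω G fd (λ x → ⟦ μ i ⟧ x ℤ.- ⟦ μ j ⟧ x))
                     ≼ (ε ⊗ ι (1ℤ ℚ./ 1000)) ^ᴿ (2 ^ (2 * k + 2))) →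
    ν n ⊗ ε ^ᴿ (2 ^ (k + 1)) ≼ ι (+ 2 ℚ./ 1)
  -- Without any form nothing forces ε ≤ 1, but then the left side is 0.
  count≼2 ε 0≼ε f f≼1 zero    μ spec small =
    ≼-trans (≼-reflexive (R.zeroˡ _)) (ι-mono (from-yes (0ℚ ℚₚ.≤? (+ 2 ℚ./ 1))))
  count≼2 ε 0≼ε f f≼1 (suc m) μ spec small = count-bound m (^-nonNeg M 0≼ε)
    (subst (λ l → (ε ⊗ ι (1ℤ ℚ./ 1000)) ^ᴿ l ≼ ι ½ ⊗ ε ^ᴿ M) (≡.sym exponent)
      (threshold ε M {{ℕₚ.m^n≢0 2 (k + 1)}} 0≼ε e≼1))
    (spectrum-bound ε 0≼ε f f≼1 m μ spec _ small)
    where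
    M = 2 ^ (k + 1)
    exponent : 2 ^ (2 * k + 2) ≡ M ℕ.* M
    exponent = ≡.trans (cong (2 ^_) 2k+2) (ℕₚ.^-distribˡ-+-* 2 (k + 1) (k + 1))
      where
      2k+2 : 2 * k + 2 ≡ (k + 1) + (k + 1)
      2k+2 = ≡.trans (≡.sym (ℕₚ.*-distribˡ-+ 2 k 1)) (cong (λ l → k + 1 + l) (ℕₚ.+-identityʳ (k + 1)))
    -- A single form already forces ε ≤ 1.
    e≼1 : ε ^ᴿ M ≼ ι 1ℚ
    e≼1 = begin
      ε ^ᴿ M                       ≈⟨ R.*-identityˡ _ ⟨
      ν 1 ⊗ ε ^ᴿ M                 ≲⟨ ν-cancelˡ 0 (spectrum-bound ε 0≼ε f f≼1 0 (λ _ → μ zero) (λ _ → spec zero) (ι 0ℚ)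
                                         λ { zero zero 0≢0 → contradiction ≡.refl 0≢0 }) ⟩
      ι 1ℚ ⊕ ν 0 ⊗ ι 0ℚ             ≈⟨ R.+-congˡ (R.zeroˡ _) ⟩
      ι 1ℚ ⊕ ι 0ℚ                   ≈⟨ R.+-identityʳ _ ⟩
      ι 1ℚ                          ∎
      where open ≼-Reasoning

theorem32 : ∀ {a b} (p : ℕ) (p-prime : Prime p) →
    let instance p≢0 = prime⇒nonZero p-prime in
    (ω : ℂ) → IsExp2πi/ p ω →
    (k : ℕ) (G : Fin k → Module (𝔽 p) a b) (fd : ∀ i → FiniteDimensional (G i)) →
    let open Box p ω G fd in
    (ε : ℝ) (0<ε : 0ʳ <ʳ ε) →
    (f : Tuple G → ℂ) → (∀ x y → _≋_ G x y → f x ≈ᶜ f y) → (∀ x → InUnitDisc (f x)) →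
    (n : ℕ) (μ : Fin n → MultilinearForm G) →
    (∀ i → Specᵐˡ ε f (μ i)) →
    (∀ i j → i ≢ j →
    re (bias (λ x → ⟦ μ i ⟧ x ℤ.- ⟦ μ j ⟧ x)) ≤ʳ (ε *ʳ fromℚ (ℤ.1ℤ ℚ./ 1000)) ^ʳ (2 ^ (2 * k + 2))) →
    ∀ N → IsCeiling (fromℤ (ℤ.+ 10) *ʳ inv ε 0<ε ^ʳ (2 ^ (k + 1))) N →
    ℤ.+ n ℤ.< N
theorem32 p p-prime ω exp k G fd ε 0<ε f _ f∈D n μ spec small N (10/e≤N , _) =
  -- The order on ℤ is decidable, so it suffices to refute N ≤ n, which would give 10 ≤ N εᴹ ≤ n εᴹ
  -- ≤ 2 with M = 2^{k+1}. Returning from reals to rationals costs a tolerance, here 1, and 10 ≤ 2 +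
  -- 1 is false by computation.
  decidable-stable (+ n ℤₚ.<? N) λ n≮N → contradiction (ι-reflect (10≼2 n≮N) 1ℚ (ℚₚ.positive⁻¹ 1ℚ))
    (from-no ((+ 10 ℚ./ 1) ℚₚ.≤? (+ 2 ℚ./ 1) ℚ.+ 1ℚ))
  where
  open ≼-Reasoning
  0≼ε : ι 0ℚ ≼ ε
  0≼ε = subst (_≼ ε) (fromℚ-ι 0ℚ) (<ʳ⇒≼ 0<ε)
  power : ∀ c m → (ε *ʳ fromℚ c) ^ʳ m ≡ (ε ⊗ ι c) ^ᴿ m
  power c m = ≡.trans (^ʳ-^ (ε *ʳ fromℚ c) m) (cong (_^ᴿ m) (≡.trans (*ʳ-⊗ ε (fromℚ c)) (cong (ε ⊗_) (fromℚ-ι c))))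
  -- The instance is written out since an instance argument still to be resolved
  -- would make the checker unfold the product of reals.
  small′ : ∀ i j → i ≢ j → re (Box.bias p {{prime⇒nonZero p-prime}} ω G fd (λ x → ⟦ μ i ⟧ x ℤ.- ⟦ μ j ⟧ x))
                            ≼ (ε ⊗ ι (1ℤ ℚ./ 1000)) ^ᴿ (2 ^ (2 * k + 2))
  small′ i j i≢j = subst (re (Box.bias p {{prime⇒nonZero p-prime}} ω G fd (λ x → ⟦ μ i ⟧ x ℤ.- ⟦ μ j ⟧ x)) ≼_)
    (power (ℚ._/_ 1ℤ 1000 {{record { nonZero = tt }}}) (2 ^ (2 * k + 2))) (mk≼ (small i j i≢j))
  count : ν n ⊗ ε ^ᴿ (2 ^ (k + 1)) ≼ ι (+ 2 ℚ./ 1)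
  count = count≼2 p {{prime⇒nonZero p-prime}} ω exp G fd ε 0≼ε f
    (λ x → unit-disc p {{prime⇒nonZero p-prime}} ω exp G fd (f x) (f∈D x)) n μ spec small′
  10≼2 : ¬ (+ n ℤ.< N) → ι (+ 10 ℚ./ 1) ≼ ι (+ 2 ℚ./ 1)
  10≼2 n≮N = begin
    ι (+ 10 ℚ./ 1)                    ≲⟨ ceiling-bound ε 0<ε (2 ^ (k + 1)) N 10/e≤N 0≼ε ⟩
    ι (N ℚ./ 1) ⊗ ε ^ᴿ (2 ^ (k + 1))  ≲⟨ ⊗-monoʳ-≼ (^-nonNeg (2 ^ (k + 1)) 0≼ε) (ι-mono (/1-mono (ℤₚ.≮⇒≥ n≮N))) ⟩
    ν n ⊗ ε ^ᴿ (2 ^ (k + 1))          ≲⟨ count ⟩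
    ι (+ 2 ℚ./ 1)                     ∎
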